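{- Let $v \equiv 0$ or $4 \pmod{12}$ and let $\lambda$ be an even integer with $2 \le \lambda \le v-2$. Then there exists a simple ${\rm TS}(v,\lambda)$ which has a cyclic $2$-intersecting Gray code; equivalently, there is a simple ${\rm TS}(v,\lambda)$ whose $2$-block intersection graph is Hamiltonian.
   Context: A triple system ${\rm TS}(v,\lambda)$ is a pair $(V,\mathcal{B})$ where $|V|=v$ and $\mathcal{B}$ is a collection of $3$-element subsets (blocks) of $V$ such that every pair of distinct points of $V$ lies in exactly $\lambda$ blocks. It is simple if no block is repeated. The $2$-block intersection graph ($2$-BIG) of a ${\rm TS}(v,\lambda)$ has the blocks as vertices, two blocks being adjacent if they share exactly two points. A cyclic $2$-intersecting Gray code is a cyclic ordering of all blocks in which each pair of cyclically consecutive blocks shares exactly two points, i.e. a Hamilton cycle of the $2$-BIG. (For $v \equiv 0,4 \pmod{12}$, a simple ${\rm TS}(v,\lambda)$ exists exactly when $\lambda$ is even and $\lambda\le v-2$.) -}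

module Defs where

open import Data.Nat using (ℕ; zero; suc; _<_; _≤_; _+_; _%_)
open import Data.Nat.Properties using (_≟_)
open import Data.Fin using (Fin; toℕ)
open import Data.Fin.Properties as FinP using ()
open import Data.List using (List; []; _∷_; length; filter; allFin; head; last)
open import Data.List.Relation.Unary.Unique.Propositional using (Unique)
open import Data.Product using (_×_; _,_; Σ; proj₁; proj₂)
open import Data.Sum using (_⊎_)
open import Data.Unit using (⊤)
open import Data.Maybe using (Maybe; just; nothing)
open import Relation.Nullary using (Dec; yes; no)
open import Relation.Nullary.Decidable using (_×-dec_; _⊎-dec_)
open import Relation.Binary.PropositionalEquality using (_≡_)

-- A block (3-element subset of V = Fin v) represented canonically as an
-- ordered triple a < b < c.
record Block (v : ℕ) : Set where
  constructor block
  field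
    a b c : Fin v
    a<b : toℕ a < toℕ b
    b<c : toℕ b < toℕ c

_∈B_ : {v : ℕ} → Fin v → Block v → Set
x ∈B B = (x ≡ Block.a B) ⊎ (x ≡ Block.b B) ⊎ (x ≡ Block.c B)

_∈B?_ : {v : ℕ} (x : Fin v) (B : Block v) → Dec (x ∈B B)
x ∈B? B = (x FinP.≟ Block.a B) ⊎-dec ((x FinP.≟ Block.b B) ⊎-dec (x FinP.≟ Block.c B))

pairCount : {v : ℕ} → List (Block v) → Fin v → Fin v → ℕ
pairCount Bs x y = length (filter (λ B → (x ∈B? B) ×-dec (y ∈B? B)) Bs)

intersectionSize : {v : ℕ} → Block v → Block v → ℕ
intersectionSize {v} B C = length (filter (λ x → (x ∈B? B) ×-dec (x ∈B? C)) (allFin v))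

-- A TS(v, λ) on point set Fin v, with block collection given as a list
-- (a multiset): every pair of distinct points lies in exactly λ blocks.
IsTS : (v λ' : ℕ) → List (Block v) → Set
IsTS v λ' Bs = (x y : Fin v) → toℕ x < toℕ y → pairCount Bs x y ≡ λ'

IsSimple : {v : ℕ} → List (Block v) → Set
IsSimple Bs = Unique Bs

Adjacent2 : {v : ℕ} → Block v → Block v → Set
Adjacent2 B C = intersectionSize B C ≡ 2

data Chain {v : ℕ} : List (Block v) → Set where
  chain-[] : Chain []
  chain-[-] : (B : Block v) → Chain (B ∷ [])
  chain-∷ : (B C : Block v) (Bs : List (Block v)) →
            Adjacent2 B C → Chain (C ∷ Bs) → Chain (B ∷ C ∷ Bs)

LastAdj : {v : ℕ} → Block v → List (Block v) → Set
LastAdj B₀ [] = ⊤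
LastAdj B₀ (C ∷ []) = Adjacent2 C B₀
LastAdj B₀ (C ∷ D ∷ Ds) = LastAdj B₀ (D ∷ Ds)

CyclicChain : {v : ℕ} → List (Block v) → Set
CyclicChain [] = ⊤
CyclicChain (B ∷ Bs) = Chain (B ∷ Bs) × LastAdj B (B ∷ Bs)

open import Data.List.Relation.Binary.Permutation.Propositional using (_↭_)

HasCyclicGrayCode : {v : ℕ} → List (Block v) → Set
HasCyclicGrayCode Bs = Σ (List _) λ order → (order ↭ Bs) × CyclicChain order

{-# OPTIONS --safe #-}

-- A cyclic Gray code is a closed walk in the graph whose vertices are the pairs
-- of points and in which every block is an edge between two of its pairs. Closed
-- walks through a common pair merge, so it is enough to cut the blocks into
-- small closed walks that hang together.
--
-- For λ = 2 k ≥ 4 write v = 2 m + 2 with m prime to 6 and take two copies of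
-- ℤ_m ∪ {∞} as points. Every triple gets a class in ℤ_m (a + b + c for a triple
-- over distinct a, b, c) such that each pair lies in exactly two triples of each
-- class; the triples of class < k are the blocks. The eight triples over a, b, c
-- form a closed walk, and the triples over only two residues are joined into
-- closed walks by pairing the classes 2 j and 2 j + 1. What is left over is
-- inserted one block at a time.
--
-- For λ = 2 nothing can be merged, since every pair lies in two blocks only.
-- There the blocks are the translates of two ladders (all blocks {x, w_j, w_j+1}
-- over a path w, with two apexes x) and of a few linking triples, over ℤ_v for
-- v = 12 u + 4 and over ℤ_(v-1) ∪ {∞} for v = 12 u. A list of v (v - 1) / 3
-- blocks in which every pair lies in two different ones is a simple TS(v, 2).
module Submission where

-- The triples of class `i` on a finite point and a point at infinity require a solution of
-- `2 c + a = i` in ℤ_m, those on both points at infinity one of `3 a = i`; hence `m` prime to 6.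
-- The `m` classes put `2 m = v - 2` triples on each pair, so they exhaust all triples, and a pair
-- is shown to lie in at most `2 k` blocks by exhibiting its triples in the other classes. A triple
-- over ∞, `a`, `b` could be counted as double in `a` or in `b`; a parity of its three bits decides,
-- so that exactly one of the two applies.
--
-- The ladders come from differences. A zigzag path over an interval has the differences 1, 2, 3,
-- ... between neighbours; the distances from its vertices to the two apexes fill the next two
-- intervals, so every difference up to half the modulus occurs. All pairs of a ladder lie in two of
-- its cells except the rungs at its ends. The linking triples have differences of such end rungs,
-- and so serve both to complete the design and to lead from one ladder to another.

-- Linear arithmetic over ℕ: the negation of a formula is refuted by
-- Fourier–Motzkin elimination over ℤ.
module Lia where

  open import Data.Nat as ℕ using (ℕ; zero; suc)
  import Data.Nat.Properties as ℕ
  open import Data.Integer as ℤ using (ℤ; +_; -[1+_]; 0ℤ; 1ℤ)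
  import Data.Integer.Properties as ℤ
  open import Data.Integer.Tactic.RingSolver using (solve-∀)
  open import Data.List using (List; []; _∷_; _++_; map; concatMap; replicate)
  open import Data.List.Relation.Unary.All as All using (All; []; _∷_)
  import Data.List.Relation.Unary.All.Properties as All
  open import Data.List.Relation.Unary.Any as Any using (Any; here; there)
  import Data.List.Relation.Unary.Any.Properties as Any
  open import Data.Bool using (Bool; true; false; T; if_then_else_)
  open import Data.Product using (_×_; _,_; proj₁; proj₂)
  open import Data.Sum using (_⊎_; inj₁; inj₂)
  open import Data.Empty using (⊥; ⊥-elim)
  open import Relation.Nullary using (¬_; Dec; yes; no)
  open import Relation.Nullary.Decidable using (_×-dec_; _⊎-dec_; _→-dec_)
  open import Relation.Binary.PropositionalEquality
  open import Relation.Binary using (tri<; tri≈; tri>)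
  open import Function using (_∘_)

  infixl 7 _:+_
  infixr 8 _:*_
  infix 6 _:≤_ _:<_ _:≡_
  infixr 5 _:∧_
  infixr 4 _:∨_
  infixr 3 _:⇒_

  data Term : Set where
    var  : ℕ → Term
    lit  : ℕ → Term
    _:+_ : Term → Term → Term
    _:*_ : ℕ → Term → Term

  data Formula : Set where
    :⊥              : Formula
    _:≤_ _:<_ _:≡_  : Term → Term → Formula
    _:∧_ _:∨_ _:⇒_  : Formula → Formula → Formula

  valueAt : List ℕ → ℕ → ℕ
  valueAt []       _       = 0
  valueAt (x ∷ _)  zero    = x
  valueAt (_ ∷ xs) (suc i) = valueAt xs i

  ⟦_⟧ᵗ : Term → List ℕ → ℕ
  ⟦ var i ⟧ᵗ ρ  = valueAt ρ i
  ⟦ lit k ⟧ᵗ ρ  = k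
  ⟦ s :+ t ⟧ᵗ ρ = ⟦ s ⟧ᵗ ρ ℕ.+ ⟦ t ⟧ᵗ ρ
  ⟦ k :* t ⟧ᵗ ρ = k ℕ.* ⟦ t ⟧ᵗ ρ

  ⟦_⟧ : Formula → List ℕ → Set
  ⟦ :⊥ ⟧ ρ     = ⊥
  ⟦ s :≤ t ⟧ ρ = ⟦ s ⟧ᵗ ρ ℕ.≤ ⟦ t ⟧ᵗ ρ
  ⟦ s :< t ⟧ ρ = ⟦ s ⟧ᵗ ρ ℕ.< ⟦ t ⟧ᵗ ρ
  ⟦ s :≡ t ⟧ ρ = ⟦ s ⟧ᵗ ρ ≡ ⟦ t ⟧ᵗ ρ
  ⟦ f :∧ g ⟧ ρ = ⟦ f ⟧ ρ × ⟦ g ⟧ ρ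
  ⟦ f :∨ g ⟧ ρ = ⟦ f ⟧ ρ ⊎ ⟦ g ⟧ ρ
  ⟦ f :⇒ g ⟧ ρ = ⟦ f ⟧ ρ → ⟦ g ⟧ ρ

  decide : ∀ f ρ → Dec (⟦ f ⟧ ρ)
  decide :⊥ ρ       = no λ ()
  decide (s :≤ t) ρ = _ ℕ.≤? _
  decide (s :< t) ρ = _ ℕ.<? _
  decide (s :≡ t) ρ = _ ℕ.≟ _
  decide (f :∧ g) ρ = decide f ρ ×-dec decide g ρ
  decide (f :∨ g) ρ = decide f ρ ⊎-dec decide g ρ
  decide (f :⇒ g) ρ = decide f ρ →-dec decide g ρ

  -- A linear form is the list of the coefficients of the variables followed by
  -- the constant term, to be evaluated at the variables followed by 1.
  Linear : Set
  Linear = List ℤ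

  dot : Linear → List ℤ → ℤ
  dot (c ∷ cs) (x ∷ xs) = c ℤ.* x ℤ.+ dot cs xs
  dot _        _        = 0ℤ

  add : Linear → Linear → Linear
  add (c ∷ cs) (d ∷ ds) = c ℤ.+ d ∷ add cs ds
  add []       ds       = ds
  add cs       []       = cs

  scale : ℤ → Linear → Linear
  scale k = map (k ℤ.*_)

  dot-add : ∀ c d ρ → dot (add c d) ρ ≡ dot c ρ ℤ.+ dot d ρ
  dot-add (c ∷ cs) (d ∷ ds) (x ∷ ρ) rewrite dot-add cs ds ρ = ring c d x (dot cs ρ) (dot ds ρ)
    where
    ring : ∀ c d x y z → (c ℤ.+ d) ℤ.* x ℤ.+ (y ℤ.+ z) ≡ (c ℤ.* x ℤ.+ y) ℤ.+ (d ℤ.* x ℤ.+ z)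
    ring = solve-∀
  dot-add (c ∷ cs) (d ∷ ds) []      = refl
  dot-add (c ∷ cs) []       ρ       = sym (ℤ.+-identityʳ _)
  dot-add []       ds       ρ       = sym (ℤ.+-identityˡ _)

  dot-scale : ∀ k c ρ → dot (scale k c) ρ ≡ k ℤ.* dot c ρ
  dot-scale k []       ρ       = sym (ℤ.*-zeroʳ k)
  dot-scale k (c ∷ cs) []      = sym (ℤ.*-zeroʳ k)
  dot-scale k (c ∷ cs) (x ∷ ρ) rewrite dot-scale k cs ρ = ring k c x (dot cs ρ)
    where
    ring : ∀ k c x y → (k ℤ.* c) ℤ.* x ℤ.+ k ℤ.* y ≡ k ℤ.* (c ℤ.* x ℤ.+ y)
    ring = solve-∀

  data Constraint : Set where
    _≥0 _=0 : Linear → Constraint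

  Holds : List ℤ → Constraint → Set
  Holds ρ (l ≥0) = 0ℤ ℤ.≤ dot l ρ
  Holds ρ (l =0) = 0ℤ ≡ dot l ρ

  System : Set
  System = List Constraint

  combine : ℕ → Linear → ℕ → Linear → Linear
  combine m c n d = add (scale (+ m) c) (scale (+ n) d)

  dot-combine : ∀ m c n d ρ → dot (combine m c n d) ρ ≡ + m ℤ.* dot c ρ ℤ.+ + n ℤ.* dot d ρ
  dot-combine m c n d ρ = trans (dot-add (scale (+ m) c) _ ρ) (cong₂ ℤ._+_ (dot-scale (+ m) c ρ) (dot-scale (+ n) d ρ))

  *-nonneg : ∀ m {i} → 0ℤ ℤ.≤ i → 0ℤ ℤ.≤ + m ℤ.* i
  *-nonneg m {i} h = subst (ℤ._≤ + m ℤ.* i) (ℤ.*-zeroʳ (+ m)) (ℤ.*-monoˡ-≤-nonNeg (+ m) h)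

  combine-≥ : ∀ m c n d ρ → Holds ρ (c ≥0) → Holds ρ (d ≥0) → Holds ρ (combine m c n d ≥0)
  combine-≥ m c n d ρ hc hd rewrite dot-combine m c n d ρ = ℤ.+-mono-≤ (*-nonneg m hc) (*-nonneg n hd)

  combine-= : ∀ m c n d ρ → Holds ρ (c =0) → Holds ρ (d =0) → Holds ρ (combine m c n d =0)
  combine-= m c n d ρ hc hd rewrite dot-combine m c n d ρ | sym hc | sym hd | ℤ.*-zeroʳ (+ m) | ℤ.*-zeroʳ (+ n) = refl

  flip-= : ∀ c ρ → Holds ρ (c =0) → Holds ρ (scale (ℤ.- 1ℤ) c =0)
  flip-= c ρ h rewrite dot-scale (ℤ.- 1ℤ) c ρ | sym h = refl

  weaken-= : ∀ c ρ → Holds ρ (c =0) → Holds ρ (c ≥0)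
  weaken-= c ρ h = ℤ.≤-reflexive h

  head₀ : Linear → ℤ
  head₀ []      = 0ℤ
  head₀ (c ∷ _) = c

  data Sign : Set where
    neg zer pos : ℕ → Sign

  signOf : ℤ → Sign
  signOf (+ zero)  = zer 0
  signOf (+ suc n) = pos (suc n)
  signOf -[1+ n ]  = neg (suc n)

  -- An equation whose leading coefficient is + n.
  findPivot : System → List (ℕ × Linear)
  findPivot []            = []
  findPivot ((l ≥0) ∷ cs) = findPivot cs
  findPivot ((l =0) ∷ cs) with signOf (head₀ l)
  ... | pos n = (n , l) ∷ []
  ... | neg n = (n , scale (ℤ.- 1ℤ) l) ∷ []
  ... | zer _ = findPivot cs

  findPivot-sound : ∀ cs ρ → All (Holds ρ) cs → All (λ p → Holds ρ (proj₂ p =0)) (findPivot cs)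
  findPivot-sound []            ρ []       = []
  findPivot-sound ((l ≥0) ∷ cs) ρ (h ∷ hs) = findPivot-sound cs ρ hs
  findPivot-sound ((l =0) ∷ cs) ρ (h ∷ hs) with signOf (head₀ l)
  ... | pos n = h ∷ []
  ... | neg n = flip-= l ρ h ∷ []
  ... | zer _ = findPivot-sound cs ρ hs

  -- The equation `p` has leading coefficient `+ n`. Scaling `l` by `n` and adding a multiple of `p`
  -- or `- p` cancels the leading terms; since `l` gets a nonnegative factor, an inequality
  -- survives.
  reduceBy : ℕ → Linear → Constraint → Constraint
  reduceBy n p (l ≥0) with signOf (head₀ l)
  ... | pos k = combine n l k (scale (ℤ.- 1ℤ) p) ≥0
  ... | neg k = combine n l k p ≥0
  ... | zer _ = l ≥0
  reduceBy n p (l =0) with signOf (head₀ l)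
  ... | pos k = combine n l k (scale (ℤ.- 1ℤ) p) =0
  ... | neg k = combine n l k p =0
  ... | zer _ = l =0

  reduceBy-sound : ∀ n p c ρ → Holds ρ (p =0) → Holds ρ c → Holds ρ (reduceBy n p c)
  reduceBy-sound n p (l ≥0) ρ hp h with signOf (head₀ l)
  ... | pos k = combine-≥ n l k _ ρ h (weaken-= (scale (ℤ.- 1ℤ) p) ρ (flip-= p ρ hp))
  ... | neg k = combine-≥ n l k p ρ h (weaken-= p ρ hp)
  ... | zer _ = h
  reduceBy-sound n p (l =0) ρ hp h with signOf (head₀ l)
  ... | pos k = combine-= n l k _ ρ h (flip-= p ρ hp)
  ... | neg k = combine-= n l k p ρ h hp
  ... | zer _ = h

  -- A Fourier-Motzkin step: a lower bound of the leading variable from `l` meets each upper bound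
  -- from `ds`. Equations are passed over: this is only reached when no equation has a nonzero
  -- leading coefficient.
  against : Constraint → System → System
  against (l =0) ds = []
  against (l ≥0) [] = []
  against (l ≥0) ((_ =0) ∷ ds) = against (l ≥0) ds
  against (l ≥0) ((d ≥0) ∷ ds) with signOf (head₀ l) | signOf (head₀ d)
  ... | pos m | neg n = (combine n l m d ≥0) ∷ against (l ≥0) ds
  ... | _     | _     = against (l ≥0) ds

  against-sound : ∀ c ds ρ → Holds ρ c → All (Holds ρ) ds → All (Holds ρ) (against c ds)
  against-sound (l =0) ds ρ h hs = []
  against-sound (l ≥0) [] ρ h hs = []
  against-sound (l ≥0) ((_ =0) ∷ ds) ρ h (_ ∷ hs) = against-sound (l ≥0) ds ρ h hs
  against-sound (l ≥0) ((d ≥0) ∷ ds) ρ h (h′ ∷ hs) with signOf (head₀ l) | signOf (head₀ d)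
  ... | pos m | neg n = combine-≥ n l m d ρ h h′ ∷ against-sound (l ≥0) ds ρ h hs
  ... | pos _ | zer _ = against-sound (l ≥0) ds ρ h hs
  ... | pos _ | pos _ = against-sound (l ≥0) ds ρ h hs
  ... | neg _ | _     = against-sound (l ≥0) ds ρ h hs
  ... | zer _ | _     = against-sound (l ≥0) ds ρ h hs

  trivial : Linear → Bool
  trivial []              = true
  trivial (+ n ∷ [])      = true
  trivial (+ zero ∷ cs)   = trivial cs
  trivial _               = false

  -- Constraints that still mention the leading variable are discarded, which is sound since a
  -- refutation may ignore hypotheses. Inequalities that have become `0 ≤ n` go too, to limit the
  -- growth of the system.
  dropHead : System → System
  dropHead [] = []
  dropHead (((+ zero ∷ l′) ≥0) ∷ cs) = if trivial l′ then dropHead cs else (l′ ≥0) ∷ dropHead cs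
  dropHead (((+ zero ∷ l) =0) ∷ cs) = (l =0) ∷ dropHead cs
  dropHead (_ ∷ cs) = dropHead cs

  drop-zero : ∀ x d → 0ℤ ℤ.* x ℤ.+ d ≡ d
  drop-zero x d = trans (cong (ℤ._+ d) (ℤ.*-zeroˡ x)) (ℤ.+-identityˡ d)

  dropHead-sound : ∀ cs x ρ → All (Holds (x ∷ ρ)) cs → All (Holds ρ) (dropHead cs)
  dropHead-sound [] x ρ hs = []
  dropHead-sound (((+ zero ∷ l) ≥0) ∷ cs) x ρ (h ∷ hs) with trivial l
  ... | true  = dropHead-sound cs x ρ hs
  ... | false = subst (0ℤ ℤ.≤_) (drop-zero x _) h ∷ dropHead-sound cs x ρ hs
  dropHead-sound (((+ zero ∷ l) =0) ∷ cs) x ρ (h ∷ hs) = trans h (drop-zero x _) ∷ dropHead-sound cs x ρ hs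
  dropHead-sound (([] ≥0) ∷ cs) x ρ (h ∷ hs) = dropHead-sound cs x ρ hs
  dropHead-sound (([] =0) ∷ cs) x ρ (h ∷ hs) = dropHead-sound cs x ρ hs
  dropHead-sound (((+ suc n ∷ l) ≥0) ∷ cs) x ρ (h ∷ hs) = dropHead-sound cs x ρ hs
  dropHead-sound (((+ suc n ∷ l) =0) ∷ cs) x ρ (h ∷ hs) = dropHead-sound cs x ρ hs
  dropHead-sound (((-[1+ n ] ∷ l) ≥0) ∷ cs) x ρ (h ∷ hs) = dropHead-sound cs x ρ hs
  dropHead-sound (((-[1+ n ] ∷ l) =0) ∷ cs) x ρ (h ∷ hs) = dropHead-sound cs x ρ hs

  eliminate : System → System
  eliminate cs with findPivot cs
  ... | (n , p) ∷ _ = dropHead (map (reduceBy n p) cs)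
  ... | []          = dropHead (cs ++ concatMap (λ c → against c cs) cs)

  eliminate-sound : ∀ cs x ρ → All (Holds (x ∷ ρ)) cs → All (Holds ρ) (eliminate cs)
  eliminate-sound cs x ρ hs with findPivot cs | findPivot-sound cs (x ∷ ρ) hs
  ... | (n , p) ∷ _ | hp ∷ _ =
    dropHead-sound _ x ρ (All.map⁺ (All.map (reduceBy-sound n p _ (x ∷ ρ) hp) hs))
  ... | [] | _ = dropHead-sound _ x ρ (All.++⁺ hs (All.concat⁺ (All.map⁺ (All.map (λ h → against-sound _ cs (x ∷ ρ) h hs) hs))))

  absurd? : Constraint → Bool
  absurd? ((-[1+ _ ] ∷ []) ≥0)   = true
  absurd? ((-[1+ _ ] ∷ []) =0)   = true
  absurd? ((+ suc _ ∷ []) =0)    = true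
  absurd? _                      = false

  absurd-sound : ∀ c → T (absurd? c) → ¬ Holds (1ℤ ∷ []) c
  absurd-sound ((-[1+ zero ] ∷ []) ≥0) _ ()
  absurd-sound ((-[1+ suc _ ] ∷ []) ≥0) _ ()
  absurd-sound ((-[1+ zero ] ∷ []) =0) _ ()
  absurd-sound ((-[1+ suc _ ] ∷ []) =0) _ ()
  absurd-sound ((+ suc _ ∷ []) =0) _ ()

  anyAbsurd : System → Bool
  anyAbsurd []       = false
  anyAbsurd (c ∷ cs) = if absurd? c then true else anyAbsurd cs

  anyAbsurd-sound : ∀ cs → T (anyAbsurd cs) → ¬ All (Holds (1ℤ ∷ [])) cs
  anyAbsurd-sound (c ∷ cs) t (h ∷ hs) with absurd? c in eq
  ... | true  = absurd-sound c (subst T (sym eq) t) h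
  ... | false = anyAbsurd-sound cs t hs

  refute : ℕ → System → Bool
  refute zero    cs = anyAbsurd cs
  refute (suc n) cs = refute n (eliminate cs)

  values : List ℕ → List ℤ
  values ρ = map +_ ρ ++ 1ℤ ∷ []

  refute-sound : ∀ ρ cs → T (refute (Data.List.length ρ) cs) → ¬ All (Holds (values ρ)) cs
  refute-sound []      cs t hs = anyAbsurd-sound cs t hs
  refute-sound (x ∷ ρ) cs t hs = refute-sound ρ _ t (eliminate-sound cs (+ x) (values ρ) hs)

  unit : ℕ → ℕ → Linear
  unit zero    _       = 0ℤ ∷ []
  unit (suc n) zero    = 1ℤ ∷ []
  unit (suc n) (suc i) = 0ℤ ∷ unit n i

  constant : ℕ → ℤ → Linear
  constant n k = replicate n 0ℤ ++ k ∷ []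

  linear : ℕ → Term → Linear
  linear n (var i)  = unit n i
  linear n (lit k)  = constant n (+ k)
  linear n (s :+ t) = add (linear n s) (linear n t)
  linear n (k :* t) = scale (+ k) (linear n t)

  private
    len : List ℕ → ℕ
    len = Data.List.length

  dot-unit : ∀ ρ i → dot (unit (len ρ) i) (values ρ) ≡ + valueAt ρ i
  dot-unit []      i       = refl
  dot-unit (x ∷ ρ) zero    = trans (ℤ.+-identityʳ _) (ℤ.*-identityˡ (+ x))
  dot-unit (x ∷ ρ) (suc i) = trans (drop-zero (+ x) _) (dot-unit ρ i)

  dot-constant : ∀ ρ k → dot (constant (len ρ) k) (values ρ) ≡ k
  dot-constant []      k = trans (ℤ.+-identityʳ _) (ℤ.*-identityʳ k)
  dot-constant (x ∷ ρ) k = trans (drop-zero (+ x) _) (dot-constant ρ k)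

  dot-linear : ∀ ρ t → dot (linear (len ρ) t) (values ρ) ≡ + ⟦ t ⟧ᵗ ρ
  dot-linear ρ (var i)  = dot-unit ρ i
  dot-linear ρ (lit k)  = dot-constant ρ (+ k)
  dot-linear ρ (s :+ t) = trans (dot-add (linear (len ρ) s) _ (values ρ)) (cong₂ ℤ._+_ (dot-linear ρ s) (dot-linear ρ t))
  dot-linear ρ (k :* t) = trans (dot-scale (+ k) (linear (len ρ) t) (values ρ))
    (trans (cong (+ k ℤ.*_) (dot-linear ρ t)) (sym (ℤ.pos-* k _)))

  -- The form `t - s - k`. Taking `k = 1` turns a strict inequality into a weak one; this is the
  -- only place where integrality enters, the elimination itself being valid over the rationals.
  difference : ℕ → Term → Term → ℕ → Linear
  difference n s t k = add (add (linear n t) (scale (ℤ.- 1ℤ) (linear n s))) (constant n (ℤ.- (+ k)))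

  dot-difference : ∀ ρ s t k → dot (difference (len ρ) s t k) (values ρ) ≡ (+ ⟦ t ⟧ᵗ ρ ℤ.- + ⟦ s ⟧ᵗ ρ) ℤ.- + k
  dot-difference ρ s t k = trans (dot-add (add (linear n t) (scale (ℤ.- 1ℤ) (linear n s))) _ v)
    (cong₂ ℤ._+_ (trans (dot-add (linear n t) _ v) (cong₂ ℤ._+_ (dot-linear ρ t)
       (trans (dot-scale (ℤ.- 1ℤ) (linear n s) v) (trans (cong (ℤ.- 1ℤ ℤ.*_) (dot-linear ρ s)) (ℤ.-1*i≡-i _)))))
     (dot-constant ρ _))
    where n = len ρ
          v = values ρ

  difference-≤ : ∀ ρ s t → ⟦ s ⟧ᵗ ρ ℕ.≤ ⟦ t ⟧ᵗ ρ → Holds (values ρ) (difference (len ρ) s t 0 ≥0)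
  difference-≤ ρ s t h rewrite dot-difference ρ s t 0 =
    subst (0ℤ ℤ.≤_) (sym (ℤ.+-identityʳ _)) (ℤ.i≤j⇒0≤j-i (ℤ.+≤+ h))

  difference-< : ∀ ρ s t → ⟦ s ⟧ᵗ ρ ℕ.< ⟦ t ⟧ᵗ ρ → Holds (values ρ) (difference (len ρ) s t 1 ≥0)
  difference-< ρ s t h rewrite dot-difference ρ s t 1 =
    subst (0ℤ ℤ.≤_) (ring (+ ⟦ s ⟧ᵗ ρ) (+ ⟦ t ⟧ᵗ ρ)) (ℤ.i≤j⇒0≤j-i (ℤ.+≤+ h))
    where
    ring : ∀ s t → t ℤ.- (1ℤ ℤ.+ s) ≡ (t ℤ.- s) ℤ.- 1ℤ
    ring = solve-∀

  difference-≡ : ∀ ρ s t → ⟦ s ⟧ᵗ ρ ≡ ⟦ t ⟧ᵗ ρ → Holds (values ρ) (difference (len ρ) s t 0 =0)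
  difference-≡ ρ s t h rewrite dot-difference ρ s t 0 | h = sym (trans (ℤ.+-identityʳ _) (ℤ.i≡j⇒i-j≡0 (refl {x = + ⟦ t ⟧ᵗ ρ})))

  DNF : Set
  DNF = List System

  Sat : List ℕ → DNF → Set
  Sat ρ = Any (All (Holds (values ρ)))

  conj : DNF → DNF → DNF
  conj xs ys = concatMap (λ x → map (x ++_) ys) xs

  conj-sound : ∀ ρ xs ys → Sat ρ xs → Sat ρ ys → Sat ρ (conj xs ys)
  conj-sound ρ xs ys p q = Any.concat⁺ (Any.map⁺ (Any.map (λ a → Any.map⁺ (Any.map (All.++⁺ a) q)) p))

  positive negative : ℕ → Formula → DNF
  positive n :⊥       = []
  positive n (s :≤ t) = ((difference n s t 0 ≥0) ∷ []) ∷ []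
  positive n (s :< t) = ((difference n s t 1 ≥0) ∷ []) ∷ []
  positive n (s :≡ t) = ((difference n s t 0 =0) ∷ []) ∷ []
  positive n (f :∧ g) = conj (positive n f) (positive n g)
  positive n (f :∨ g) = positive n f ++ positive n g
  positive n (f :⇒ g) = negative n f ++ positive n g
  negative n :⊥       = [] ∷ []
  negative n (s :≤ t) = ((difference n t s 1 ≥0) ∷ []) ∷ []
  negative n (s :< t) = ((difference n t s 0 ≥0) ∷ []) ∷ []
  negative n (s :≡ t) = ((difference n s t 1 ≥0) ∷ []) ∷ ((difference n t s 1 ≥0) ∷ []) ∷ []
  negative n (f :∧ g) = negative n f ++ negative n g
  negative n (f :∨ g) = conj (negative n f) (negative n g)
  negative n (f :⇒ g) = conj (positive n f) (negative n g)

  -- Implications become disjunctions and negations are pushed inwards as in classical logic; this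
  -- is legitimate because `decide` settles every formula at given values.
  positive-sound : ∀ ρ f → ⟦ f ⟧ ρ → Sat ρ (positive (len ρ) f)
  negative-sound : ∀ ρ f → ¬ ⟦ f ⟧ ρ → Sat ρ (negative (len ρ) f)
  positive-sound ρ (s :≤ t) h = here (difference-≤ ρ s t h ∷ [])
  positive-sound ρ (s :< t) h = here (difference-< ρ s t h ∷ [])
  positive-sound ρ (s :≡ t) h = here (difference-≡ ρ s t h ∷ [])
  positive-sound ρ (f :∧ g) (p , q) = conj-sound ρ _ _ (positive-sound ρ f p) (positive-sound ρ g q)
  positive-sound ρ (f :∨ g) (inj₁ p) = Any.++⁺ˡ (positive-sound ρ f p)
  positive-sound ρ (f :∨ g) (inj₂ q) = Any.++⁺ʳ (positive (len ρ) f) (positive-sound ρ g q)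
  positive-sound ρ (f :⇒ g) h with decide f ρ
  ... | yes p = Any.++⁺ʳ (negative (len ρ) f) (positive-sound ρ g (h p))
  ... | no ¬p = Any.++⁺ˡ (negative-sound ρ f ¬p)
  negative-sound ρ :⊥ h = here []
  negative-sound ρ (s :≤ t) h = here (difference-< ρ t s (ℕ.≰⇒> h) ∷ [])
  negative-sound ρ (s :< t) h = here (difference-≤ ρ t s (ℕ.≮⇒≥ h) ∷ [])
  negative-sound ρ (s :≡ t) h with ℕ.<-cmp (⟦ s ⟧ᵗ ρ) (⟦ t ⟧ᵗ ρ)
  ... | tri< p _ _ = here (difference-< ρ s t p ∷ [])
  ... | tri≈ _ p _ = ⊥-elim (h p)
  ... | tri> _ _ p = there (here (difference-< ρ t s p ∷ []))
  negative-sound ρ (f :∧ g) h with decide f ρ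
  ... | yes p = Any.++⁺ʳ (negative (len ρ) f) (negative-sound ρ g λ q → h (p , q))
  ... | no ¬p = Any.++⁺ˡ (negative-sound ρ f ¬p)
  negative-sound ρ (f :∨ g) h = conj-sound ρ _ _ (negative-sound ρ f (h ∘ inj₁)) (negative-sound ρ g (h ∘ inj₂))
  negative-sound ρ (f :⇒ g) h with decide f ρ
  ... | yes p = conj-sound ρ _ _ (positive-sound ρ f p) (negative-sound ρ g λ q → h λ _ → q)
  ... | no ¬p = ⊥-elim (h λ p → ⊥-elim (¬p p))

  pad : Constraint → Constraint
  pad (l ≥0) = (0ℤ ∷ l) ≥0
  pad (l =0) = (0ℤ ∷ l) =0

  nonnegatives : ℕ → System
  nonnegatives zero    = []
  nonnegatives (suc n) = ((1ℤ ∷ constant n 0ℤ) ≥0) ∷ map pad (nonnegatives n)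

  nonnegatives-sound : ∀ ρ → All (Holds (values ρ)) (nonnegatives (len ρ))
  nonnegatives-sound [] = []
  nonnegatives-sound (x ∷ ρ) = subst (0ℤ ℤ.≤_) (sym (trans (cong₂ ℤ._+_ (ℤ.*-identityˡ (+ x)) (dot-constant ρ 0ℤ)) (ℤ.+-identityʳ _))) (ℤ.+≤+ ℕ.z≤n)
    ∷ All.map⁺ (All.map (λ {c} → padded c) (nonnegatives-sound ρ))
    where
    padded : ∀ c → Holds (values ρ) c → Holds (values (x ∷ ρ)) (pad c)
    padded (l ≥0) h = subst (0ℤ ℤ.≤_) (sym (drop-zero (+ x) _)) h
    padded (l =0) h = trans h (sym (drop-zero (+ x) _))

  allRefuted : ℕ → DNF → Bool
  allRefuted n []       = true
  allRefuted n (s ∷ ss) = if refute n (nonnegatives n ++ s) then allRefuted n ss else false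

  allRefuted-sound : ∀ ρ ss → T (allRefuted (len ρ) ss) → ¬ Sat ρ ss
  allRefuted-sound ρ (s ∷ ss) t h with refute (len ρ) (nonnegatives (len ρ) ++ s) in eq
  allRefuted-sound ρ (s ∷ ss) t (here p)  | true = refute-sound ρ _ (subst T (sym eq) _) (All.++⁺ (nonnegatives-sound ρ) p)
  allRefuted-sound ρ (s ∷ ss) t (there h) | true = allRefuted-sound ρ ss t h

  -- Depends on the number of variables and not on their values, so it can be evaluated once for all
  -- instances of a formula.
  valid : ℕ → Formula → Bool
  valid n f = allRefuted n (negative n f)

  valid-sound : ∀ f ρ → T (valid (len ρ) f) → ⟦ f ⟧ ρ
  valid-sound f ρ t with decide f ρ
  ... | yes p = p
  ... | no ¬p = ⊥-elim (allRefuted-sound ρ _ t (negative-sound ρ f ¬p))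

  Open : ℕ → Set
  Open zero    = Formula
  Open (suc n) = Term → Open n

  close : ∀ n → ℕ → Open n → Formula
  close zero    i f = f
  close (suc n) i f = close n (suc i) (f (var i))

  -- New values are appended at the end, so that `var i` denotes the `i`-th argument. On a closed
  -- formula this unfolds to the quantified arithmetical statement itself.
  Universal : ℕ → List ℕ → (List ℕ → Set) → Set
  Universal zero    ρ P = P ρ
  Universal (suc n) ρ P = ∀ x → Universal n (ρ ++ x ∷ []) P

  universal : ∀ n ρ {P : List ℕ → Set} → (∀ ρ′ → len ρ′ ≡ len ρ ℕ.+ n → P ρ′) → Universal n ρ P
  universal zero    ρ h = h ρ (sym (ℕ.+-identityʳ _))
  universal (suc n) ρ h x = universal n (ρ ++ x ∷ []) λ ρ′ e → h ρ′ (trans e (trans (cong (ℕ._+ n) (Data.List.Properties.length-++ ρ)) (ℕ.+-assoc (len ρ) 1 n)))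
    where import Data.List.Properties

  -- The hidden argument has type `T true` as soon as the refutation succeeds and is then filled in
  -- by evaluation.
  lia : ∀ n (f : Open n) {_ : T (valid n (close n 0 f))} → Universal n [] ⟦ close n 0 f ⟧
  lia n f {t} = universal n [] λ ρ e → valid-sound (close n 0 f) ρ (subst (λ k → T (valid k (close n 0 f))) (sym e) t)

open import Data.Bool using (Bool; true; false; not; _xor_; T; if_then_else_)
import Data.Bool.Properties as Bool
open import Data.Empty using (⊥; ⊥-elim)
open import Data.Fin as Fin using (Fin; toℕ; fromℕ<)
import Data.Fin.Properties as Fin
open import Data.List using (mapMaybe; List; []; _∷_; _++_; map; concatMap; filter; length; upTo; allFin; cartesianProductWith; deduplicate)
import Data.List.Properties as List
open import Data.List.Membership.Propositional using (_∈_; lose; find)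
open import Data.List.Membership.Propositional.Properties
open import Data.List.Relation.Binary.Disjoint.Propositional using (Disjoint)
open import Data.List.Relation.Binary.Subset.Propositional using (_⊆_)
open import Data.List.Relation.Binary.Permutation.Propositional using (_↭_; ↭-refl; ↭-sym; ↭-trans; ↭-prep; ↭-reflexive; ↭⇒↭ₛ)
import Data.List.Relation.Binary.Permutation.Propositional.Properties as ↭
open import Data.List.Relation.Unary.All as All using (All; []; _∷_)
import Data.List.Relation.Unary.All.Properties as All
open import Data.List.Relation.Unary.AllPairs as AllPairs using ([]; _∷_)
open import Data.List.Relation.Unary.Any as Any using (Any; here; there)
import Data.List.Relation.Unary.Any.Properties as Any
open import Data.List.Relation.Unary.Unique.Propositional using (Unique)
import Data.List.Relation.Unary.Unique.Propositional.Properties as Unique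
open import Data.Maybe using (Maybe; just; nothing)
open import Data.Nat using (>-nonZero; ℕ; zero; _<ᵇ_; suc; _+_; _*_; _∸_; _≤_; _<_; _%_; _/_; z≤n; s≤s; s≤s⁻¹; ⌊_/2⌋; NonZero)
import Data.Nat.Properties as ℕ
import Data.Nat.DivMod as ℕ
open import Data.Nat.Tactic.RingSolver using (solve-∀)
open import Data.Nat.ListAction using (sum)
open import Data.Nat.ListAction.Properties using (sum-↭)
open import Data.Product using (Σ; ∃; ∃₂; _×_; _,_; proj₁; proj₂)
open import Data.Unit using (⊤)
open import Data.Sum using (_⊎_; inj₁; inj₂; [_,_]′)
open import Function using (_∘_; id; _⟨_⟩_)
open import Relation.Binary using (tri<; tri≈; tri>; DecidableEquality)
open import Relation.Binary.PropositionalEquality hiding ([_])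
open import Relation.Nullary using (¬_; Dec; yes; no)
open import Relation.Nullary.Decidable using (_×-dec_; _→-dec_; ¬?; map′; True; toWitness)
open import Defs
open Lia using (Term; lit; _:+_; _:*_; Formula; :⊥; _:≤_; _:<_; _:≡_; _:∧_; _:∨_; _:⇒_; lia)

-- Finite lists without repetition

module _ {A : Set} where

  ↭-unique : ∀ {xs ys : List A} → xs ↭ ys → Unique xs → Unique ys
  ↭-unique p = AllPairs-resp-↭ (λ ne → ne ∘ sym) ((λ { refl ne → ne }) , (λ { refl ne → ne })) (↭⇒↭ₛ p)
    where open import Data.List.Relation.Binary.Permutation.Setoid.Properties (setoid A) using (AllPairs-resp-↭)

  ∈-↭ : ∀ {x : A} {xs} → x ∈ xs → ∃ λ ys → xs ↭ x ∷ ys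
  ∈-↭ x∈ with ys , zs , refl ← ∈-∃++ x∈ = ys ++ zs , ↭.shift _ ys zs

  ⊆-uncons : ∀ {x : A} {xs ys zs} → Unique (x ∷ xs) → x ∷ xs ⊆ ys → ys ↭ x ∷ zs → xs ⊆ zs
  ⊆-uncons (x∉ ∷ _) sub p z∈ with ↭.∈-resp-↭ p (sub (there z∈))
  ... | here refl = ⊥-elim (All.lookup x∉ z∈ refl)
  ... | there z∈′ = z∈′

  unique-⊆-length : ∀ {xs ys : List A} → Unique xs → xs ⊆ ys → length xs ≤ length ys
  unique-⊆-length {[]}     _ _   = z≤n
  unique-⊆-length {x ∷ xs} u sub with zs , p ← ∈-↭ (sub (here refl)) =
    subst (suc (length xs) ≤_) (sym (↭.↭-length p)) (s≤s (unique-⊆-length (AllPairs.tail u) (⊆-uncons u sub p)))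

  -- If the removed `x` occurred a second time in `ys`, then all of `x ∷ xs` would fit into the
  -- remainder `zs`, which is too short.
  unique-of-length : ∀ {xs ys : List A} → Unique xs → xs ⊆ ys → length ys ≤ length xs → Unique ys
  unique-of-length {[]}     {[]}     _ _   _ = []
  unique-of-length {x ∷ xs} {ys} u sub le with zs , p ← ∈-↭ (sub (here refl)) =
    ↭-unique (↭-sym p) (All.tabulate x∉zs ∷ unique-of-length (AllPairs.tail u) sub′ le′)
    where
    sub′ : xs ⊆ zs
    sub′ = ⊆-uncons u sub p
    le′ : length zs ≤ length xs
    le′ = s≤s⁻¹ (subst (_≤ suc (length xs)) (↭.↭-length p) le)
    x∉zs : ∀ {z} → z ∈ zs → x ≢ z
    x∉zs z∈ refl = ℕ.n≮n _ (ℕ.≤-trans (unique-⊆-length u λ { (here refl) → z∈ ; (there w) → sub′ w }) le′)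

-- Closed walks and how they are merged

module Walks {S L : Set} (_∋_ : S → L → Set) where

  Walk : Set
  Walk = List (S × L)

  -- A step records a block together with the label by which it is left; it is entered by the label
  -- of the preceding step. The two labels of a block may coincide.
  data Path : L → Walk → L → Set where
    []  : ∀ {ℓ} → Path ℓ [] ℓ
    _∷_ : ∀ {ℓ ℓ′ ℓ″ s w} → s ∋ ℓ × s ∋ ℓ′ → Path ℓ′ w ℓ″ → Path ℓ ((s , ℓ′) ∷ w) ℓ″

  blocks : Walk → List S
  blocks = map proj₁

  labels : Walk → List L
  labels = map proj₂

  infixr 5 _++ᵖ_

  _++ᵖ_ : ∀ {ℓ ℓ′ ℓ″ v w} → Path ℓ v ℓ′ → Path ℓ′ w ℓ″ → Path ℓ (v ++ w) ℓ″
  []      ++ᵖ q = q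
  (h ∷ p) ++ᵖ q = h ∷ (p ++ᵖ q)

  split : ∀ {ℓ₀ ℓ₁ ℓ w} → Path ℓ₀ w ℓ₁ → ℓ ∈ labels w → ∃₂ λ u v → w ≡ u ++ v × Path ℓ₀ u ℓ × Path ℓ v ℓ₁
  split {w = x ∷ w} (h ∷ p) (here refl) = x ∷ [] , w , refl , h ∷ [] , p
  split {w = x ∷ w} (h ∷ p) (there ℓ∈) with u , v , refl , p₁ , p₂ ← split p ℓ∈ = x ∷ u , v , refl , h ∷ p₁ , p₂

  rotate : ∀ {ℓ₀ ℓ w} → Path ℓ₀ w ℓ₀ → ℓ ∈ labels w → ∃ λ w′ → w′ ↭ w × Path ℓ w′ ℓ
  rotate p ℓ∈ with u , v , refl , p₁ , p₂ ← split p ℓ∈ = v ++ u , ↭.++-comm v u , p₂ ++ᵖ p₁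

  merge : ∀ {ℓ₀ ℓ₁ ℓ v w} → Path ℓ₀ v ℓ₀ → Path ℓ₁ w ℓ₁ → ℓ ∈ labels v → ℓ ∈ labels w →
          ∃ λ w′ → w′ ↭ w ++ v × Path ℓ₀ w′ ℓ₀
  merge {v = v} {w} p q ℓ∈v ℓ∈w with w₁ , w₁↭w , q′ ← rotate q ℓ∈w | u , u′ , refl , p₁ , p₂ ← split p ℓ∈v =
    u ++ (w₁ ++ u′) , ↭-trans (↭.shifts u w₁) (↭.++⁺ʳ (u ++ u′) w₁↭w) , p₁ ++ᵖ (q′ ++ᵖ p₂)

  -- Reversal exchanges entering and leaving labels, so the recorded labels move by one block: the
  -- last one is lost and the initial label `ℓ` is recorded instead.
  backward : L → Walk → Walk
  backward ℓ []             = []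
  backward ℓ ((s , ℓ′) ∷ w) = backward ℓ′ w ++ (s , ℓ) ∷ []

  backward-path : ∀ {ℓ ℓ′ w} → Path ℓ w ℓ′ → Path ℓ′ (backward ℓ w) ℓ
  backward-path []            = []
  backward-path ((h , h′) ∷ p) = backward-path p ++ᵖ ((h′ , h) ∷ [])

  backward-blocks : ∀ ℓ w → blocks w ↭ blocks (backward ℓ w)
  backward-blocks ℓ []             = ↭-refl
  backward-blocks ℓ ((s , ℓ′) ∷ w) = ↭-trans (↭-prep s (backward-blocks ℓ′ w))
    (↭-trans (↭.∷↭∷ʳ s (blocks (backward ℓ′ w))) (↭-reflexive (sym (List.map-++ proj₁ (backward ℓ′ w) _))))

  module Pieces {I : Set} (_≟_ : DecidableEquality I) (base : I → L) (piece : I → Walk)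
                (Valid : I → Set) (closed : ∀ {i} → Valid i → Path (base i) (piece i) (base i))
                (root : I) (valid-root : Valid root) where

    open import Data.List.Membership.DecPropositional _≟_ using (_∈?_)

    -- A chain of valid pieces from `root` to a label, each sharing a label with what precedes it.
    -- It does not mention the walk built so far, so links between pieces can be proved locally and
    -- in any order.
    data Reached : L → Set where
      start : ∀ {ℓ} → ℓ ∈ labels (piece root) → Reached ℓ
      step  : ∀ {ℓ ℓ′} i → Valid i → Reached ℓ → ℓ ∈ labels (piece i) → ℓ′ ∈ labels (piece i) → Reached ℓ′

    Attached : I → Set
    Attached i = ∃ λ ℓ → Reached ℓ × ℓ ∈ labels (piece i)

    record State : Set where
      field
        ids    : List I
        walk   : Walk
        unique : Unique ids
        valid  : All Valid ids
        path   : Path (base root) walk (base root)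
        perm   : walk ↭ concatMap piece ids
        rooted : root ∈ ids
    open State

    labels⊆ : ∀ s {i ℓ} → i ∈ ids s → ℓ ∈ labels (piece i) → ℓ ∈ labels (walk s)
    labels⊆ s i∈ ℓ∈ with x , x∈ , refl ← ∈-map⁻ proj₂ ℓ∈ =
      ∈-map⁺ proj₂ (↭.∈-resp-↭ (↭-sym (perm s)) (∈-concatMap⁺ piece (lose i∈ x∈)))

    initial : State
    initial = record
      { ids = root ∷ [] ; walk = piece root ; unique = [] ∷ [] ; valid = valid-root ∷ [] ; path = closed valid-root
      ; perm = ↭-reflexive (sym (List.++-identityʳ _)) ; rooted = here refl }

    join : ∀ s {i ℓ} → Valid i → ℓ ∈ labels (walk s) → ℓ ∈ labels (piece i) →
           Σ State λ s′ → ids s ⊆ ids s′ × i ∈ ids s′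
    join s {i} vi ℓ∈w ℓ∈i with i ∈? ids s
    ... | yes i∈ = s , id , i∈
    ... | no i∉ with w′ , w′↭ , p ← merge (path s) (closed vi) ℓ∈w ℓ∈i = record
      { ids = i ∷ ids s ; walk = w′ ; path = p ; rooted = there (rooted s) ; valid = vi ∷ valid s
      ; unique = All.tabulate (λ j∈ → λ { refl → i∉ j∈ }) ∷ unique s
      ; perm = ↭-trans w′↭ (↭.++⁺ˡ (piece i) (perm s)) } , there , here refl

    -- The pieces of the chain are merged one after another; `join` leaves a piece alone that is
    -- already present, so chains may overlap.
    reach : ∀ s {ℓ} → Reached ℓ → Σ State λ s′ → ids s ⊆ ids s′ × ℓ ∈ labels (walk s′)
    reach s (start ℓ∈) = s , id , labels⊆ s (rooted s) ℓ∈
    reach s (step i vi r ℓ∈ ℓ′∈) with s₁ , sub₁ , ℓ∈₁ ← reach s r with s₂ , sub₂ , i∈ ← join s₁ vi ℓ∈₁ ℓ∈ =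
      s₂ , sub₂ ∘ sub₁ , labels⊆ s₂ i∈ ℓ′∈

    reachAll : ∀ s (ℓs : List L) → All Reached ℓs → ∃ λ s′ → ids s ⊆ ids s′ × All (_∈ labels (walk s′)) ℓs
    reachAll s [] [] = s , id , []
    reachAll s (ℓ ∷ ℓs) (r ∷ rs) with s₁ , sub₁ , all ← reachAll s ℓs rs with s₂ , sub₂ , ℓ∈ ← reach s₁ r =
      s₂ , sub₂ ∘ sub₁ , ℓ∈ ∷ All.map mono all
      where
      mono : ∀ {ℓ} → ℓ ∈ labels (walk s₁) → ℓ ∈ labels (walk s₂)
      mono ℓ∈ with x , x∈ , refl ← ∈-map⁻ proj₂ ℓ∈
        with i , i∈ , x∈i ← find (∈-concatMap⁻ piece (↭.∈-resp-↭ (perm s₁) x∈)) =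
        labels⊆ s₂ (sub₂ i∈) (∈-map⁺ proj₂ x∈i)

    joinAll : ∀ s (is : List I) → All Valid is → All Attached is → ∃ λ s′ → is ⊆ ids s′
    joinAll s [] [] [] = s , λ ()
    joinAll s (i ∷ is) (v ∷ vs) ((ℓ , r , ℓ∈i) ∷ as) with s₁ , sub₁ ← joinAll s is vs as
      with s₂ , sub₂ , ℓ∈ ← reach s₁ r with s₃ , sub₃ , i∈ ← join s₂ v ℓ∈ ℓ∈i =
      s₃ , λ { (here refl) → i∈ ; (there j∈) → sub₃ (sub₂ (sub₁ j∈)) }

    insertAll : ∀ {ℓ₀ w} (xs : Walk) → Path ℓ₀ w ℓ₀ → All (λ x → proj₁ x ∋ proj₂ x) xs → All (_∈ labels w) (labels xs) →
                ∃ λ w′ → w′ ↭ xs ++ w × Path ℓ₀ w′ ℓ₀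
    insertAll [] p [] [] = _ , ↭-refl , p
    insertAll {w = w} (x@(s , ℓ) ∷ xs) p (h ∷ hs) (ℓ∈ ∷ ℓs) with w₁ , w₁↭ , p₁ ← insertAll xs p hs ℓs
      -- A single block is itself a closed walk, entered and left by the same label `ℓ`.
      with w₂ , w₂↭ , p₂ ← merge {w = x ∷ []} p₁ ((h , h) ∷ [])
             (↭.∈-resp-↭ (↭.map⁺ proj₂ (↭-sym w₁↭)) (subst (ℓ ∈_) (sym (List.map-++ proj₂ xs w)) (∈-++⁺ʳ (labels xs) ℓ∈)))
             (here refl) =
      w₂ , ↭-trans w₂↭ (↭-prep x w₁↭) , p₂

    -- The chains that reach the pieces `is` may pull in further valid pieces, so `js` contains `is`
    -- but need not consist of it.
    closedWalk : (is : List I) → All Valid is → All Attached is →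
                 (bs : List S) → (∀ {b} → b ∈ bs → ∃ λ ℓ → Reached ℓ × b ∋ ℓ) →
                 ∃₂ λ js w → Unique js × All Valid js × is ⊆ js × Path (base root) w (base root) ×
                   blocks w ↭ bs ++ concatMap (blocks ∘ piece) js
    closedWalk is vs as bs good = ids s₂ , w , unique s₂ , valid s₂ , sub₂ ∘ sub₁ , p , perm′
      where
      singles : ∀ bs → (∀ {b} → b ∈ bs → ∃ λ ℓ → Reached ℓ × b ∋ ℓ) →
                ∃ λ (xs : Walk) → blocks xs ≡ bs × All (λ x → proj₁ x ∋ proj₂ x) xs × All Reached (labels xs)
      singles [] g = [] , refl , [] , []
      singles (b ∷ bs) g with ℓ , r , h ← g (here refl) with xs , e , hs , rs ← singles bs (g ∘ there) =
        (b , ℓ) ∷ xs , cong (b ∷_) e , h ∷ hs , r ∷ rs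
      xs = proj₁ (singles bs good)
      xs-props = proj₂ (singles bs good)
      s₁ = proj₁ (joinAll initial is vs as)
      sub₁ = proj₂ (joinAll initial is vs as)
      reached = reachAll s₁ (labels xs) (proj₂ (proj₂ xs-props))
      s₂ = proj₁ reached
      sub₂ = proj₁ (proj₂ reached)
      inserted = insertAll xs (path s₂) (proj₁ (proj₂ xs-props)) (proj₂ (proj₂ reached))
      w = proj₁ inserted
      p = proj₂ (proj₂ inserted)
      perm′ : blocks w ↭ bs ++ concatMap (blocks ∘ piece) (ids s₂)
      perm′ = ↭-trans (↭.map⁺ proj₁ (↭-trans (proj₁ (proj₂ inserted)) (↭.++⁺ˡ xs (perm s₂))))
        (↭-reflexive (trans (List.map-++ proj₁ xs _) (cong₂ _++_ (proj₁ xs-props) (List.map-concatMap proj₁ piece (ids s₂)))))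

module _ {S L : Set} {_∋₁_ _∋₂_ : S → L → Set} where

  path-map : ∀ {P : S → Set} → (∀ {s ℓ} → P s → s ∋₁ ℓ → s ∋₂ ℓ) → ∀ {ℓ ℓ′ w} → All P (map proj₁ w) →
             Walks.Path _∋₁_ ℓ w ℓ′ → Walks.Path _∋₂_ ℓ w ℓ′
  path-map f []       Walks.[]                   = Walks.[]
  path-map f (h ∷ hs) ((l , r) Walks.∷ p) = (f h l , f h r) Walks.∷ path-map f hs p

unique-map : ∀ {A B : Set} {f : A → B} {xs} → (∀ {a b} → a ∈ xs → b ∈ xs → f a ≡ f b → a ≡ b) →
             Unique xs → Unique (map f xs)
unique-map inj [] = []
unique-map {f = f} inj (x∉ ∷ u) =
  All.map⁺ (All.tabulate λ y∈ e → All.lookup x∉ y∈ (inj (here refl) (there y∈) e)) ∷ unique-map (λ a∈ b∈ → inj (there a∈) (there b∈)) u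

-- Double counting

module _ {A B : Set} {R : A → B → Set} (R? : ∀ a b → Dec (R a b)) where

  count-swap : ∀ xs ys → sum (map (λ x → length (filter (R? x) ys)) xs) ≡ sum (map (λ y → length (filter (λ x → R? x y) xs)) ys)
  count-swap []       ys = sym (zeros ys)
    where
    zeros : ∀ ys → sum (map {A = B} (λ _ → 0) ys) ≡ 0
    zeros []       = refl
    zeros (_ ∷ ys) = zeros ys
  count-swap (x ∷ xs) ys = trans (cong (length (filter (R? x) ys) +_) (count-swap xs ys)) (sym (peel ys))
    where
    exchange : ∀ y ys → let a = length (filter (λ x → R? x y) xs) ; b = length (filter (R? x) ys)
                            c = sum (map (λ y → length (filter (λ x → R? x y) xs)) ys) in a + (b + c) ≡ b + (a + c)
    exchange y ys = lia 3 (λ a b c → a :+ (b :+ c) :≡ b :+ (a :+ c)) (length (filter (λ x → R? x y) xs)) (length (filter (R? x) ys)) _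
    peel : ∀ ys → sum (map (λ y → length (filter (λ x → R? x y) (x ∷ xs))) ys) ≡
                  length (filter (R? x) ys) + sum (map (λ y → length (filter (λ x → R? x y) xs)) ys)
    peel [] = refl
    peel (y ∷ ys) with R? x y
    ... | yes _ = cong suc (trans (cong (length (filter (λ x → R? x y) xs) +_) (peel ys)) (exchange y ys))
    ... | no _  = trans (cong (length (filter (λ x → R? x y) xs) +_) (peel ys)) (exchange y ys)

sum-constant-on : ∀ {A : Set} {P : A → Set} (P? : ∀ a → Dec (P a)) (f : A → ℕ) c →
                  (∀ {a} → P a → f a ≡ c) → (∀ {a} → ¬ P a → f a ≡ 0) → ∀ xs → sum (map f xs) ≡ length (filter P? xs) * c
sum-constant-on P? f c yes-c no-c [] = refl
sum-constant-on P? f c yes-c no-c (x ∷ xs) with P? x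
... | yes p = cong₂ _+_ (yes-c p) (sum-constant-on P? f c yes-c no-c xs)
... | no ¬p = cong₂ _+_ (no-c ¬p) (sum-constant-on P? f c yes-c no-c xs)

sum-constant : ∀ {A : Set} (f : A → ℕ) c → (∀ a → f a ≡ c) → ∀ xs → sum (map f xs) ≡ length xs * c
sum-constant f c h []       = refl
sum-constant f c h (x ∷ xs) = cong₂ _+_ (h x) (sum-constant f c h xs)

module _ {A : Set} (f : A → ℕ) (c : ℕ) where

  sum-lower : ∀ {xs} → All (λ x → c ≤ f x) xs → length xs * c ≤ sum (map f xs)
  sum-lower []       = z≤n
  sum-lower (h ∷ hs) = ℕ.+-mono-≤ h (sum-lower hs)

  sum-tight : ∀ {xs} → All (λ x → c ≤ f x) xs → sum (map f xs) ≤ length xs * c → All (λ x → f x ≡ c) xs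
  sum-tight []       le = []
  sum-tight {x ∷ xs} (h ∷ hs) le =
    lia 4 (λ c fx n s → c :≤ fx :⇒ n :≤ s :⇒ fx :+ s :≤ c :+ n :⇒ fx :≡ c) c (f x) (length xs * c) _ h (sum-lower hs) le
    ∷ sum-tight hs (lia 4 (λ c fx n s → c :≤ fx :⇒ fx :+ s :≤ c :+ n :⇒ s :≤ n) c (f x) (length xs * c) _ h le)

-- Blocks, adjacency, and the number of blocks through a pair

module _ {v : ℕ} where

  private
    P : Set
    P = Fin v

  points : Block v → List P
  points B = Block.a B ∷ Block.b B ∷ Block.c B ∷ []

  ∈⇒∈B : ∀ {p} {B : Block v} → p ∈ points B → p ∈B B
  ∈⇒∈B (here e)                 = inj₁ e
  ∈⇒∈B (there (here e))         = inj₂ (inj₁ e)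
  ∈⇒∈B (there (there (here e))) = inj₂ (inj₂ e)

  ∈B⇒∈ : ∀ {p} {B : Block v} → p ∈B B → p ∈ points B
  ∈B⇒∈ (inj₁ e)        = here e
  ∈B⇒∈ (inj₂ (inj₁ e)) = there (here e)
  ∈B⇒∈ (inj₂ (inj₂ e)) = there (there (here e))

  points-unique : ∀ B → Unique (points B)
  points-unique (block a b c a<b b<c) =
    ((λ { refl → ℕ.n≮n _ a<b }) ∷ (λ { refl → ℕ.n≮n _ (ℕ.<-trans a<b b<c) }) ∷ []) ∷
    ((λ { refl → ℕ.n≮n _ b<c }) ∷ []) ∷ [] ∷ []

  toℕ-cases : ∀ {p a b c : P} → p ≡ a ⊎ p ≡ b ⊎ p ≡ c → toℕ p ≡ toℕ a ⊎ toℕ p ≡ toℕ b ⊎ toℕ p ≡ toℕ c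
  toℕ-cases (inj₁ e)        = inj₁ (cong toℕ e)
  toℕ-cases (inj₂ (inj₁ e)) = inj₂ (inj₁ (cong toℕ e))
  toℕ-cases (inj₂ (inj₂ e)) = inj₂ (inj₂ (cong toℕ e))

  -- One inclusion is enough: three increasing values among three increasing values must match in
  -- order.
  block-ext : ∀ {B C : Block v} → (∀ {p} → p ∈B B → p ∈B C) → B ≡ C
  block-ext {B = block a b c a<b b<c} {C = block a′ b′ c′ a′<b′ b′<c′} sub
    with ea , eb , ec ← lia 6 (λ a b c a′ b′ c′ → a :< b :⇒ b :< c :⇒ a′ :< b′ :⇒ b′ :< c′ :⇒
           (a :≡ a′ :∨ a :≡ b′ :∨ a :≡ c′) :⇒ (b :≡ a′ :∨ b :≡ b′ :∨ b :≡ c′) :⇒ (c :≡ a′ :∨ c :≡ b′ :∨ c :≡ c′) :⇒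
           (a :≡ a′ :∧ b :≡ b′ :∧ c :≡ c′))
           (toℕ a) (toℕ b) (toℕ c) (toℕ a′) (toℕ b′) (toℕ c′) a<b b<c a′<b′ b′<c′
           (toℕ-cases (sub (inj₁ refl))) (toℕ-cases (sub (inj₂ (inj₁ refl)))) (toℕ-cases (sub (inj₂ (inj₂ refl))))
    with refl ← Fin.toℕ-injective ea | refl ← Fin.toℕ-injective eb | refl ← Fin.toℕ-injective ec =
    cong₂ (block a b c) (ℕ.≤-irrelevant _ _) (ℕ.≤-irrelevant _ _)

  three-points : ∀ {B : Block v} {xs} → Unique xs → length xs ≡ 3 → (∀ {x} → x ∈ xs → x ∈B B) → ∀ {p} → p ∈B B → p ∈ xs
  three-points {B} {xs} u len sub {p} p∈ with p ∈? xs
    where open import Data.List.Membership.DecPropositional (Fin._≟_ {v}) using (_∈?_)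
  ... | yes q = q
  ... | no p∉ = ⊥-elim (ℕ.n≮n 3 (subst (λ n → suc n ≤ 3) len (unique-⊆-length {ys = points B}
    (All.tabulate (λ x∈ → λ { refl → p∉ x∈ }) ∷ u) λ { (here refl) → ∈B⇒∈ {B = B} p∈ ; (there x∈) → ∈B⇒∈ {B = B} (sub x∈) })))

  three-common : ∀ {B C : Block v} {x y z} → x ≢ y → x ≢ z → y ≢ z → x ∈B B → y ∈B B → z ∈B B → x ∈B C → y ∈B C → z ∈B C → B ≡ C
  three-common {B} {C} {x} {y} {z} xy xz yz xB yB zB xC yC zC = block-ext λ p∈ → toC (three-points {B = B}
    ((xy ∷ xz ∷ []) ∷ (yz ∷ []) ∷ [] ∷ []) refl (λ { (here refl) → xB ; (there (here refl)) → yB ; (there (there (here refl))) → zB }) p∈)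
    where
    toC : ∀ {p} → p ∈ x ∷ y ∷ z ∷ [] → p ∈B C
    toC (here refl)                 = xC
    toC (there (here refl))         = yC
    toC (there (there (here refl))) = zC

  -- A third common point would make the two blocks equal by `three-common`.
  share-pair : ∀ {B C : Block v} {x y} → x ≢ y → x ∈B B → y ∈B B → x ∈B C → y ∈B C → B ≢ C → Adjacent2 B C
  share-pair {B} {C} {x} {y} xy xB yB xC yC B≢C = ℕ.≤-antisym
    (unique-⊆-length {ys = x ∷ y ∷ []} (Unique.filter⁺ both? (Unique.allFin⁺ v)) λ z∈ → only (proj₂ (∈-filter⁻ both? {xs = allFin v} z∈)))
    (unique-⊆-length {xs = x ∷ y ∷ []} ((xy ∷ []) ∷ [] ∷ []) λ
      { (here refl) → ∈-filter⁺ both? (∈-allFin x) (xB , xC) ; (there (here refl)) → ∈-filter⁺ both? (∈-allFin y) (yB , yC) })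
    where
    both? : ∀ z → Dec (z ∈B B × z ∈B C)
    both? z = (z ∈B? B) ×-dec (z ∈B? C)
    only : ∀ {z} → z ∈B B × z ∈B C → z ∈ x ∷ y ∷ []
    only {z} (zB , zC) with z Fin.≟ x | z Fin.≟ y
    ... | yes e | _     = here e
    ... | no _  | yes e = there (here e)
    ... | no zx | no zy = ⊥-elim (B≢C (three-common xy (zx ∘ sym) (zy ∘ sym) xB yB zB xC yC zC))

  module _ {S L : Set} (_∋_ : S → L → Set) (real : S → Block v)
           (adjacent : ∀ {s t ℓ} → s ∋ ℓ → t ∋ ℓ → real s ≢ real t → Adjacent2 (real s) (real t)) where

    open Walks _∋_

    path-chain : ∀ {ℓ ℓ′ w} → Path ℓ w ℓ′ → Unique (map real (blocks w)) → Chain (map real (blocks w))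
    path-chain []                      u                   = chain-[]
    path-chain (h ∷ [])                u                   = chain-[-] _
    path-chain (h ∷ p@(h′ ∷ _)) ((ne ∷ _) ∷ u) = chain-∷ _ _ _ (adjacent (proj₂ h) (proj₁ h′) ne) (path-chain p u)

    path-last : ∀ {s₀ ℓ ℓ₀ w} → Path ℓ w ℓ₀ → s₀ ∋ ℓ₀ → All (real s₀ ≢_) (map real (blocks w)) → LastAdj (real s₀) (map real (blocks w))
    path-last []                   h₀ ne         = _
    path-last (h ∷ [])             h₀ (ne ∷ [])  = adjacent (proj₂ h) h₀ (ne ∘ sym)
    path-last (h ∷ p@(_ ∷ _))      h₀ (_ ∷ ne)   = path-last p h₀ ne

    -- Consecutive blocks share the pair of a label, and absence of repetitions makes them distinct,
    -- hence adjacent. With a single block the last adjacency would relate the block to itself.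
    closed-cyclic : ∀ {ℓ w} → Path ℓ w ℓ → Unique (map real (blocks w)) → 2 ≤ length w → CyclicChain (map real (blocks w))
    closed-cyclic p@(h ∷ q@(_ ∷ _)) u@(ne ∷ _) _ = path-chain p u , path-last q (proj₁ h) ne
    closed-cyclic (h ∷ [])          u (s≤s ())

  -- The blocks `Ws` give the lower bound. For the upper bound, the third points of all blocks
  -- through `x` and `y`, in `L` or among the excluded `Rs`, are distinct and avoid `x` and `y`, so
  -- there are at most `v - 2`. Exhibiting enough excluded blocks thus replaces a classification of
  -- the blocks of `L`.
  pairCount-exact : ∀ {L Ws Rs : List (Block v)} {x y} n → x ≢ y → Unique L → Ws ⊆ L → Unique Ws → Unique Rs → Disjoint L Rs →
                    All (λ B → x ∈B B × y ∈B B) Ws → All (λ B → x ∈B B × y ∈B B) Rs →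
                    length Ws ≡ n → n + length Rs + 2 ≡ v → pairCount L x y ≡ n
  pairCount-exact {L} {Ws} {Rs} {x} {y} n xy uL W⊆L uW uR disj cW cR lenW lenR =
    ℕ.≤-antisym (lia 4 (λ f r n v → f :+ r :+ lit 2 :≤ v :⇒ n :+ r :+ lit 2 :≡ v :⇒ f :≤ n) _ (length Rs) n v upper lenR)
      (subst (_≤ length F) lenW (unique-⊆-length uW λ w∈ → ∈-filter⁺ both? (W⊆L w∈) (All.lookup cW w∈)))
    where
    both? : ∀ B → Dec (x ∈B B × y ∈B B)
    both? B = (x ∈B? B) ×-dec (y ∈B? B)
    F = filter both? L
    third : Block v → P
    third (block a b c _ _) with a Fin.≟ x | a Fin.≟ y | b Fin.≟ x | b Fin.≟ y
    ... | no _  | no _ | _    | _    = a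
    ... | _     | _    | no _ | no _ = b
    -- For a block through `x` and `y` the other two points are then `x` and `y` themselves.
    ... | _     | _    | _    | _    = c
    third-spec : ∀ {B} → x ∈B B × y ∈B B → third B ∈B B × x ≢ third B × y ≢ third B
    third-spec {block a b c a<b b<c} (hx , hy) with a Fin.≟ x | a Fin.≟ y | b Fin.≟ x | b Fin.≟ y
    ... | no ax | no ay  | _      | _       = inj₁ refl , ax ∘ sym , ay ∘ sym
    ... | yes _ | _      | no bx  | no by   = inj₂ (inj₁ refl) , bx ∘ sym , by ∘ sym
    ... | no _  | yes _  | no bx  | no by   = inj₂ (inj₁ refl) , bx ∘ sym , by ∘ sym
    ... | yes refl | _        | yes refl | _        = ⊥-elim (ℕ.n≮n _ a<b)
    ... | yes refl | _        | no _     | yes refl = inj₂ (inj₂ refl) , (λ { refl → ℕ.n≮n _ (ℕ.<-trans a<b b<c) }) , λ { refl → ℕ.n≮n _ b<c }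
    ... | no _     | yes refl | yes refl | _        = inj₂ (inj₂ refl) , (λ { refl → ℕ.n≮n _ b<c }) , λ { refl → ℕ.n≮n _ (ℕ.<-trans a<b b<c) }
    ... | no _     | yes refl | no _     | yes refl = ⊥-elim (ℕ.n≮n _ a<b)
    G = F ++ Rs
    F-spec : ∀ {B} → B ∈ F → B ∈ L × x ∈B B × y ∈B B
    F-spec = ∈-filter⁻ both? {xs = L}
    G-spec : ∀ {B} → B ∈ G → x ∈B B × y ∈B B
    G-spec {B} B∈ with ∈-++⁻ F B∈
    ... | inj₁ f = proj₂ (F-spec f)
    ... | inj₂ r = All.lookup cR r
    uG : Unique G
    uG = Unique.++⁺ (Unique.filter⁺ both? uL) uR λ (f , r) → disj (proj₁ (F-spec f) , r)
    third-injective : ∀ {B C} → B ∈ G → C ∈ G → third B ≡ third C → B ≡ C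
    third-injective {B} {C} B∈ C∈ e with t , tx , ty ← third-spec {B} (G-spec B∈) | t′ , _ , _ ← third-spec {C} (G-spec C∈) =
      three-common xy tx ty (proj₁ (G-spec B∈)) (proj₂ (G-spec B∈)) t (proj₁ (G-spec C∈)) (proj₂ (G-spec C∈)) (subst (_∈B C) (sym e) t′)
    thirds : Unique (x ∷ y ∷ map third G)
    thirds = (xy ∷ All.map⁺ (All.tabulate λ B∈ → proj₁ (proj₂ (third-spec (G-spec B∈)))))
      ∷ All.map⁺ (All.tabulate λ B∈ → proj₂ (proj₂ (third-spec (G-spec B∈)))) ∷ unique-map third-injective uG
    upper : length F + length Rs + 2 ≤ v
    upper = lia 4 (λ f r g v → g :≡ f :+ r :⇒ lit 2 :+ g :≤ v :⇒ f :+ r :+ lit 2 :≤ v) (length F) (length Rs) _ v (List.length-++ F)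
      (subst₂ _≤_ (cong (2 +_) (List.length-map third G)) (List.length-tabulate {n = v} id)
        (unique-⊆-length thirds λ {p} _ → ∈-allFin p))

  block-size : ∀ B → length (filter (_∈B? B) (allFin v)) ≡ 3
  block-size B = ℕ.≤-antisym
    (unique-⊆-length {ys = points B} (Unique.filter⁺ (_∈B? B) (Unique.allFin⁺ v)) λ p∈ → ∈B⇒∈ {B = B} (proj₂ (∈-filter⁻ (_∈B? B) {xs = allFin v} p∈)))
    (unique-⊆-length (points-unique B) λ {p} p∈ → ∈-filter⁺ (_∈B? B) (∈-allFin p) (∈⇒∈B {B = B} p∈))

  _≟ᴮ_ : DecidableEquality (Block v)
  block a b c p q ≟ᴮ block a′ b′ c′ p′ q′ with a Fin.≟ a′ | b Fin.≟ b′ | c Fin.≟ c′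
  ... | yes refl | yes refl | yes refl = yes (cong₂ (block a b c) (ℕ.≤-irrelevant p p′) (ℕ.≤-irrelevant q q′))
  ... | no ne    | _        | _        = no λ { refl → ne refl }
  ... | _        | no ne    | _        = no λ { refl → ne refl }
  ... | _        | _        | no ne    = no λ { refl → ne refl }

  -- Only the lower half of the condition on pairs; the upper half will follow from the number of
  -- blocks.
  TwoCovered : List (Block v) → Set
  TwoCovered L = ∀ {x y} → x ≢ y → ∃₂ λ B C → B ≢ C × B ∈ L × C ∈ L × (x ∈B B × y ∈B B) × (x ∈B C × y ∈B C)

  module _ (L : List (Block v)) (cover : TwoCovered L) where

    private
      degree : P → ℕ
      degree x = length (filter (x ∈B?_) L)

      pair-lower : ∀ {x y} → x ≢ y → 2 ≤ pairCount L x y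
      pair-lower xy with B , C , ne , B∈ , C∈ , hB , hC ← cover xy = unique-⊆-length {xs = B ∷ C ∷ []} ((ne ∷ []) ∷ [] ∷ [])
        λ { (here refl) → ∈-filter⁺ _ B∈ hB ; (there (here refl)) → ∈-filter⁺ _ C∈ hC }

      -- Each block through `x` is counted once at each of its three points, `x` included;
      -- `rest-sum` removes the diagonal term again.
      pair-sum : ∀ x → sum (map (pairCount L x) (allFin v)) ≡ degree x * 3
      pair-sum x = trans (count-swap (λ y B → (x ∈B? B) ×-dec (y ∈B? B)) (allFin v) L)
        (sum-constant-on (x ∈B?_) _ 3 (λ {B} h → trans (cong length (List.filter-≐ _ (_∈B? B) (proj₂ , (h ,_)) (allFin v))) (block-size B))
          (λ h → cong length (List.filter-none _ (All.tabulate {xs = allFin v} λ _ → h ∘ proj₁))) L)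

      degree-sum : sum (map degree (allFin v)) ≡ length L * 3
      degree-sum = trans (count-swap _∈B?_ (allFin v) L)
        (sum-constant _ 3 (λ B → block-size B) L)

      rest : ∀ x → ∃ λ ys → allFin v ↭ x ∷ ys
      rest x = ∈-↭ (∈-allFin x)

      rest-distinct : ∀ x → All (x ≢_) (proj₁ (rest x))
      rest-distinct x = AllPairs.head (↭-unique (proj₂ (rest x)) (Unique.allFin⁺ v))

      rest-length : ∀ x → suc (length (proj₁ (rest x))) ≡ v
      rest-length x = trans (sym (↭.↭-length (proj₂ (rest x)))) (List.length-tabulate id)

      rest-sum : ∀ x → sum (map (pairCount L x) (proj₁ (rest x))) ≡ degree x * 2
      rest-sum x = lia 4 (λ d p s r → s :≡ p :+ r :⇒ s :≡ 3 :* d :⇒ d :≡ p :⇒ r :≡ 2 :* d) (degree x) (pairCount L x x) _ _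
          (sum-↭ (↭.map⁺ (pairCount L x) (proj₂ (rest x)))) (trans (pair-sum x) (ℕ.*-comm (degree x) 3)) diagonal
        ⟨ trans ⟩ ℕ.*-comm 2 (degree x)
        where
        diagonal : degree x ≡ pairCount L x x
        diagonal = cong length (List.filter-≐ (x ∈B?_) _ ((λ h → h , h) , proj₁) L)

      rest-lower : ∀ x → All (λ y → 2 ≤ pairCount L x y) (proj₁ (rest x))
      rest-lower x = All.map pair-lower (rest-distinct x)

      degree-lower : ∀ x → v ∸ 1 ≤ degree x
      degree-lower x = subst (_≤ degree x) (cong (_∸ 1) (rest-length x))
        (ℕ.*-cancelʳ-≤ _ (degree x) 2 (subst (length (proj₁ (rest x)) * 2 ≤_) (rest-sum x) (sum-lower _ 2 (rest-lower x))))

    -- The `v - 1` pairs at a point `x` are covered at least `2 (v - 1)` times, and each block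
    -- through `x` covers two of them, so every degree is at least `v - 1`.
    size-lower : v * (v ∸ 1) ≤ length L * 3
    size-lower = subst₂ _≤_ (cong (_* (v ∸ 1)) (List.length-tabulate {n = v} id)) degree-sum
      (sum-lower degree (v ∸ 1) (All.tabulate {xs = allFin v} λ {x} _ → degree-lower x))

    exactly-two : length L * 3 ≡ v * (v ∸ 1) → ∀ {x y} → x ≢ y → pairCount L x y ≡ 2
    exactly-two size {x} {y} xy with ↭.∈-resp-↭ (proj₂ (rest x)) (∈-allFin y)
    ... | here refl = ⊥-elim (xy refl)
    ... | there y∈ = All.lookup (sum-tight _ 2 (rest-lower x) (ℕ.≤-reflexive (trans (rest-sum x) (cong (_* 2) degree-x)))) y∈
      where
      degree-x : degree x ≡ length (proj₁ (rest x))
      degree-x = trans (All.lookup (sum-tight degree (v ∸ 1) (All.tabulate {xs = allFin v} λ {x} _ → degree-lower x)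
          (ℕ.≤-reflexive (trans degree-sum (trans size (cong (_* (v ∸ 1)) (sym (List.length-tabulate {n = v} id))))))) (∈-allFin x))
        (sym (cong (_∸ 1) (rest-length x)))

  -- Equality in the double count of incident pairs and blocks.
  two-covered⇒TS : ∀ L → TwoCovered L → length L * 3 ≡ v * (v ∸ 1) → IsTS v 2 L × IsSimple L
  two-covered⇒TS L cover size = (λ x y x<y → exactly-two L cover size λ { refl → ℕ.n≮n _ x<y }) ,
    -- Removing repetitions keeps every pair in two different blocks, so `size-lower` applies to the
    -- shortened list, which therefore cannot be shorter.
    unique-of-length (deduplicate-! L) (∈-deduplicate⁻ _≟ᴮ_ L)
      (ℕ.*-cancelʳ-≤ (length L) (length L′) 3 (subst (_≤ length L′ * 3) (sym size) (size-lower L′ cover′)))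
    where
    open import Data.List.Relation.Unary.Unique.DecPropositional.Properties _≟ᴮ_ using (deduplicate-!)
    L′ = deduplicate _≟ᴮ_ L
    cover′ : TwoCovered L′
    cover′ xy with B , C , ne , B∈ , C∈ , h ← cover xy = B , C , ne , ∈-deduplicate⁺ _≟ᴮ_ B∈ , ∈-deduplicate⁺ _≟ᴮ_ C∈ , h

-- Triples over two copies of ℤ_m ∪ {∞}, and their classes

Point : Set
Point = ℕ × Bool

Label : Set
Label = Point × Point

-- The triples of points over ℤ_m ∪ {∞}, where (m , p) stands for the two
-- points at infinity. With q = s xor (a <ᵇ b):
--   cu a b c α β γ = {aα, bβ, cγ},       of class a + b + c,
--   ee a b p s     = {∞_(p xor s), ap, bq}, of class 2a + b,
--   aa a b s       = {a0, a1, bq},       of class 2a + b,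
--   dd a e         = {∞e, a0, a1},       of class 3a,
--   ff a p         = {∞0, ∞1, ap},       of class 3a.
data Triple : Set where
  cu : (a b c : ℕ) (α β γ : Bool) → Triple
  ee : (a b : ℕ) (p s : Bool) → Triple
  aa : (a b : ℕ) (s : Bool) → Triple
  dd : (a : ℕ) (e : Bool) → Triple
  ff : (a : ℕ) (p : Bool) → Triple

weight : Triple → ℕ
weight (cu a b c _ _ _) = a + b + c
weight (ee a b _ _)     = 2 * a + b
weight (aa a b _)       = 2 * a + b
weight (dd a _)         = 3 * a
weight (ff a _)         = 3 * a

-- The comparison makes the kinds `ee a b` and `ee b a` disjoint: on given finite points over `a`
-- and `b` they use opposite points at infinity.
twist : ℕ → ℕ → Bool → Bool
twist a b s = s xor (a <ᵇ b)

-- The smaller residue comes first, so that cubes and rings give a common pair the same label.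
pair : Point → Point → Label
pair x y = if proj₁ x <ᵇ proj₁ y then (x , y) else (y , x)

pair-< : ∀ {a b p q} → a < b → pair (a , p) (b , q) ≡ ((a , p) , (b , q))
pair-< {a} {b} h with a <ᵇ b | ℕ.<⇒<ᵇ h
... | true | _ = refl

<ᵇ-false : ∀ {a b} → b ≤ a → (a <ᵇ b) ≡ false
<ᵇ-false {a} {b} h with a <ᵇ b in e
... | false = refl
... | true = ⊥-elim (ℕ.≤⇒≯ h (ℕ.<ᵇ⇒< a b (subst T (sym e) _)))

<ᵇ-true : ∀ {a b} → a < b → (a <ᵇ b) ≡ true
<ᵇ-true {a} {b} h with a <ᵇ b | ℕ.<⇒<ᵇ h
... | true | _ = refl

pair-> : ∀ {a b p q} → b < a → pair (a , p) (b , q) ≡ ((b , q) , (a , p))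
pair-> {a} {b} h rewrite <ᵇ-false (ℕ.<⇒≤ h) = refl

-- A coding with a left inverse yields decidable equality without comparing every constructor with
-- every other.
code : Triple → List ℕ
code (cu a b c α β γ) = 0 ∷ a ∷ b ∷ c ∷ bit α ∷ bit β ∷ bit γ ∷ []
  where bit : Bool → ℕ
        bit b = if b then 1 else 0
code (ee a b p s) = 1 ∷ a ∷ b ∷ (if p then 1 else 0) ∷ (if s then 1 else 0) ∷ []
code (aa a b s)   = 2 ∷ a ∷ b ∷ (if s then 1 else 0) ∷ []
code (dd a e)     = 3 ∷ a ∷ (if e then 1 else 0) ∷ []
code (ff a p)     = 4 ∷ a ∷ (if p then 1 else 0) ∷ []

_≟ᵀ_ : DecidableEquality Triple
x ≟ᵀ y = map′ (λ e → just-injective (trans (sym (decode-code x)) (trans (cong decode e) (decode-code y)))) (cong code)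
              (List.≡-dec ℕ._≟_ (code x) (code y))
  where
  open import Data.Maybe.Properties using (just-injective)
  decode : List ℕ → Maybe Triple
  decode (0 ∷ a ∷ b ∷ c ∷ α ∷ β ∷ γ ∷ []) = just (cu a b c (0 <ᵇ α) (0 <ᵇ β) (0 <ᵇ γ))
  decode (1 ∷ a ∷ b ∷ p ∷ s ∷ [])         = just (ee a b (0 <ᵇ p) (0 <ᵇ s))
  decode (2 ∷ a ∷ b ∷ s ∷ [])             = just (aa a b (0 <ᵇ s))
  decode (3 ∷ a ∷ e ∷ [])                 = just (dd a (0 <ᵇ e))
  decode (4 ∷ a ∷ p ∷ [])                 = just (ff a (0 <ᵇ p))
  decode _                                = nothing
  bit-true : ∀ b → (0 <ᵇ (if b then 1 else 0)) ≡ b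
  bit-true false = refl
  bit-true true  = refl
  decode-code : ∀ t → decode (code t) ≡ just t
  decode-code (cu a b c α β γ) rewrite bit-true α | bit-true β | bit-true γ = refl
  decode-code (ee a b p s) rewrite bit-true p | bit-true s = refl
  decode-code (aa a b s)   rewrite bit-true s = refl
  decode-code (dd a e)     rewrite bit-true e = refl
  decode-code (ff a p)     rewrite bit-true p = refl

-- Names of the small closed walks: the eight triples over three residues; the triples with double
-- point `a` and parameter `s` in the classes `2 j` and `2 j + 1`; and one exceptional walk at the
-- double point 0.
data Id : Set where
  cube : (a b c : ℕ) → Id
  ring : (j a : ℕ) (s : Bool) → Id
  five : Id

_≟ᴵ_ : DecidableEquality Id
cube a b c ≟ᴵ cube a′ b′ c′ = map′ (λ { (refl , refl , refl) → refl }) (λ { refl → refl , refl , refl })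
  ((a ℕ.≟ a′) ×-dec ((b ℕ.≟ b′) ×-dec (c ℕ.≟ c′)))
ring j a s ≟ᴵ ring j′ a′ s′ = map′ (λ { (refl , refl , refl) → refl }) (λ { refl → refl , refl , refl })
  ((j ℕ.≟ j′) ×-dec ((a ℕ.≟ a′) ×-dec (s Bool.≟ s′)))
five ≟ᴵ five = yes refl
cube _ _ _ ≟ᴵ ring _ _ _ = no λ ()
cube _ _ _ ≟ᴵ five       = no λ ()
ring _ _ _ ≟ᴵ cube _ _ _ = no λ ()
ring _ _ _ ≟ᴵ five       = no λ ()
five ≟ᴵ cube _ _ _       = no λ ()
five ≟ᴵ ring _ _ _       = no λ ()

-- A sum of three residues is below `3 m`, so its congruence to `i` is one of three linear
-- equations. Congruences thereby stay within the reach of `lia`.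
residue near : (m x i : Term) → Formula
residue m x i = x :≡ i :∨ x :≡ m :+ i :∨ x :≡ 2 :* m :+ i
near m x i    = i :< m :∧ residue m x i

module Classes (m : ℕ) {{_ : NonZero m}} where

  infix 4 _≈_

  _≈_ : ℕ → ℕ → Set
  x ≈ i = i < m × (x ≡ i ⊎ x ≡ m + i ⊎ x ≡ 2 * m + i)

  cls : ℕ → ℕ
  cls x = x % m

  ≈-cls : ∀ {x i} → x ≈ i → cls x ≡ i
  ≈-cls (i<m , inj₁ refl) = ℕ.m<n⇒m%n≡m i<m
  ≈-cls {i = i} (i<m , inj₂ (inj₁ refl)) = trans (cong (_% m) (ℕ.+-comm m i)) (trans (ℕ.[m+n]%n≡m%n i m) (ℕ.m<n⇒m%n≡m i<m))
  ≈-cls {i = i} (i<m , inj₂ (inj₂ refl)) = trans (cong (_% m) (ℕ.+-comm (2 * m) i)) (trans (ℕ.[m+kn]%n≡m%n i 2 m) (ℕ.m<n⇒m%n≡m i<m))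

  cls-≈ : ∀ {x} → x < 3 * m → x ≈ cls x
  cls-≈ {x} h = ℕ.m%n<n x m , cases (x / m) (ℕ.m≡m%n+[m/n]*n x m)
    where
    cases : ∀ q → x ≡ x % m + q * m → x ≡ x % m ⊎ x ≡ m + x % m ⊎ x ≡ 2 * m + x % m
    cases 0 e = inj₁ (trans e (ℕ.+-identityʳ _))
    cases 1 e = inj₂ (inj₁ (lia 3 (λ x r m → x :≡ r :+ (m :+ lit 0) :⇒ x :≡ m :+ r) x (x % m) m e))
    cases 2 e = inj₂ (inj₂ (lia 3 (λ x r m → x :≡ r :+ (m :+ (m :+ lit 0)) :⇒ x :≡ 2 :* m :+ r) x (x % m) m e))
    cases (suc (suc (suc q))) e = ⊥-elim (lia 4 (λ x r m n → x :≡ r :+ (m :+ (m :+ (m :+ n))) :⇒ x :< 3 :* m :⇒ :⊥) x (x % m) m (q * m) e h)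

  abstract

    complement : ℕ → ℕ → ℕ
    complement x i with x ℕ.≤? i | x ℕ.≤? m + i
    ... | yes _ | _     = i ∸ x
    ... | no _  | yes _ = m + i ∸ x
    ... | no _  | no _  = 2 * m + i ∸ x

    complement-spec : ∀ {x i} → x ≤ 2 * m → i < m → complement x i < m × x + complement x i ≈ i
    complement-spec {x} {i} h i<m with x ℕ.≤? i | x ℕ.≤? m + i
    ... | yes p | _ = lia 4 (λ x c i m → x :+ c :≡ i :⇒ i :< m :⇒ (c :< m :∧ i :< m :∧ residue m (x :+ c) i))
        x (i ∸ x) i m (ℕ.m+[n∸m]≡n p) i<m
    ... | no ¬p | yes p = lia 4 (λ x c i m → x :+ c :≡ m :+ i :⇒ i :< m :⇒ i :< x :⇒ (c :< m :∧ i :< m :∧ residue m (x :+ c) i))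
        x (m + i ∸ x) i m (ℕ.m+[n∸m]≡n p) i<m (ℕ.≰⇒> ¬p)
    ... | no _ | no ¬p = lia 4 (λ x c i m → x :+ c :≡ 2 :* m :+ i :⇒ i :< m :⇒ m :+ i :< x :⇒ (c :< m :∧ i :< m :∧ residue m (x :+ c) i))
        x (2 * m + i ∸ x) i m (ℕ.m+[n∸m]≡n (ℕ.≤-trans h (ℕ.m≤m+n (2 * m) i))) i<m (ℕ.≰⇒> ¬p)

    complement-unique : ∀ {x c d i} → c < m → d < m → x + c ≈ i → x + d ≈ i → c ≡ d
    complement-unique {x} {c} {d} {i} c<m d<m (_ , h) (_ , h′) = lia 5 (λ x c d i m → c :< m :⇒ d :< m :⇒
      residue m (x :+ c) i :⇒ residue m (x :+ d) i :⇒ c :≡ d)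
      x c d i m c<m d<m h h′

-- Labels of triples and the small closed walks

module Incidence (m : ℕ) where

  pts : Triple → List Point
  pts (cu a b c α β γ) = (a , α) ∷ (b , β) ∷ (c , γ) ∷ []
  pts (ee a b p s)     = (a , p) ∷ (b , twist a b s) ∷ (m , p xor s) ∷ []
  pts (aa a b s)       = (a , false) ∷ (a , true) ∷ (b , twist a b s) ∷ []
  pts (dd a e)         = (a , false) ∷ (a , true) ∷ (m , e) ∷ []
  pts (ff a p)         = (a , p) ∷ (m , false) ∷ (m , true) ∷ []

  infix 4 _∋_

  record _∋_ (t : Triple) (ℓ : Label) : Set where
    constructor contains
    field
      first    : proj₁ ℓ ∈ pts t
      second   : proj₂ ℓ ∈ pts t
      distinct : proj₁ ℓ ≢ proj₂ ℓ

  open Walks _∋_ public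

  pattern 1st = here refl
  pattern 2nd = there (here refl)
  pattern 3rd = there (there (here refl))

  apart : ∀ {a b : ℕ} {p q : Bool} → a ≢ b → _≢_ {A = Point} (a , p) (b , q)
  apart ne refl = ne refl

  ∋-pair : ∀ {t a b p q} → (a , p) ∈ pts t → (b , q) ∈ pts t → a ≢ b → t ∋ pair (a , p) (b , q)
  ∋-pair {a = a} {b} x y ne with a <ᵇ b
  ... | true  = contains x y (apart ne)
  ... | false = contains y x (apart (ne ∘ sym))

  cu-ab : ∀ {a b c α β γ} → a < b → cu a b c α β γ ∋ ((a , α) , (b , β))
  cu-ab h = contains 1st 2nd (apart (ℕ.<⇒≢ h))

  cu-bc : ∀ {a b c α β γ} → b < c → cu a b c α β γ ∋ ((b , β) , (c , γ))
  cu-bc h = contains 2nd 3rd (apart (ℕ.<⇒≢ h))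

  cu-ac : ∀ {a b c α β γ} → a < c → cu a b c α β γ ∋ ((a , α) , (c , γ))
  cu-ac h = contains 1st 3rd (apart (ℕ.<⇒≢ h))

  ee-ab : ∀ {a b p s} → a ≢ b → ee a b p s ∋ pair (a , p) (b , twist a b s)
  ee-ab = ∋-pair 1st 2nd

  ee-a∞ : ∀ {a b p s} → a < m → ee a b p s ∋ ((a , p) , (m , p xor s))
  ee-a∞ h = contains 1st 3rd (apart (ℕ.<⇒≢ h))

  aa-ab : ∀ {a b s} p → a ≢ b → aa a b s ∋ pair (a , p) (b , twist a b s)
  aa-ab false = ∋-pair 1st 3rd
  aa-ab true  = ∋-pair 2nd 3rd

  aa-aa : ∀ {a b s} → aa a b s ∋ ((a , false) , (a , true))
  aa-aa = contains 1st 2nd λ ()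

  dd-aa : ∀ {a e} → dd a e ∋ ((a , false) , (a , true))
  dd-aa = contains 1st 2nd λ ()

  dd-a∞ : ∀ {a e} p → a < m → dd a e ∋ ((a , p) , (m , e))
  dd-a∞ false h = contains 1st 3rd (apart (ℕ.<⇒≢ h))
  dd-a∞ true  h = contains 2nd 3rd (apart (ℕ.<⇒≢ h))

  ff-a∞ : ∀ {a p} e → a < m → ff a p ∋ ((a , p) , (m , e))
  ff-a∞ false h = contains 1st 2nd (apart (ℕ.<⇒≢ h))
  ff-a∞ true  h = contains 1st 3rd (apart (ℕ.<⇒≢ h))

  ff-∞∞ : ∀ {a p} → ff a p ∋ ((m , false) , (m , true))
  ff-∞∞ = contains 2nd 3rd λ ()

  -- The two ends of the path of triples of a given class with double point a.
  tail head : ℕ → Bool → Label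
  tail a s = (a , false) , (m , s)
  head a s = (a , true) , (m , not s)

  -- The path runs from `a0, ∞s` to `a1` and the other point at infinity, through the triples with
  -- double point `a` and third residue `b`. If `b = a`, the parameter chooses between the two `dd`
  -- and the two `ff`, with the same ends. So the segments of any two classes close up to a ring.
  forth back : ℕ → ℕ → Bool → Walk
  forth a b s with a ℕ.≟ b
  ... | no _  = (ee a b false s , pair (a , false) (b , twist a b s)) ∷ (aa a b s , pair (a , true) (b , twist a b s)) ∷
                (ee a b true s , head a s) ∷ []
  ... | yes _ with s
  ...   | false = (dd a false , ((a , false) , (a , true))) ∷ (dd a true , head a s) ∷ []
  ...   | true  = (ff a false , ((m , false) , (m , true))) ∷ (ff a true , head a s) ∷ []
  back a b s = backward (tail a s) (forth a b s)

  forth-path : ∀ {a} b s → a < m → Path (tail a s) (forth a b s) (head a s)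
  forth-path {a} b s h with a ℕ.≟ b
  ... | no ne = (ee-a∞ h , ee-ab ne) ∷ (aa-ab false ne , aa-ab true ne) ∷ (ee-ab ne , ee-a∞ h) ∷ []
  ... | yes _ with s
  ...   | false = (dd-a∞ false h , dd-aa) ∷ (dd-aa , dd-a∞ true h) ∷ []
  ...   | true  = (ff-a∞ true h , ff-∞∞) ∷ (ff-∞∞ , ff-a∞ false h) ∷ []

  back-path : ∀ {a} b s → a < m → Path (head a s) (back a b s) (tail a s)
  back-path b s h = backward-path (forth-path b s h)

  forth-label : ∀ {a b} p s → a ≢ b → pair (a , p) (b , twist a b s) ∈ labels (forth a b s)
  forth-label {a} {b} p s ne with a ℕ.≟ b
  ... | yes e = ⊥-elim (ne e)
  forth-label false s ne | no _ = here refl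
  forth-label true  s ne | no _ = there (here refl)

  back-label : ∀ {a b} p s → a ≢ b → pair (a , p) (b , twist a b s) ∈ labels (back a b s)
  back-label {a} {b} p s ne with a ℕ.≟ b
  ... | yes e = ⊥-elim (ne e)
  back-label true  s ne | no _ = here refl
  back-label false s ne | no _ = there (here refl)

  head-∈ : ∀ a b s → head a s ∈ labels (forth a b s)
  head-∈ a b s with a ℕ.≟ b
  ... | no _ = there (there (here refl))
  ... | yes _ with s
  ...   | false = there (here refl)
  ...   | true  = there (here refl)

  tail-∈ : ∀ a b s → tail a s ∈ labels (back a b s)
  tail-∈ a b s with a ℕ.≟ b
  ... | no _ = there (there (here refl))
  ... | yes _ with s
  ...   | false = there (here refl)
  ...   | true  = there (here refl)

  -- A Hamilton cycle of the 3-cube of bits, the label of a step being the two points that do not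
  -- change. All four labels over `a`, `c` occur, but over `a`, `b` only those with bit `false` at
  -- `b`, and over `b`, `c` only those with bit `true` at `b`; every link through a cube has to
  -- respect this.
  cubeWalk : (a b c : ℕ) → Walk
  cubeWalk a b c =
    (cu a b c false false false , ((a , false) , (c , false))) ∷ (cu a b c false true false , ((b , true) , (c , false))) ∷
    (cu a b c true true false , ((a , true) , (c , false))) ∷ (cu a b c true false false , ((a , true) , (b , false))) ∷
    (cu a b c true false true , ((a , true) , (c , true))) ∷ (cu a b c true true true , ((b , true) , (c , true))) ∷
    (cu a b c false true true , ((a , false) , (c , true))) ∷ (cu a b c false false true , ((a , false) , (b , false))) ∷ []

  cube-path : ∀ {a b c} → a < b → b < c → Path ((a , false) , (b , false)) (cubeWalk a b c) ((a , false) , (b , false))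
  cube-path {a} {b} {c} h h′ = (cu-ab h , ac) ∷ (ac , cu-bc h′) ∷ (cu-bc h′ , ac) ∷ (ac , cu-ab h) ∷ (cu-ab h , ac) ∷ (ac , cu-bc h′) ∷ (cu-bc h′ , ac) ∷ (ac , cu-ab h) ∷ []
    where
    ac : ∀ {α β γ} → cu a b c α β γ ∋ ((a , α) , (c , γ))
    ac = cu-ac (ℕ.<-trans h h′)

  cube-ac : ∀ {a b c} α γ → ((a , α) , (c , γ)) ∈ labels (cubeWalk a b c)
  cube-ac false false = here refl
  cube-ac true  false = there (there (here refl))
  cube-ac true  true  = there (there (there (there (here refl))))
  cube-ac false true  = there (there (there (there (there (there (here refl))))))

  cube-ab : ∀ {a b c} α → ((a , α) , (b , false)) ∈ labels (cubeWalk a b c)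
  cube-ab true  = there (there (there (here refl)))
  cube-ab false = there (there (there (there (there (there (there (here refl)))))))

  cube-bc : ∀ {a b c} γ → ((b , true) , (c , γ)) ∈ labels (cubeWalk a b c)
  cube-bc false = there (here refl)
  cube-bc true  = there (there (there (there (there (here refl)))))

  -- The triples with double point 0 form no rings; the label (00, 01) of this
  -- walk serves to attach them.
  fiveWalk : Walk
  fiveWalk = (ee 0 1 false true , ((0 , false) , (1 , false))) ∷ (aa 0 1 true , ((0 , true) , (1 , false))) ∷
    (ee 0 1 true true , ((0 , true) , (m , false))) ∷ (dd 0 false , ((0 , false) , (0 , true))) ∷ (dd 0 true , ((0 , false) , (m , true))) ∷ []

  five-path : 0 < m → Path ((0 , false) , (m , true)) fiveWalk ((0 , false) , (m , true))
  five-path h = (ee-a∞ h , ee-ab (λ ())) ∷ (aa-ab false (λ ()) , aa-ab true (λ ())) ∷ (ee-ab (λ ()) , ee-a∞ h) ∷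
    (dd-a∞ true h , dd-aa) ∷ (dd-aa , dd-a∞ false h) ∷ []

-- Linking the cubes to a root

module Reach (m k : ℕ) {{_ : NonZero m}} (5≤m : 5 ≤ m) (2≤k : 2 ≤ k) (k≤m : k ≤ m) where

  open Classes m public
  open Incidence m public

  0<m : 0 < m
  0<m = ℕ.≤-trans (s≤s z≤n) 5≤m

  third : ℕ → ℕ → ℕ
  third i a = complement (2 * a) i

  ringWalk : ℕ → ℕ → Bool → Walk
  ringWalk j a s = forth a (third (2 * j) a) s ++ back a (third (suc (2 * j)) a) s

  piece : Id → Walk
  piece (cube a b c) = cubeWalk a b c
  piece (ring j a s) = ringWalk j a s
  piece five         = fiveWalk

  base : Id → Label
  base (cube a b c) = (a , false) , (b , false)
  base (ring j a s) = tail a s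
  base five         = (0 , false) , (m , true)

  Valid : Id → Set
  Valid (cube a b c) = a < b × b < c × c < m × cls (a + b + c) < k
  Valid (ring j a s) = suc (2 * j) < k × 0 < a × a < m
  Valid five         = 1 < k

  closed : ∀ {i} → Valid i → Path (base i) (piece i) (base i)
  closed {cube a b c} (h , h′ , _)   = cube-path h h′
  closed {ring j a s} (_ , _ , h)    = forth-path _ s h ++ᵖ back-path _ s h
  closed {five}       _              = five-path 0<m

  -- Its residues add up to `m`, so its class is 0; its largest residue is as large as possible,
  -- which makes it the end of the descent in `sum-m`.
  root : Id
  root = cube 0 1 (m ∸ 1)

  m-1 : suc (m ∸ 1) ≡ m
  m-1 = ℕ.m+[n∸m]≡n 0<m

  0≈ : 0 + 1 + (m ∸ 1) ≈ 0
  0≈ = 0<m , inj₂ (inj₁ (trans m-1 (sym (ℕ.+-identityʳ m))))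

  valid-root : Valid root
  valid-root = s≤s z≤n , lia 2 (λ m n → lit 1 :+ n :≡ m :⇒ lit 5 :≤ m :⇒ lit 1 :< n) m (m ∸ 1) m-1 5≤m , ℕ.≤-reflexive m-1 ,
    subst (_< k) (sym (≈-cls 0≈)) (ℕ.≤-trans (s≤s z≤n) 2≤k)

  open Pieces _≟ᴵ_ base piece Valid closed root valid-root public

  CubeReached : ℕ → ℕ → ℕ → Set
  CubeReached a b c = ∀ {ℓ} → ℓ ∈ labels (cubeWalk a b c) → Reached ℓ

  -- Cubes of class 0 and 1 are linked to the root by raising the largest
  -- coordinate and lowering another one in turn, cubes of class i ≥ 2 to cubes
  -- of class i - 1 by lowering a coordinate.
  module Cubes where

    Cube : ℕ → ℕ → ℕ → ℕ → Set
    Cube i a b c = a < b × b < c × c < m × a + b + c ≈ i × i < k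

    valid : ∀ {i a b c} → Cube i a b c → Valid (cube a b c)
    valid (h₁ , h₂ , h₃ , e , i<k) = h₁ , h₂ , h₃ , subst (_< k) (sym (≈-cls e)) i<k

    via : ∀ {i a b c a′ b′ c′ ℓ} → CubeReached a′ b′ c′ → Cube i a b c →
          ℓ ∈ labels (cubeWalk a′ b′ c′) → ℓ ∈ labels (cubeWalk a b c) → CubeReached a b c
    via {a = a} {b} {c} r v ℓ∈′ ℓ∈ = step (cube a b c) (valid v) (r ℓ∈′) ℓ∈

    change-a : ∀ {i a b c} a′ → CubeReached a′ b c → Cube i a b c → CubeReached a b c
    change-a {i} {a} {b} {c} a′ r v = via r v (cube-bc {a′} {b} {c} false) (cube-bc {a} {b} {c} false)

    change-b : ∀ {i a b c} b′ → CubeReached a b′ c → Cube i a b c → CubeReached a b c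
    change-b {i} {a} {b} {c} b′ r v = via r v (cube-ac {a} {b′} {c} false false) (cube-ac {a} {b} {c} false false)

    change-c : ∀ {i a b c} c′ → CubeReached a b c′ → Cube i a b c → CubeReached a b c
    change-c {i} {a} {b} {c} c′ r v = via r v (cube-ab {a} {b} {c′} false) (cube-ab {a} {b} {c} false)

    0<k : 0 < k
    0<k = ℕ.≤-trans (s≤s z≤n) 2≤k

    1<m : 1 < m
    1<m = ℕ.≤-trans (s≤s (s≤s z≤n)) 5≤m

    root-reached : CubeReached 0 1 (m ∸ 1)
    root-reached = start

    -- The distance `n` of the largest residue from `m` decreases whenever `c` is raised and is kept
    -- when `b` or `a` is lowered. At distance 1 only the root has sum `m`.
    sum-m   : ∀ n {a b c} → c + n ≡ m → a < b → b < c → 0 < n → a + b + c ≡ m → CubeReached a b c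
    sum-m+1 : ∀ n {a b c} → c + n ≡ m → a < b → b < c → 0 < n → a + b + c ≡ m + 1 → CubeReached a b c
    sum-m (suc zero) {a} {b} {c} e h h′ _ e′
      with refl , refl , refl ← lia 5 (λ a b c m m′ → c :+ lit 1 :≡ m :⇒ lit 1 :+ m′ :≡ m :⇒ a :< b :⇒ a :+ b :+ c :≡ m :⇒ (a :≡ lit 0 :∧ b :≡ lit 1 :∧ c :≡ m′))
             a b c m (m ∸ 1) e m-1 h e′ = root-reached
    sum-m (suc (suc n)) {a} {b} {c} e h h′ _ e′ =
      change-c (suc c) (sum-m+1 (suc n) (trans (sym (ℕ.+-suc c (suc n))) e) h (ℕ.m<n⇒m<1+n h′) (s≤s z≤n)
          (lia 4 (λ a b c m → a :+ b :+ c :≡ m :⇒ a :+ b :+ (lit 1 :+ c) :≡ m :+ lit 1) a b c m e′))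
        (h , h′ , lia 3 (λ c n m → c :+ (lit 2 :+ n) :≡ m :⇒ c :< m) c n m e , (0<m , inj₂ (inj₁ (trans e′ (sym (ℕ.+-identityʳ m))))) , 0<k)
    sum-m+1 (suc n) {a} {b} {c} e h h′ 0<n e′ with suc a ℕ.<? b
    sum-m+1 (suc n) {a} {suc b} {c} e h h′ 0<n e′ | yes p =
      change-b b (sum-m (suc n) e (s≤s⁻¹ p) (ℕ.<-trans (ℕ.n<1+n b) h′) 0<n
          (lia 4 (λ a b c m → a :+ (lit 1 :+ b) :+ c :≡ m :+ lit 1 :⇒ a :+ b :+ c :≡ m) a b c m e′))
        (h , h′ , lia 3 (λ c n m → c :+ (lit 1 :+ n) :≡ m :⇒ c :< m) c n m e , (1<m , inj₂ (inj₁ e′)) , 2≤k)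
    sum-m+1 (suc n) {zero} {b} {c} e h h′ 0<n e′ | no ¬p =
      ⊥-elim (lia 4 (λ b c m n → b :≤ lit 1 :⇒ c :+ (lit 1 :+ n) :≡ m :⇒ b :+ c :≡ m :+ lit 1 :⇒ :⊥) b c m n (ℕ.≮⇒≥ ¬p) e e′)
    sum-m+1 (suc n) {suc a} {b} {c} e h h′ 0<n e′ | no ¬p =
      change-a a (sum-m (suc n) e (ℕ.<-trans (ℕ.n<1+n a) h) h′ 0<n
          (lia 4 (λ a b c m → lit 1 :+ a :+ b :+ c :≡ m :+ lit 1 :⇒ a :+ b :+ c :≡ m) a b c m e′))
        (h , h′ , lia 3 (λ c n m → c :+ (lit 1 :+ n) :≡ m :⇒ c :< m) c n m e , (1<m , inj₂ (inj₁ e′)) , 2≤k)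

    reach-m+1 : ∀ {a b c} → a < b → b < c → c < m → a + b + c ≡ m + 1 → CubeReached a b c
    reach-m+1 {a} {b} {c} h h′ h″ = sum-m+1 (m ∸ c) (ℕ.m+[n∸m]≡n (ℕ.<⇒≤ h″)) h h′ (ℕ.m<n⇒0<n∸m h″)

    -- Here the smallest residue is the measure: after `c` or `b` has been raised, `a` is lowered.
    sum-2m   : ∀ a {b c} → a < b → b < c → c < m → a + b + c ≡ 2 * m → CubeReached a b c
    sum-2m+1 : ∀ a {b c} → a < b → b < c → c < m → a + b + c ≡ 2 * m + 1 → CubeReached a b c
    sum-2m a {b} {c} h h′ h″ e with suc c ℕ.<? m | suc b ℕ.<? c
    ... | yes p | _ = change-c (suc c) (sum-2m+1 a h (ℕ.m<n⇒m<1+n h′) p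
          (lia 4 (λ a b c m → a :+ b :+ c :≡ 2 :* m :⇒ a :+ b :+ (lit 1 :+ c) :≡ 2 :* m :+ lit 1) a b c m e))
        (h , h′ , h″ , (0<m , inj₂ (inj₂ (trans e (sym (ℕ.+-identityʳ _))))) , 0<k)
    ... | no _ | yes p = change-b (suc b) (sum-2m+1 a (ℕ.m<n⇒m<1+n h) p h″
          (lia 4 (λ a b c m → a :+ b :+ c :≡ 2 :* m :⇒ a :+ (lit 1 :+ b) :+ c :≡ 2 :* m :+ lit 1) a b c m e))
        (h , h′ , h″ , (0<m , inj₂ (inj₂ (trans e (sym (ℕ.+-identityʳ _))))) , 0<k)
    -- Nothing can be raised only if `c = m - 1` and `b = m - 2`, whence `a = 3`. The cube over 0,
    -- 3, `m - 2` has sum `m + 1` and shares a label over 3 and `m - 2`.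
    ... | no ¬p | no ¬q with refl , e₁ ← lia 4 (λ a b c m → m :≤ lit 1 :+ c :⇒ c :≤ lit 1 :+ b :⇒ b :< c :⇒ c :< m :⇒ a :+ b :+ c :≡ 2 :* m :⇒ (a :≡ lit 3 :∧ lit 2 :+ b :≡ m))
          a b c m (ℕ.≮⇒≥ ¬p) (ℕ.≮⇒≥ ¬q) h′ h″ e =
      via {a′ = 0} {b′ = 3} {c′ = b} (reach-m+1 (s≤s z≤n) h (ℕ.<-trans h′ h″) (lia 2 (λ b m → lit 2 :+ b :≡ m :⇒ lit 0 :+ lit 3 :+ b :≡ m :+ lit 1) b m e₁))
        (h , h′ , h″ , (0<m , inj₂ (inj₂ (trans e (sym (ℕ.+-identityʳ _))))) , 0<k)
        (cube-bc {0} {3} {b} false) (cube-ab {3} {b} {c} true)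
    sum-2m+1 zero {b} {c} h h′ h″ e =
      ⊥-elim (lia 3 (λ b c m → b :< c :⇒ c :< m :⇒ b :+ c :≡ 2 :* m :+ lit 1 :⇒ :⊥) b c m h′ h″ e)
    sum-2m+1 (suc a) {b} {c} h h′ h″ e =
      change-a a (sum-2m a (ℕ.<-trans (ℕ.n<1+n a) h) h′ h″ (lia 4 (λ a b c m → lit 1 :+ a :+ b :+ c :≡ 2 :* m :+ lit 1 :⇒ a :+ b :+ c :≡ 2 :* m) a b c m e))
        (h , h′ , h″ , (1<m , inj₂ (inj₂ e)) , 2≤k)

    reached : ∀ i {a b c} → Cube i a b c → CubeReached a b c
    reached zero {a} {b} {c} (h , h′ , h″ , (_ , inj₁ e) , _) = ⊥-elim (lia 3 (λ a b c → a :< b :⇒ a :+ b :+ c :≡ lit 0 :⇒ :⊥) a b c h e)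
    reached zero {a} {b} {c} (h , h′ , h″ , (_ , inj₂ (inj₁ e)) , _) = sum-m (m ∸ c) (ℕ.m+[n∸m]≡n (ℕ.<⇒≤ h″)) h h′ (ℕ.m<n⇒0<n∸m h″) (trans e (ℕ.+-identityʳ m))
    reached zero (h , h′ , h″ , (_ , inj₂ (inj₂ e)) , _) = sum-2m _ h h′ h″ (trans e (ℕ.+-identityʳ _))
    reached (suc zero) {a} {b} {c} (h , h′ , h″ , (_ , inj₁ e) , _) = ⊥-elim (lia 3 (λ a b c → a :< b :⇒ b :< c :⇒ a :+ b :+ c :≡ lit 1 :⇒ :⊥) a b c h h′ e)
    reached (suc zero) (h , h′ , h″ , (_ , inj₂ (inj₁ e)) , _) = reach-m+1 h h′ h″ e
    reached (suc zero) (h , h′ , h″ , (_ , inj₂ (inj₂ e)) , _) = sum-2m+1 _ h h′ h″ e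
    reached (suc (suc i)) {a} {b} {c} v@(h , h′ , h″ , e , i<k) with suc a ℕ.<? b | suc b ℕ.<? c
    reached (suc (suc i)) {a} {suc b} {c} v@(h , h′ , h″ , (i<m , e) , i<k) | yes p | _ =
      change-b b (reached (suc i) (s≤s⁻¹ p , ℕ.<-trans (ℕ.n<1+n b) h′ , h″ , (ℕ.<-trans (ℕ.n<1+n _) i<m ,
        lia 5 (λ a b c i m → residue m (a :+ (lit 1 :+ b) :+ c) (lit 2 :+ i) :⇒
          residue m (a :+ b :+ c) (lit 1 :+ i)) a b c i m e) , ℕ.<-trans (ℕ.n<1+n _) i<k)) v
    reached (suc (suc i)) {a} {b} {suc c} v@(h , h′ , h″ , (i<m , e) , i<k) | no _ | yes p =
      change-c c (reached (suc i) (h , s≤s⁻¹ p , ℕ.<-trans (ℕ.n<1+n c) h″ , (ℕ.<-trans (ℕ.n<1+n _) i<m ,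
        lia 5 (λ a b c i m → residue m (a :+ b :+ (lit 1 :+ c)) (lit 2 :+ i) :⇒
          residue m (a :+ b :+ c) (lit 1 :+ i)) a b c i m e) , ℕ.<-trans (ℕ.n<1+n _) i<k)) v
    reached (suc (suc i)) {suc a} {b} {c} v@(h , h′ , h″ , (i<m , e) , i<k) | no _ | no _ =
      change-a a (reached (suc i) (ℕ.<-trans (ℕ.n<1+n a) h , h′ , h″ , (ℕ.<-trans (ℕ.n<1+n _) i<m ,
        lia 5 (λ a b c i m → residue m (lit 1 :+ a :+ b :+ c) (lit 2 :+ i) :⇒
          residue m (a :+ b :+ c) (lit 1 :+ i)) a b c i m e) , ℕ.<-trans (ℕ.n<1+n _) i<k)) v
    -- Nothing can be lowered only in the cube over 0, 1, 2, which shares a label over 0 and 1 with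
    -- the root.
    reached (suc (suc i)) {zero} {b} {c} v@(h , h′ , h″ , (i<m , e) , i<k) | no p | no q with refl , refl ← lia 2 (λ b c → lit 0 :< b :⇒ b :< c :⇒ b :≤ lit 1 :⇒ c :≤ lit 1 :+ b :⇒ (b :≡ lit 1 :∧ c :≡ lit 2)) b c h h′ (ℕ.≮⇒≥ p) (ℕ.≮⇒≥ q) =
      change-c (m ∸ 1) root-reached v

halves : ∀ n → n ≡ 2 * ⌊ n /2⌋ ⊎ n ≡ suc (2 * ⌊ n /2⌋)
halves zero          = inj₁ refl
halves (suc zero)    = inj₂ refl
halves (suc (suc n)) with halves n
... | inj₁ e = inj₁ (lia 2 (λ n h → n :≡ 2 :* h :⇒ lit 2 :+ n :≡ 2 :* (lit 1 :+ h)) n ⌊ n /2⌋ e)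
... | inj₂ e = inj₂ (lia 2 (λ n h → n :≡ lit 1 :+ 2 :* h :⇒ lit 2 :+ n :≡ lit 1 :+ 2 :* (lit 1 :+ h)) n ⌊ n /2⌋ e)

-- Linking the rings

module Attachments (m k : ℕ) {{_ : NonZero m}} (5≤m : 5 ≤ m) (2≤k : 2 ≤ k) (k≤m : k ≤ m) where

  open Reach m k 5≤m 2≤k k≤m public
  open Cubes

  third-spec : ∀ {i a} → i < m → a < m → third i a < m × 2 * a + third i a ≈ i
  third-spec {i} {a} i<m a<m = complement-spec (lia 2 (λ a m → a :< m :⇒ 2 :* a :≤ 2 :* m) a m a<m) i<m

  third-unique : ∀ {i a b} → a < m → b < m → 2 * a + b ≈ i → third i a ≡ b
  third-unique {i} {a} {b} a<m b<m e with c<m , e′ ← third-spec {i} {a} (proj₁ e) a<m = complement-unique {2 * a} c<m b<m e′ e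

  ∈-labelsˡ : ∀ {ℓ u} v → ℓ ∈ labels u → ℓ ∈ labels (u ++ v)
  ∈-labelsˡ {ℓ} {u} v ℓ∈ = subst (ℓ ∈_) (sym (List.map-++ proj₂ u v)) (∈-++⁺ˡ ℓ∈)

  ∈-labelsʳ : ∀ {ℓ} u {v} → ℓ ∈ labels v → ℓ ∈ labels (u ++ v)
  ∈-labelsʳ {ℓ} u {v} ℓ∈ = subst (ℓ ∈_) (sym (List.map-++ proj₂ u v)) (∈-++⁺ʳ (labels u) ℓ∈)

  ring-label : ∀ {j a b s} p → a < m → b < m → a ≢ b → 2 * a + b ≈ 2 * j ⊎ 2 * a + b ≈ suc (2 * j) →
               pair (a , p) (b , twist a b s) ∈ labels (ringWalk j a s)
  ring-label {j} {a} {b} {s} p a<m b<m ne (inj₁ e) with refl ← third-unique a<m b<m e = ∈-labelsˡ _ (forth-label p s ne)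
  ring-label {j} {a} {b} {s} p a<m b<m ne (inj₂ e) with refl ← third-unique a<m b<m e = ∈-labelsʳ (forth a (third (2 * j) a) s) (back-label p s ne)

  ring-tail : ∀ {j a s} → tail a s ∈ labels (ringWalk j a s)
  ring-tail {j} {a} {s} = ∈-labelsʳ (forth a (third (2 * j) a) s) (tail-∈ a _ s)

  ring-head : ∀ {j a s} → head a s ∈ labels (ringWalk j a s)
  ring-head {j} {a} {s} = ∈-labelsˡ _ (head-∈ a _ s)

  -- Rings with the same a and s share a label, so it is enough to link those
  -- with j = 0. If a triple with double point a and third point b has class i,
  -- then the cube {a - 1, a, b} has class i - 1.
  RingReached : ℕ → Bool → Set
  RingReached a s = ∀ {ℓ} → ℓ ∈ labels (ringWalk 0 a s) → Reached ℓ

  ring-via : ∀ {a s ℓ} → 0 < a → a < m → Reached ℓ → ℓ ∈ labels (ringWalk 0 a s) → RingReached a s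
  ring-via {a} {s} h h′ r ℓ∈ = step (ring 0 a s) (2≤k , h , h′) r ℓ∈

  -- The shared label carries the bit `true` at the double point, because a cube offers it both as
  -- middle residue (`cube-bc`) and as largest (`cube-ac`). The two excluded cases are those in
  -- which `a - 1`, `a` and the third residue are not distinct.
  ring-typical : ∀ {a} s → 0 < a → a < m → a ≢ third 1 a → suc (third 1 a) ≢ a → RingReached a s
  ring-typical {suc a} s 0<a a<m ne ne′ with b<m , e ← third-spec {1} {suc a} 1<m a<m | ℕ.<-cmp (suc a) (third 1 (suc a))
  ... | tri≈ _ eq _ = ⊥-elim (ne eq)
  ... | tri< lt _ _ = ring-via 0<a a<m (reached 0 (ℕ.n<1+n a , lt , b<m , sum≈ , 0<k) (cube-bc {a} {suc a} {b} (twist (suc a) b s)))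
          (subst (_∈ labels (ringWalk 0 (suc a) s)) (pair-< lt) (ring-label {0} true a<m b<m ne (inj₂ e)))
    where
    b = third 1 (suc a)
    sum≈ : a + suc a + b ≈ 0
    sum≈ = lia 3 (λ a b m → near m (2 :* (lit 1 :+ a) :+ b) (lit 1) :⇒
      near m (a :+ (lit 1 :+ a) :+ b) (lit 0)) a b m e
  ... | tri> _ _ gt = ring-via 0<a a<m (reached 0 (s≤s⁻¹ (ℕ.≤∧≢⇒< gt ne′) , ℕ.n<1+n a , a<m , sum≈ , 0<k) (cube-ac {b} {a} {suc a} (twist (suc a) b s) true))
          (subst (_∈ labels (ringWalk 0 (suc a) s)) (pair-> gt) (ring-label {0} true a<m b<m ne (inj₂ e)))
    where
    b = third 1 (suc a)
    sum≈ : b + a + suc a ≈ 0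
    sum≈ = lia 3 (λ a b m → near m (2 :* (lit 1 :+ a) :+ b) (lit 1) :⇒
      near m (b :+ a :+ (lit 1 :+ a)) (lit 0)) a b m e

  ring-cases : ∀ {a} s → 0 < a → a < m → Dec (a ≡ third 1 a) → Dec (suc (third 1 a) ≡ a) → RingReached a s
  ring-cases s 0<a a<m (no ne) (no ne′) = ring-typical s 0<a a<m ne ne′
  -- Here `3 a = 1` modulo `m`. The class 0 segment has the third residue `a - 1`, and `a - 1`, `a`,
  -- `a + 1` form a cube of class 1 with bit `false` available at its middle residue.
  ring-cases {a} s 0<a a<m (yes eq) _ with b<m , (_ , e₀) ← third-spec {0} {a} 0<m a<m | _ , (_ , e₁) ← third-spec {1} {a} 1<m a<m
    with eb , lt , eq₀ ← lia 4 (λ a b c m → a :≡ c :⇒ a :< m :⇒ b :< m :⇒ lit 5 :≤ m :⇒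
             residue m (2 :* a :+ b) (lit 0) :⇒
             residue m (2 :* a :+ c) (lit 1) :⇒
             (lit 1 :+ b :≡ a :∧ lit 1 :+ a :< m :∧ residue m (b :+ a :+ (lit 1 :+ a)) (lit 1)))
           a (third 0 a) (third 1 a) m eq a<m b<m 5≤m e₀ e₁ =
      ring-via 0<a a<m (reached 1 {b} {a} {suc a} (b<a , ℕ.n<1+n a , lt , (1<m , eq₀) , 2≤k) (cube-ab {b} {a} {suc a} (twist a b s)))
        (subst (_∈ labels (ringWalk 0 a s)) (pair-> b<a) (ring-label {0} false a<m b<m (ℕ.<⇒≢ b<a ∘ sym) (inj₁ (0<m , e₀))))
    where
    b = third 0 a
    b<a : b < a
    b<a = ℕ.≤-reflexive eb
  -- Here `3 b + 1 = 0` modulo `m`, so the triples with double point `b` and third residue `b + 1`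
  -- have class 0. The ring at `b` is typical and shares a label with the ring at `b + 1`; its
  -- parameter `true` cancels the twist and leaves the bit `false` at `b + 1`.
  ring-cases {suc b} s 0<a a<m (no _) (yes eq) with e₁@(_ , e) ← subst (λ t → 2 * suc b + t ≈ 1) (ℕ.suc-injective eq) (proj₂ (third-spec {1} {suc b} 1<m a<m))
    with d<m , (_ , e′) ← third-spec {1} {b} 1<m (ℕ.<-trans (ℕ.n<1+n b) a<m)
    with 0<b , ne , ne′ , e₀ ← lia 3 (λ b d m → lit 1 :+ b :< m :⇒ d :< m :⇒ lit 5 :≤ m :⇒
             residue m (2 :* (lit 1 :+ b) :+ b) (lit 1) :⇒
             residue m (2 :* b :+ d) (lit 1) :⇒
             (lit 0 :< b :∧ (b :≡ d :⇒ :⊥) :∧ (lit 1 :+ d :≡ b :⇒ :⊥) :∧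
              residue m (2 :* b :+ (lit 1 :+ b)) (lit 0)))
           b (third 1 b) m a<m d<m 5≤m e e′ =
      ring-via 0<a a<m (ring-typical true 0<b b<m ne ne′
          (subst (_∈ labels (ringWalk 0 b true)) (trans (pair-< (ℕ.n<1+n b)) (cong (λ t → (b , twist (suc b) b s) , (suc b , not t)) (<ᵇ-true (ℕ.n<1+n b))))
            (ring-label {0} (twist (suc b) b s) b<m a<m (ℕ.<⇒≢ (ℕ.n<1+n b)) (inj₁ (0<m , e₀)))))
        (subst (_∈ labels (ringWalk 0 (suc b) s)) (pair-> (ℕ.n<1+n b)) (ring-label {0} false a<m b<m (ℕ.<⇒≢ (ℕ.n<1+n b) ∘ sym) (inj₂ e₁)))
    where
    b<m : b < m
    b<m = ℕ.<-trans (ℕ.n<1+n b) a<m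

  ring-reached : ∀ {a} s → 0 < a → a < m → RingReached a s
  ring-reached {a} s 0<a a<m = ring-cases s 0<a a<m (a ℕ.≟ third 1 a) (suc (third 1 a) ℕ.≟ a)

  -- Tail and head for the two parameters are the four labels over `a` and infinity.
  ∞-reached : ∀ {a} p e → 0 < a → a < m → Reached ((a , p) , (m , e))
  ∞-reached {a} false e     0<a a<m = ring-reached e 0<a a<m (ring-tail {0})
  ∞-reached {a} true  false 0<a a<m = ring-reached true 0<a a<m (ring-head {0})
  ∞-reached {a} true  true  0<a a<m = ring-reached false 0<a a<m (ring-head {0})

  five-reached : ∀ {ℓ} → ℓ ∈ labels fiveWalk → Reached ℓ
  five-reached = step five 2≤k (root-reached (cube-ab {0} {1} {m ∸ 1} false)) (here refl)

  attached : ∀ i → Valid i → Attached i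
  attached (cube a b c) (h , h′ , h″ , i<k) = _ , reached (cls (a + b + c)) (h , h′ , h″ ,
      cls-≈ (lia 4 (λ a b c m → a :< b :⇒ b :< c :⇒ c :< m :⇒ a :+ b :+ c :< 3 :* m) a b c m h h′ h″) , i<k) (cube-ac {a} {b} {c} false false) , cube-ac {a} {b} {c} false false
  attached (ring j a s) (_ , 0<a , a<m) = tail a s , ∞-reached false s 0<a a<m , ring-tail {j}
  attached five _ = _ , five-reached (here refl) , here refl

⌊2*n/2⌋ : ∀ n → ⌊ 2 * n /2⌋ ≡ n
⌊2*n/2⌋ n = trans (cong (λ t → ⌊ n + t /2⌋) (ℕ.+-identityʳ n)) (sym (ℕ.n≡⌊n+n/2⌋ n))

⌊1+2*n/2⌋ : ∀ n → ⌊ suc (2 * n) /2⌋ ≡ n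
⌊1+2*n/2⌋ n = trans (cong (λ t → ⌊ suc (n + t) /2⌋) (ℕ.+-identityʳ n)) (sym (ℕ.n≡⌈n+n/2⌉ n))

-- Partition of the triples into pieces

ValidTriple : ℕ → Triple → Set
ValidTriple m (cu a b c _ _ _) = a < b × b < c × c < m
ValidTriple m (ee a b _ _)     = a < m × b < m × a ≢ b
ValidTriple m (aa a b _)       = a < m × b < m × a ≢ b
ValidTriple m (dd a _)         = a < m
ValidTriple m (ff a _)         = a < m

weight-< : ∀ m t → ValidTriple m t → weight t < 3 * m
weight-< m (cu a b c _ _ _) (h , h′ , h″) = lia 4 (λ a b c m → a :< b :⇒ b :< c :⇒ c :< m :⇒ a :+ b :+ c :< 3 :* m) a b c m h h′ h″
weight-< m (ee a b _ _) (h , h′ , _) = lia 3 (λ a b m → a :< m :⇒ b :< m :⇒ 2 :* a :+ b :< 3 :* m) a b m h h′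
weight-< m (aa a b _) (h , h′ , _) = lia 3 (λ a b m → a :< m :⇒ b :< m :⇒ 2 :* a :+ b :< 3 :* m) a b m h h′
weight-< m (dd a _) h = ℕ.*-monoʳ-< 3 h
weight-< m (ff a _) h = ℕ.*-monoʳ-< 3 h

module Order (m k : ℕ) {{_ : NonZero m}} (5≤m : 5 ≤ m) (2≤k : 2 ≤ k) (k≤m : k ≤ m) where

  open Attachments m k 5≤m 2≤k k≤m public
  open Cubes using (reached; 0<k; 1<m)

  class : Triple → ℕ
  class t = cls (weight t)

  class-≈ : ∀ {t} → ValidTriple m t → weight t ≈ class t
  class-≈ {t} v = cls-≈ (weight-< m t v)

  special : ℕ → Bool → Maybe Id
  special 1 true = just five
  special _ _    = nothing

  -- Every triple of a valid piece names that piece, which makes different pieces disjoint. A named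
  -- ring need not be valid: for odd `k` the class `k - 1` has no partner.
  pieceOf : Triple → Maybe Id
  pieceOf (cu a b c _ _ _)     = just (cube a b c)
  pieceOf (ee zero b p s)      = special b s
  pieceOf (aa zero b s)        = special b s
  pieceOf (dd zero e)          = just five
  pieceOf (ff zero p)          = nothing
  pieceOf (ee a@(suc _) b p s) = just (ring ⌊ cls (2 * a + b) /2⌋ a s)
  pieceOf (aa a@(suc _) b s)   = just (ring ⌊ cls (2 * a + b) /2⌋ a s)
  pieceOf (dd a@(suc _) e)     = just (ring ⌊ cls (3 * a) /2⌋ a false)
  pieceOf (ff a@(suc _) p)     = just (ring ⌊ cls (3 * a) /2⌋ a true)

  data Segment (a b : ℕ) : Bool → Triple → Set where
    ee : ∀ {p s} → a ≢ b → Segment a b s (ee a b p s)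
    aa : ∀ {s} → a ≢ b → Segment a b s (aa a b s)
    dd : ∀ {e} → a ≡ b → Segment a b false (dd a e)
    ff : ∀ {p} → a ≡ b → Segment a b true (ff a p)

  forth⁻ : ∀ {a b s t} → t ∈ blocks (forth a b s) → Segment a b s t
  forth⁻ {a} {b} {s} t∈ with a ℕ.≟ b | s
  forth⁻ (here refl)                 | no ne | s = ee ne
  forth⁻ (there (here refl))         | no ne | s = aa ne
  forth⁻ (there (there (here refl))) | no ne | s = ee ne
  forth⁻ (here refl)                 | yes e | false = dd e
  forth⁻ (there (here refl))         | yes e | false = dd e
  forth⁻ (here refl)                 | yes e | true = ff e
  forth⁻ (there (here refl))         | yes e | true = ff e

  back⁻ : ∀ {a b s t} → t ∈ blocks (back a b s) → Segment a b s t
  back⁻ {a} {b} {s} = forth⁻ ∘ ↭.∈-resp-↭ (↭-sym (backward-blocks (tail a s) (forth a b s)))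

  forth⁺ : ∀ {a b s t} → Segment a b s t → t ∈ blocks (forth a b s)
  forth⁺ {a} {b} seg with a ℕ.≟ b
  forth⁺ (ee {p = false} _) | no _ = here refl
  forth⁺ (ee {p = true} _)  | no _ = there (there (here refl))
  forth⁺ (aa _)             | no _ = there (here refl)
  forth⁺ (dd e)             | no ne = ⊥-elim (ne e)
  forth⁺ (ff e)             | no ne = ⊥-elim (ne e)
  forth⁺ (ee ne)            | yes e = ⊥-elim (ne e)
  forth⁺ (aa ne)            | yes e = ⊥-elim (ne e)
  forth⁺ (dd {false} _)     | yes _ = here refl
  forth⁺ (dd {true} _)      | yes _ = there (here refl)
  forth⁺ (ff {false} _)     | yes _ = here refl
  forth⁺ (ff {true} _)      | yes _ = there (here refl)

  back⁺ : ∀ {a b s t} → Segment a b s t → t ∈ blocks (back a b s)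
  back⁺ {a} {b} {s} = ↭.∈-resp-↭ (backward-blocks (tail a s) (forth a b s)) ∘ forth⁺

  forth-unique : ∀ a b s → Unique (blocks (forth a b s))
  forth-unique a b s with a ℕ.≟ b | s
  ... | no _  | _     = ((λ ()) ∷ (λ ()) ∷ []) ∷ ((λ ()) ∷ []) ∷ [] ∷ []
  ... | yes _ | false = ((λ ()) ∷ []) ∷ [] ∷ []
  ... | yes _ | true  = ((λ ()) ∷ []) ∷ [] ∷ []

  back-unique : ∀ a b s → Unique (blocks (back a b s))
  back-unique a b s = ↭-unique (backward-blocks (tail a s) (forth a b s)) (forth-unique a b s)

  Belongs : Triple → Id → Set
  Belongs t i = ValidTriple m t × class t < k × pieceOf t ≡ just i

  segment-class : ∀ {i a s t} → 0 < a → a < m → i < m → Segment a (third i a) s t →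
                  ValidTriple m t × class t ≡ i × pieceOf t ≡ just (ring ⌊ i /2⌋ a s)
  segment-class {i} {suc a} _ a<m i<m seg with b<m , e ← third-spec {i} {suc a} i<m a<m | seg
  ... | ee ne = (a<m , b<m , ne) , ≈-cls e , cong (λ c → just (ring ⌊ c /2⌋ _ _)) (≈-cls e)
  ... | aa ne = (a<m , b<m , ne) , ≈-cls e , cong (λ c → just (ring ⌊ c /2⌋ _ _)) (≈-cls e)
  ... | dd eq = a<m , triple eq e , cong (λ c → just (ring ⌊ c /2⌋ _ _)) (triple eq e)
    where
    triple : ∀ {b} → suc a ≡ b → 2 * suc a + b ≈ i → cls (3 * suc a) ≡ i
    triple refl e = trans (cong cls (lia 1 (λ a → 3 :* (lit 1 :+ a) :≡ 2 :* (lit 1 :+ a) :+ (lit 1 :+ a)) a)) (≈-cls e)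
  ... | ff eq = a<m , triple eq e , cong (λ c → just (ring ⌊ c /2⌋ _ _)) (triple eq e)
    where
    triple : ∀ {b} → suc a ≡ b → 2 * suc a + b ≈ i → cls (3 * suc a) ≡ i
    triple refl e = trans (cong cls (lia 1 (λ a → 3 :* (lit 1 :+ a) :≡ 2 :* (lit 1 :+ a) :+ (lit 1 :+ a)) a)) (≈-cls e)

  segment : ∀ t {j a s} → ValidTriple m t → pieceOf t ≡ just (ring j a s) →
            (class t ≡ 2 * j ⊎ class t ≡ suc (2 * j)) × Segment a (third (class t) a) s t
  segment (ee zero b p s) v e with b | s
  segment (ee zero b p s) v () | 0 | _
  segment (ee zero b p s) v () | 1 | false
  segment (ee zero b p s) v () | 1 | true
  segment (ee zero b p s) v () | suc (suc _) | _
  segment (aa zero b s) v e with b | s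
  segment (aa zero b s) v () | 0 | _
  segment (aa zero b s) v () | 1 | false
  segment (aa zero b s) v () | 1 | true
  segment (aa zero b s) v () | suc (suc _) | _
  segment (ee (suc a) b p s) v@(a<m , b<m , ne) refl = halves _ , subst (λ c → Segment (suc a) c s (ee (suc a) b p s))
    (sym (third-unique {b = b} a<m b<m (class-≈ {ee (suc a) b p s} v))) (ee ne)
  segment (aa (suc a) b s) v@(a<m , b<m , ne) refl = halves _ , subst (λ c → Segment (suc a) c s (aa (suc a) b s))
    (sym (third-unique {b = b} a<m b<m (class-≈ {aa (suc a) b s} v))) (aa ne)
  segment (dd (suc a) e) a<m refl = halves _ , dd (sym (third-unique {b = suc a} a<m a<m
    (subst (_≈ cls (3 * suc a)) (lia 1 (λ a → 3 :* (lit 1 :+ a) :≡ 2 :* (lit 1 :+ a) :+ (lit 1 :+ a)) a) (class-≈ {dd (suc a) e} a<m))))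
  segment (ff (suc a) e) a<m refl = halves _ , ff (sym (third-unique {b = suc a} a<m a<m
    (subst (_≈ cls (3 * suc a)) (lia 1 (λ a → 3 :* (lit 1 :+ a) :≡ 2 :* (lit 1 :+ a) :+ (lit 1 :+ a)) a) (class-≈ {ff (suc a) e} a<m))))

  piece⁻ : ∀ i {t} → Valid i → t ∈ blocks (piece i) → Belongs t i
  piece⁻ (cube a b c) (h , h′ , h″ , i<k) t∈ with t∈
  ... | here refl = (h , h′ , h″) , i<k , refl
  ... | there (here refl) = (h , h′ , h″) , i<k , refl
  ... | there (there (here refl)) = (h , h′ , h″) , i<k , refl
  ... | there (there (there (here refl))) = (h , h′ , h″) , i<k , refl
  ... | there (there (there (there (here refl)))) = (h , h′ , h″) , i<k , refl
  ... | there (there (there (there (there (here refl))))) = (h , h′ , h″) , i<k , refl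
  ... | there (there (there (there (there (there (here refl)))))) = (h , h′ , h″) , i<k , refl
  ... | there (there (there (there (there (there (there (here refl))))))) = (h , h′ , h″) , i<k , refl
  piece⁻ (ring j a s) {t} (j<k , 0<a , a<m) t∈
    with ∈-++⁻ (blocks (forth a (third (2 * j) a) s)) (subst (t ∈_) (List.map-++ proj₁ (forth a (third (2 * j) a) s) _) t∈)
  ... | inj₁ t∈₁ with v , c , e ← segment-class 0<a a<m (ℕ.<-trans (ℕ.n<1+n _) (ℕ.≤-trans j<k k≤m)) (forth⁻ t∈₁) =
    v , subst (_< k) (sym c) (ℕ.<-trans (ℕ.n<1+n _) j<k) , trans e (cong (λ j → just (ring j a s)) (⌊2*n/2⌋ j))
  ... | inj₂ t∈₂ with v , c , e ← segment-class 0<a a<m (ℕ.≤-trans j<k k≤m) (back⁻ t∈₂) =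
    v , subst (_< k) (sym c) j<k , trans e (cong (λ j → just (ring j a s)) (⌊1+2*n/2⌋ j))
  piece⁻ five _ t∈ with t∈
  ... | here refl = (0<m , 1<m , λ ()) , subst (_< k) (sym (≈-cls (1<m , inj₁ refl))) 2≤k , refl
  ... | there (here refl) = (0<m , 1<m , λ ()) , subst (_< k) (sym (≈-cls (1<m , inj₁ refl))) 2≤k , refl
  ... | there (there (here refl)) = (0<m , 1<m , λ ()) , subst (_< k) (sym (≈-cls (1<m , inj₁ refl))) 2≤k , refl
  ... | there (there (there (here refl))) = 0<m , subst (_< k) (sym (≈-cls (0<m , inj₁ refl))) 0<k , refl
  ... | there (there (there (there (here refl)))) = 0<m , subst (_< k) (sym (≈-cls (0<m , inj₁ refl))) 0<k , refl

  piece⁺ : ∀ i {t} → Valid i → Belongs t i → t ∈ blocks (piece i)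
  piece⁺ (ring j a s) {t} (j<k , 0<a , a<m) (v , _ , e)
    with segment t v e
  ... | inj₁ c , seg = subst (t ∈_) (sym (List.map-++ proj₁ (forth a (third (2 * j) a) s) _))
    (∈-++⁺ˡ (forth⁺ (subst (λ i → Segment a (third i a) s t) c seg)))
  ... | inj₂ c , seg = subst (t ∈_) (sym (List.map-++ proj₁ (forth a (third (2 * j) a) s) _))
    (∈-++⁺ʳ (blocks (forth a (third (2 * j) a) s)) (back⁺ (subst (λ i → Segment a (third i a) s t) c seg)))
  piece⁺ (cube a b c) {cu a b c false false false} _ (_ , _ , refl) = here refl
  piece⁺ (cube a b c) {cu a b c false true false} _ (_ , _ , refl) = there (here refl)
  piece⁺ (cube a b c) {cu a b c true true false} _ (_ , _ , refl) = there (there (here refl))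
  piece⁺ (cube a b c) {cu a b c true false false} _ (_ , _ , refl) = there (there (there (here refl)))
  piece⁺ (cube a b c) {cu a b c true false true} _ (_ , _ , refl) = there (there (there (there (here refl))))
  piece⁺ (cube a b c) {cu a b c true true true} _ (_ , _ , refl) = there (there (there (there (there (here refl)))))
  piece⁺ (cube a b c) {cu a b c false true true} _ (_ , _ , refl) = there (there (there (there (there (there (here refl))))))
  piece⁺ (cube a b c) {cu a b c false false true} _ (_ , _ , refl) = there (there (there (there (there (there (there (here refl)))))))
  piece⁺ (cube _ _ _) {ee zero 0 _ _} _ (_ , _ , ())
  piece⁺ (cube _ _ _) {ee zero 1 _ false} _ (_ , _ , ())
  piece⁺ (cube _ _ _) {ee zero 1 _ true} _ (_ , _ , ())
  piece⁺ (cube _ _ _) {ee zero (suc (suc _)) _ _} _ (_ , _ , ())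
  piece⁺ (cube _ _ _) {aa zero 0 _} _ (_ , _ , ())
  piece⁺ (cube _ _ _) {aa zero 1 false} _ (_ , _ , ())
  piece⁺ (cube _ _ _) {aa zero 1 true} _ (_ , _ , ())
  piece⁺ (cube _ _ _) {aa zero (suc (suc _)) _} _ (_ , _ , ())
  piece⁺ five {ee zero 1 false true} _ _ = here refl
  piece⁺ five {aa zero 1 true} _ _ = there (here refl)
  piece⁺ five {ee zero 1 true true} _ _ = there (there (here refl))
  piece⁺ five {dd zero false} _ _ = there (there (there (here refl)))
  piece⁺ five {dd zero true} _ _ = there (there (there (there (here refl))))
  piece⁺ five {ee zero 0 _ _} _ (_ , _ , ())
  piece⁺ five {ee zero 1 _ false} _ (_ , _ , ())
  piece⁺ five {ee zero (suc (suc _)) _ _} _ (_ , _ , ())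
  piece⁺ five {aa zero 0 _} _ (_ , _ , ())
  piece⁺ five {aa zero 1 false} _ (_ , _ , ())
  piece⁺ five {aa zero (suc (suc _)) _} _ (_ , _ , ())

  piece⁺ five {ff zero _} _ (_ , _ , ())
  piece⁺ five {ff (suc _) _} _ (_ , _ , ())
  piece⁺ (cube _ _ _) {dd zero _} _ (_ , _ , ())
  piece⁺ (cube _ _ _) {dd (suc _) _} _ (_ , _ , ())
  piece⁺ (cube _ _ _) {ff zero _} _ (_ , _ , ())
  piece⁺ (cube _ _ _) {ff (suc _) _} _ (_ , _ , ())

  piece-unique : ∀ i → Valid i → Unique (blocks (piece i))
  piece-unique (cube a b c) _ = ((λ ()) ∷ (λ ()) ∷ (λ ()) ∷ (λ ()) ∷ (λ ()) ∷ (λ ()) ∷ (λ ()) ∷ []) ∷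
    ((λ ()) ∷ (λ ()) ∷ (λ ()) ∷ (λ ()) ∷ (λ ()) ∷ (λ ()) ∷ []) ∷ ((λ ()) ∷ (λ ()) ∷ (λ ()) ∷ (λ ()) ∷ (λ ()) ∷ []) ∷
    ((λ ()) ∷ (λ ()) ∷ (λ ()) ∷ (λ ()) ∷ []) ∷ ((λ ()) ∷ (λ ()) ∷ (λ ()) ∷ []) ∷ ((λ ()) ∷ (λ ()) ∷ []) ∷ ((λ ()) ∷ []) ∷ [] ∷ []
  piece-unique (ring j a s) (j<k , 0<a , a<m) = subst Unique (sym (List.map-++ proj₁ (forth a (third (2 * j) a) s) _))
    -- The two segments of a ring are disjoint because their classes differ by one.
    (Unique.++⁺ (forth-unique a _ s) (back-unique a _ s) λ (t∈₁ , t∈₂) →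
      ℕ.1+n≢n (trans (sym (proj₁ (proj₂ (segment-class 0<a a<m (ℕ.≤-trans j<k k≤m) (back⁻ t∈₂)))))
        (proj₁ (proj₂ (segment-class 0<a a<m (ℕ.<-trans (ℕ.n<1+n _) (ℕ.≤-trans j<k k≤m)) (forth⁻ t∈₁))))))
  piece-unique five _ = ((λ ()) ∷ (λ ()) ∷ (λ ()) ∷ (λ ()) ∷ []) ∷ ((λ ()) ∷ (λ ()) ∷ (λ ()) ∷ []) ∷ ((λ ()) ∷ (λ ()) ∷ []) ∷ ((λ ()) ∷ []) ∷ [] ∷ []

-- The remaining triples, and one closed walk through all chosen triples

module LargeOrder (m k : ℕ) {{_ : NonZero m}} (5≤m : 5 ≤ m) (2≤k : 2 ≤ k) (k≤m : k ≤ m) where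

  open Order m k 5≤m 2≤k k≤m public
  open Cubes using (reached; 0<k; 1<m; root-reached)

  valid? : ∀ i → Dec (Valid i)
  valid? (cube a b c) = (a ℕ.<? b) ×-dec ((b ℕ.<? c) ×-dec ((c ℕ.<? m) ×-dec (cls (a + b + c) ℕ.<? k)))
  valid? (ring j a s) = (suc (2 * j) ℕ.<? k) ×-dec ((0 ℕ.<? a) ×-dec (a ℕ.<? m))
  valid? five         = 1 ℕ.<? k

  validTriple? : ∀ t → Dec (ValidTriple m t)
  validTriple? (cu a b c _ _ _) = (a ℕ.<? b) ×-dec ((b ℕ.<? c) ×-dec (c ℕ.<? m))
  validTriple? (ee a b _ _)     = (a ℕ.<? m) ×-dec ((b ℕ.<? m) ×-dec ¬? (a ℕ.≟ b))
  validTriple? (aa a b _)       = (a ℕ.<? m) ×-dec ((b ℕ.<? m) ×-dec ¬? (a ℕ.≟ b))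
  validTriple? (dd a _)         = a ℕ.<? m
  validTriple? (ff a _)         = a ℕ.<? m

  Selected : Triple → Set
  Selected t = ValidTriple m t × class t < k

  selected? : ∀ t → Dec (Selected t)
  selected? t = validTriple? t ×-dec (class t ℕ.<? k)

  NoPiece : Maybe Id → Set
  NoPiece nothing  = ⊤
  NoPiece (just i) = ¬ Valid i

  noPiece? : ∀ i → Dec (NoPiece i)
  noPiece? nothing  = yes _
  noPiece? (just i) = ¬? (valid? i)

  cube-reached : ∀ {i a b c} → a < b → b < c → c < m → a + b + c ≈ i → i < k → CubeReached a b c
  cube-reached {i} h h′ h″ e i<k = reached i (h , h′ , h″ , e , i<k)

  zero-<k : ∀ {j} → ¬ suc (2 * j) < k → 0 < j
  zero-<k {zero}  ¬h = ⊥-elim (¬h 2≤k)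
  zero-<k {suc _} _  = s≤s z≤n

  -- As in `ring-typical`, a triple with double point `a + 1` meets the cube over `a`, `a + 1`, `b`,
  -- which lies in the preceding class. This fails only if `b = a`.
  single-aa : ∀ {a b s} j → suc a < m → b < m → suc a ≢ b → 2 * suc a + b ≈ 2 + 2 * j → 2 + 2 * j < k →
              ∃ λ ℓ → Reached ℓ × aa (suc a) b s ∋ ℓ
  single-aa {a} {b} {s} j a<m b<m ne e i<k with ℕ.<-cmp (suc a) b
  ... | tri≈ _ eq _ = ⊥-elim (ne eq)
  ... | tri< lt _ _ = _ , cube-reached (ℕ.n<1+n a) lt b<m sum≈ (ℕ.<-trans (ℕ.n<1+n _) i<k) (cube-bc {a} {suc a} {b} (twist (suc a) b s)) ,
        subst (aa (suc a) b s ∋_) (pair-< lt) (aa-ab true ne)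
    where
    sum≈ : a + suc a + b ≈ 1 + 2 * j
    sum≈ = lia 4 (λ a b m j → near m (2 :* (lit 1 :+ a) :+ b) (lit 2 :+ j) :⇒
      near m (a :+ (lit 1 :+ a) :+ b) (lit 1 :+ j)) a b m (2 * j) e
  ... | tri> _ _ gt with suc b ℕ.≟ suc a
  ...   | no ne′ = _ , cube-reached {b = a} (s≤s⁻¹ (ℕ.≤∧≢⇒< gt ne′)) (ℕ.n<1+n a) a<m sum≈ (ℕ.<-trans (ℕ.n<1+n _) i<k) (cube-ac {b} {a} {suc a} (twist (suc a) b s) true) ,
          subst (aa (suc a) b s ∋_) (pair-> gt) (aa-ab true ne)
    where
    sum≈ : b + a + suc a ≈ 1 + 2 * j
    sum≈ = lia 4 (λ a b m j → near m (2 :* (lit 1 :+ a) :+ b) (lit 2 :+ j) :⇒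
      near m (b :+ a :+ (lit 1 :+ a)) (lit 1 :+ j)) a b m (2 * j) e
  -- Both labels over 0 and 1 with bit `false` at 1 lie on `fiveWalk`.
  single-aa {zero} {zero} {s} j a<m b<m ne e i<k | tri> _ _ gt | yes refl =
    _ , five-reached (0-1 (twist 1 0 s)) , subst (aa 1 0 s ∋_) (pair-> gt) (aa-ab false ne)
    where
    0-1 : ∀ q → ((0 , q) , (1 , false)) ∈ labels fiveWalk
    0-1 false = here refl
    0-1 true  = there (here refl)
  -- Exchanging the roles of the two residues lowers the class by one, to `2 j + 1`; so the pair is
  -- a label of a ring at the smaller residue, and this ring is valid.
  single-aa {suc a} {suc a} {s} j a<m b<m ne e i<k | tri> _ _ gt | yes refl =
    _ , step (ring j (suc a) true) (ℕ.<-trans (ℕ.n<1+n _) i<k , s≤s z≤n , b<m) (∞-reached false true (s≤s z≤n) b<m) (ring-tail {j})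
          (subst (_∈ labels (ringWalk j (suc a) true)) (trans (pair-< gt) (cong (λ t → (suc a , q) , (suc (suc a) , not t)) (<ᵇ-true gt)))
            (ring-label {j} q b<m a<m (ne ∘ sym) (inj₂ sum≈))) ,
      subst (aa (suc (suc a)) (suc a) s ∋_) (pair-> gt) (aa-ab false ne)
    where
    q = twist (suc (suc a)) (suc a) s
    sum≈ : 2 * suc a + suc (suc a) ≈ 1 + 2 * j
    sum≈ = lia 3 (λ a m j → near m (2 :* (lit 2 :+ a) :+ (lit 1 :+ a)) (lit 2 :+ j) :⇒
      near m (2 :* (lit 1 :+ a) :+ (lit 2 :+ a)) (lit 1 :+ j)) a m (2 * j) e

  single-reached : ∀ t → Selected t → NoPiece (pieceOf t) → ∃ λ ℓ → Reached ℓ × t ∋ ℓ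
  single-reached (cu a b c _ _ _) ((h , h′ , h″) , c<k) np = ⊥-elim (np (h , h′ , h″ , c<k))
  single-reached (ee zero zero p s) ((_ , _ , ne) , _) np = ⊥-elim (ne refl)
  single-reached (ee zero (suc b) p s) ((a<m , b<m , ne) , _) np =
    _ , ∞-reached (twist 0 (suc b) s) (p xor s) (s≤s z≤n) b<m , contains 2nd 3rd (apart (ℕ.<⇒≢ b<m))
  single-reached (ee (suc a) b p s) ((a<m , b<m , ne) , _) np = _ , ∞-reached p (p xor s) (s≤s z≤n) a<m , ee-a∞ a<m
  single-reached (aa zero b s) _ np = _ , five-reached (there (there (there (here refl)))) , aa-aa
  single-reached (aa (suc a) b s) ((a<m , b<m , ne) , c<k) np with halves (class (aa (suc a) b s))
  ... | inj₂ e = ⊥-elim (np (subst (_< k) e c<k , s≤s z≤n , a<m))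
  -- Class 0 is excluded: as `2 ≤ k`, it is paired with class 1 and its ring would be valid.
  ... | inj₁ e = by-half ⌊ class (aa (suc a) b s) /2⌋ e (zero-<k {⌊ class (aa (suc a) b s) /2⌋} λ h → np (h , s≤s z≤n , a<m))
    where
    by-half : ∀ j → class (aa (suc a) b s) ≡ 2 * j → 0 < j → ∃ λ ℓ → Reached ℓ × aa (suc a) b s ∋ ℓ
    by-half (suc j) e _ = single-aa j a<m b<m ne (subst (2 * suc a + b ≈_) e′ (class-≈ {aa (suc a) b s} (a<m , b<m , ne))) (subst (_< k) e′ c<k)
      where
      e′ : class (aa (suc a) b s) ≡ 2 + 2 * j
      e′ = trans e (ℕ.*-suc 2 j)
  single-reached (dd zero e) _ np = ⊥-elim (np 2≤k)
  single-reached (dd (suc a) e) (a<m , _) np = _ , ∞-reached false e (s≤s z≤n) a<m , dd-a∞ false a<m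
  single-reached (ff zero p) _ np = _ , five-reached (ends p) , ff-a∞ (not p) 0<m
    where
    ends : ∀ p → ((0 , p) , (m , not p)) ∈ labels fiveWalk
    ends false = there (there (there (there (here refl))))
    ends true  = there (there (here refl))
  single-reached (ff (suc a) p) (a<m , _) np = _ , ∞-reached p false (s≤s z≤n) a<m , ff-a∞ false a<m

  private
    residues : List ℕ
    residues = upTo m

    bits : List Bool
    bits = false ∷ true ∷ []

    infixl 4 _⊛_
    _⊛_ : ∀ {A B : Set} → List (A → B) → List A → List B
    _⊛_ = cartesianProductWith (λ f x → f x)

    ∈-⊛ : ∀ {A B : Set} {fs : List (A → B)} {xs f x} → f ∈ fs → x ∈ xs → f x ∈ (fs ⊛ xs)
    ∈-⊛ = ∈-cartesianProductWith⁺ (λ f x → f x)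

    ∈-bits : ∀ b → b ∈ bits
    ∈-bits false = here refl
    ∈-bits true  = there (here refl)

    cus ees aas dds ffs : List Triple
    cus = map cu residues ⊛ residues ⊛ residues ⊛ bits ⊛ bits ⊛ bits
    ees = map ee residues ⊛ residues ⊛ bits ⊛ bits
    aas = map aa residues ⊛ residues ⊛ bits
    dds = map dd residues ⊛ bits
    ffs = map ff residues ⊛ bits

    allTriples : List Triple
    allTriples = cus ++ ees ++ aas ++ dds ++ ffs

    ∈-all : ∀ t → ValidTriple m t → t ∈ allTriples
    ∈-all (cu a b c α β γ) (h , h′ , h″) = ∈-++⁺ˡ (∈-⊛ (∈-⊛ (∈-⊛ (∈-⊛ (∈-⊛ (∈-map⁺ cu (∈-upTo⁺ (ℕ.<-trans h (ℕ.<-trans h′ h″))))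
      (∈-upTo⁺ (ℕ.<-trans h′ h″))) (∈-upTo⁺ h″)) (∈-bits α)) (∈-bits β)) (∈-bits γ))
    ∈-all (ee a b p s) (h , h′ , _) = ∈-++⁺ʳ cus (∈-++⁺ˡ
      (∈-⊛ (∈-⊛ (∈-⊛ (∈-map⁺ ee (∈-upTo⁺ h)) (∈-upTo⁺ h′)) (∈-bits p)) (∈-bits s)))
    ∈-all (aa a b s) (h , h′ , _) = ∈-++⁺ʳ cus (∈-++⁺ʳ ees (∈-++⁺ˡ (∈-⊛ (∈-⊛ (∈-map⁺ aa (∈-upTo⁺ h)) (∈-upTo⁺ h′)) (∈-bits s))))
    ∈-all (dd a e) h = ∈-++⁺ʳ cus (∈-++⁺ʳ ees (∈-++⁺ʳ aas (∈-++⁺ˡ (∈-⊛ (∈-map⁺ dd (∈-upTo⁺ h)) (∈-bits e)))))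
    ∈-all (ff a p) h = ∈-++⁺ʳ cus (∈-++⁺ʳ ees (∈-++⁺ʳ aas (∈-++⁺ʳ dds (∈-⊛ (∈-map⁺ ff (∈-upTo⁺ h)) (∈-bits p)))))

    selected : List Triple
    selected = deduplicate _≟ᵀ_ (filter selected? allTriples)

    ∈-selected⁺ : ∀ {t} → Selected t → t ∈ selected
    ∈-selected⁺ {t} s = ∈-deduplicate⁺ _≟ᵀ_ (∈-filter⁺ selected? (∈-all t (proj₁ s)) s)

    ∈-selected⁻ : ∀ {t} → t ∈ selected → Selected t
    ∈-selected⁻ t∈ = proj₂ (∈-filter⁻ selected? {xs = allTriples} (∈-deduplicate⁻ _≟ᵀ_ (filter selected? allTriples) t∈))

    single? : ∀ t → Dec (NoPiece (pieceOf t))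
    single? t = noPiece? (pieceOf t)

    singles : List Triple
    singles = filter single? selected

    pieces : List Id
    pieces = filter valid? (mapMaybe pieceOf selected)

    ∈-pieces : ∀ {t i} → t ∈ selected → pieceOf t ≡ just i → Valid i → i ∈ pieces
    ∈-pieces t∈ e v = ∈-filter⁺ valid? (Any.mapMaybe⁺ pieceOf selected (Any.map⁺ (lose t∈ (subst (λ x → MAny.Any (_ ≡_) x) (sym e) (MAny.just refl))))) v
      where import Data.Maybe.Relation.Unary.Any as MAny

    pieces-valid : All Valid pieces
    pieces-valid = All.all-filter valid? (mapMaybe pieceOf selected)

    union-unique : ∀ {is} → Unique is → All Valid is → Unique (concatMap (blocks ∘ piece) is)
    union-unique [] [] = []
    union-unique {i ∷ is} (i∉ ∷ u) (v ∷ vs) = Unique.++⁺ (piece-unique i v) (union-unique u vs) λ (t∈ , t∈′) → disjoint t∈ t∈′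
      where
      disjoint : ∀ {t} → t ∈ blocks (piece i) → t ∈ concatMap (blocks ∘ piece) is → ⊥
      disjoint t∈ t∈′ with j , j∈ , t∈j ← find (∈-concatMap⁻ (blocks ∘ piece) t∈′)
        with _ , _ , e ← piece⁻ i v t∈ | _ , _ , e′ ← piece⁻ j (All.lookup vs j∈) t∈j
        = All.lookup i∉ j∈ (just-injective (trans (sym e) e′))
        where open import Data.Maybe.Properties using (just-injective)

  closed-order : ∃₂ λ ℓ w → Path ℓ w ℓ × Unique (blocks w) × (∀ {t} → t ∈ blocks w → Selected t) × (∀ {t} → Selected t → t ∈ blocks w)
  closed-order with js , w , u , vs , sub , p , perm ←
      closedWalk pieces pieces-valid (All.map (λ {i} → attached i) pieces-valid) singles
        (λ {b} b∈ → let b∈s , np = ∈-filter⁻ single? {xs = selected} b∈ in single-reached b (∈-selected⁻ b∈s) np) =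
    _ , w , p , ↭-unique (↭-sym perm) unique , (λ t∈ → sound (∈-++⁻ singles (↭.∈-resp-↭ perm t∈))) , λ s → ↭.∈-resp-↭ (↭-sym perm) (complete s)
    where
    open import Data.List.Relation.Unary.Unique.DecPropositional.Properties _≟ᵀ_ using (deduplicate-!)
    rest = concatMap (blocks ∘ piece) js
    in-piece : ∀ {t} → t ∈ rest → ∃ λ i → Valid i × Belongs t i
    in-piece t∈ with i , i∈ , t∈i ← find (∈-concatMap⁻ (blocks ∘ piece) t∈) = i , All.lookup vs i∈ , piece⁻ i (All.lookup vs i∈) t∈i
    sound : ∀ {t} → t ∈ singles ⊎ t ∈ rest → Selected t
    sound (inj₁ t∈) = ∈-selected⁻ (proj₁ (∈-filter⁻ single? {xs = selected} t∈))
    sound (inj₂ t∈) with _ , _ , v , c , _ ← in-piece t∈ = v , c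
    unique : Unique (singles ++ rest)
    unique = Unique.++⁺ (Unique.filter⁺ single? (deduplicate-! (filter selected? allTriples))) (union-unique u vs) λ (t∈ , t∈′) → disjoint t∈ (in-piece t∈′)
      where
      disjoint : ∀ {t} → t ∈ singles → (∃ λ i → Valid i × Belongs t i) → ⊥
      disjoint t∈ (i , v , _ , _ , e) = subst NoPiece e (proj₂ (∈-filter⁻ single? {xs = selected} t∈)) v
    complete : ∀ {t} → Selected t → t ∈ singles ++ rest
    complete {t} s@(v , c<k) = by-piece (pieceOf t) refl
      where
      by-piece : ∀ x → pieceOf t ≡ x → t ∈ singles ++ rest
      by-piece nothing e = ∈-++⁺ˡ (∈-filter⁺ single? (∈-selected⁺ s) (subst NoPiece (sym e) _))
      by-piece (just i) e with valid? i
      ... | yes vi = ∈-++⁺ʳ singles (∈-concatMap⁺ (blocks ∘ piece) (lose (sub (∈-pieces (∈-selected⁺ s) e vi)) (piece⁺ i vi (v , c<k , e))))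
      ... | no ¬vi = ∈-++⁺ˡ (∈-filter⁺ single? (∈-selected⁺ s) (subst NoPiece (sym e) ¬vi))

-- Triples as blocks

bit : Bool → ℕ
bit false = 0
bit true  = 1

-- Interleaving the two copies makes the order by residue an order by number and puts the points at
-- infinity last, at `2 m` and `2 m + 1`.
num : Point → ℕ
num (a , p) = 2 * a + bit p

odd : ℕ → Bool
odd zero          = false
odd (suc zero)    = true
odd (suc (suc n)) = odd n

pt : ℕ → Point
pt n = ⌊ n /2⌋ , odd n

pt-num : ∀ x → pt (num x) ≡ x
pt-num (a , p) = cong₂ _,_ (base a p) (parity a p)
  where
  shift : ∀ a p → 2 * suc a + bit p ≡ suc (suc (2 * a + bit p))
  shift a p = lia 2 (λ a p → 2 :* (lit 1 :+ a) :+ p :≡ lit 2 :+ (2 :* a :+ p)) a (bit p)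
  base : ∀ a p → ⌊ 2 * a + bit p /2⌋ ≡ a
  base zero    false = refl
  base zero    true  = refl
  base (suc a) p rewrite shift a p = cong suc (base a p)
  parity : ∀ a p → odd (2 * a + bit p) ≡ p
  parity zero    false = refl
  parity zero    true  = refl
  parity (suc a) p rewrite shift a p = parity a p

num-pt : ∀ n → num (pt n) ≡ n
num-pt zero          = refl
num-pt (suc zero)    = refl
num-pt (suc (suc n)) = trans (lia 2 (λ a p → 2 :* (lit 1 :+ a) :+ p :≡ lit 2 :+ (2 :* a :+ p)) ⌊ n /2⌋ (bit (odd n))) (cong (2 +_) (num-pt n))

num-base : ∀ {a b p q} → a < b → num (a , p) < num (b , q)
num-base {a} {b} {false} {q} h = lia 3 (λ a b q → a :< b :⇒ 2 :* a :+ lit 0 :< 2 :* b :+ q) a b (bit q) h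
num-base {a} {b} {true}  {q} h = lia 3 (λ a b q → a :< b :⇒ 2 :* a :+ lit 1 :< 2 :* b :+ q) a b (bit q) h

num-bit : ∀ {a} → num (a , false) < num (a , true)
num-bit {a} = lia 1 (λ a → 2 :* a :+ lit 0 :< 2 :* a :+ lit 1) a

num-order : ∀ {a b p q} → num (a , p) < num (b , q) → a < b ⊎ (a ≡ b × p ≡ false × q ≡ true)
num-order {a} {b} {p} {q} h with ℕ.<-cmp a b
... | tri< lt _ _ = inj₁ lt
... | tri> _ _ gt = ⊥-elim (ℕ.<-asym h (num-base {b} {a} {q} {p} gt))
num-order {a} {a} {false} {true}  h | tri≈ _ refl _ = inj₂ (refl , refl , refl)
num-order {a} {a} {false} {false} h | tri≈ _ refl _ = ⊥-elim (ℕ.n≮n _ h)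
num-order {a} {a} {true}  {true}  h | tri≈ _ refl _ = ⊥-elim (ℕ.n≮n _ h)
num-order {a} {a} {true}  {false} h | tri≈ _ refl _ = ⊥-elim (ℕ.<-asym h (num-bit {a}))

-- Junk unless x < y < z < v.
build : ∀ {v} → Block v → ℕ → ℕ → ℕ → Block v
build {v} junk x y z with x ℕ.<? y | y ℕ.<? z | z ℕ.<? v
... | yes p | yes q | yes r = block (fromℕ< (ℕ.<-trans p (ℕ.<-trans q r))) (fromℕ< (ℕ.<-trans q r)) (fromℕ< r)
        (subst₂ _<_ (sym (Fin.toℕ-fromℕ< _)) (sym (Fin.toℕ-fromℕ< _)) p) (subst₂ _<_ (sym (Fin.toℕ-fromℕ< _)) (sym (Fin.toℕ-fromℕ< _)) q)
... | _ | _ | _ = junk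

build-points : ∀ {v} (junk : Block v) {x y z} → x < y → y < z → z < v →
               let B = build junk x y z in toℕ (Block.a B) ≡ x × toℕ (Block.b B) ≡ y × toℕ (Block.c B) ≡ z
build-points {v} junk {x} {y} {z} p q r with x ℕ.<? y | y ℕ.<? z | z ℕ.<? v
... | yes _ | yes _ | yes _ = Fin.toℕ-fromℕ< _ , Fin.toℕ-fromℕ< _ , Fin.toℕ-fromℕ< _
... | no ¬p | _     | _     = ⊥-elim (¬p p)
... | yes _ | no ¬q | _     = ⊥-elim (¬q q)
... | yes _ | yes _ | no ¬r = ⊥-elim (¬r r)

twist-twist : ∀ a b q → twist a b (twist a b q) ≡ q
twist-twist a b q with a <ᵇ b
twist-twist a b false | false = refl
twist-twist a b true  | false = refl
twist-twist a b false | true = refl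
twist-twist a b true  | true = refl

module Realisation (m v : ℕ) (v≡ : v ≡ 2 * m + 2) (junk : Block v) where

  open Incidence m using (pts; _∋_; contains)

  sorted : Triple → Point × Point × Point
  sorted (cu a b c α β γ) = (a , α) , (b , β) , (c , γ)
  sorted (ee a b p s)     = if a <ᵇ b then ((a , p) , (b , twist a b s) , (m , p xor s)) else ((b , twist a b s) , (a , p) , (m , p xor s))
  sorted (aa a b s)       = if a <ᵇ b then ((a , false) , (a , true) , (b , twist a b s)) else ((b , twist a b s) , (a , false) , (a , true))
  sorted (dd a e)         = (a , false) , (a , true) , (m , e)
  sorted (ff a p)         = (a , p) , (m , false) , (m , true)

  real : Triple → Block v
  real t = let x , y , z = sorted t in build junk (num x) (num y) (num z)

  Sorted : Point × Point × Point → Set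
  Sorted (x , y , z) = num x < num y × num y < num z × proj₁ z ≤ m

  toList : Point × Point × Point → List Point
  toList (x , y , z) = x ∷ y ∷ z ∷ []

  <ᵇ-cases : ∀ {a b} → a ≢ b → (a < b × (a <ᵇ b) ≡ true) ⊎ (b < a × (a <ᵇ b) ≡ false)
  <ᵇ-cases {a} {b} ne with ℕ.<-cmp a b
  ... | tri< lt _ _ = inj₁ (lt , <ᵇ-true lt)
  ... | tri≈ _ e _  = ⊥-elim (ne e)
  ... | tri> _ _ gt = inj₂ (gt , <ᵇ-false (ℕ.<⇒≤ gt))

  sorted-spec : ∀ t → ValidTriple m t → Sorted (sorted t) × pts t ⊆ toList (sorted t)
  sorted-spec (cu a b c α β γ) (h , h′ , h″) = (num-base {p = α} h , num-base {p = β} h′ , ℕ.<⇒≤ h″) , id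
  sorted-spec (ee a b p s) (a<m , b<m , ne) with <ᵇ-cases ne
  ... | inj₁ (lt , e) rewrite e = (num-base {p = p} lt , num-base {p = s xor true} b<m , ℕ.≤-refl) , id
  ... | inj₂ (gt , e) rewrite e = (num-base {p = s xor false} gt , num-base {p = p} a<m , ℕ.≤-refl) ,
    λ { (here refl) → there (here refl) ; (there (here refl)) → here refl ; (there (there (here refl))) → there (there (here refl)) }
  sorted-spec (aa a b s) (a<m , b<m , ne) with <ᵇ-cases ne
  ... | inj₁ (lt , e) rewrite e = (num-bit {a} , num-base {p = true} lt , ℕ.<⇒≤ b<m) , id
  ... | inj₂ (gt , e) rewrite e = (num-base {p = s xor false} gt , num-bit {a} , ℕ.<⇒≤ a<m) ,
    λ { (here refl) → there (here refl) ; (there (here refl)) → there (there (here refl)) ; (there (there (here refl))) → here refl }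
  sorted-spec (dd a e) h = (num-bit {a} , num-base {p = true} h , ℕ.≤-refl) , id
  sorted-spec (ff a p) h = (num-base {p = p} h , num-bit {m} , ℕ.≤-refl) , id

  num-< : ∀ x → proj₁ x ≤ m → num x < v
  num-< (a , false) h = lia 3 (λ a m v → v :≡ 2 :* m :+ lit 2 :⇒ a :≤ m :⇒ 2 :* a :+ lit 0 :< v) a m v v≡ h
  num-< (a , true)  h = lia 3 (λ a m v → v :≡ 2 :* m :+ lit 2 :⇒ a :≤ m :⇒ 2 :* a :+ lit 1 :< v) a m v v≡ h

  real-points : ∀ t → ValidTriple m t → let x , y , z = sorted t ; B = real t in
                toℕ (Block.a B) ≡ num x × toℕ (Block.b B) ≡ num y × toℕ (Block.c B) ≡ num z
  real-points t vt with (h , h′ , h″) , _ ← sorted-spec t vt = build-points junk h h′ (num-< _ h″)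

  real-∈ : ∀ {t x} → ValidTriple m t → x ∈ pts t → ∀ {X : Fin v} → toℕ X ≡ num x → X ∈B real t
  real-∈ {t} vt x∈ e with proj₂ (sorted-spec t vt) x∈ | real-points t vt
  ... | here refl                 | e₁ , _ , _ = inj₁ (Fin.toℕ-injective (trans e (sym e₁)))
  ... | there (here refl)         | _ , e₂ , _ = inj₂ (inj₁ (Fin.toℕ-injective (trans e (sym e₂))))
  ... | there (there (here refl)) | _ , _ , e₃ = inj₂ (inj₂ (Fin.toℕ-injective (trans e (sym e₃))))

  -- The kind of a triple shows in which residues of the sorted points coincide or equal `m`. As a
  -- left inverse of `sorted` it makes `real` injective on valid triples.
  recover : Point × Point × Point → Triple
  recover ((a , p) , (b , q) , (c , r)) with b ℕ.≟ m | a ℕ.≟ b | c ℕ.≟ m | b ℕ.≟ c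
  ... | yes _ | _     | _     | _     = ff a p
  ... | no _  | yes _ | yes _ | _     = dd a r
  ... | no _  | yes _ | no _  | _     = aa a c (not r)
  ... | no _  | no _  | no _  | yes _ = aa b a p
  ... | no _  | no _  | no _  | no _  = cu a b c p q r
  -- Because of `twist`, the parity of the three bits tells which of the two finite residues is the
  -- double one.
  ... | no _  | no _  | yes _ | _     = if r xor (p xor q) then ee a b p (not q) else ee b a q p

  recover-sorted : ∀ t → ValidTriple m t → recover (sorted t) ≡ t
  recover-sorted (cu a b c α β γ) (h , h′ , h″) with b ℕ.≟ m | a ℕ.≟ b | c ℕ.≟ m | b ℕ.≟ c
  ... | yes refl | _        | _        | _        = ⊥-elim (ℕ.<-asym h′ h″)
  ... | no _     | yes refl | _        | _        = ⊥-elim (ℕ.n≮n _ h)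
  ... | no _     | no _     | yes refl | _        = ⊥-elim (ℕ.n≮n _ h″)
  ... | no _     | no _     | no _     | yes refl = ⊥-elim (ℕ.n≮n _ h′)
  ... | no _     | no _     | no _     | no _     = refl
  recover-sorted (ee a b p s) (a<m , b<m , ne) with <ᵇ-cases ne
  recover-sorted (ee a b p s) (a<m , b<m , ne) | inj₁ (lt , e) rewrite e with b ℕ.≟ m | a ℕ.≟ b | m ℕ.≟ m
  ... | yes refl | _        | _    = ⊥-elim (ℕ.n≮n _ b<m)
  ... | no _     | yes refl | _    = ⊥-elim (ℕ.n≮n _ lt)
  ... | no _     | no _     | no n = ⊥-elim (n refl)
  recover-sorted (ee a b false false) _ | inj₁ _ | no _ | no _ | yes _ = refl
  recover-sorted (ee a b false true)  _ | inj₁ _ | no _ | no _ | yes _ = refl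
  recover-sorted (ee a b true false)  _ | inj₁ _ | no _ | no _ | yes _ = refl
  recover-sorted (ee a b true true)   _ | inj₁ _ | no _ | no _ | yes _ = refl
  recover-sorted (ee a b p s) (a<m , b<m , ne) | inj₂ (gt , e) rewrite e with a ℕ.≟ m | b ℕ.≟ a | m ℕ.≟ m
  ... | yes refl | _        | _    = ⊥-elim (ℕ.n≮n _ a<m)
  ... | no _     | yes refl | _    = ⊥-elim (ℕ.n≮n _ gt)
  ... | no _     | no _     | no n = ⊥-elim (n refl)
  recover-sorted (ee a b false false) _ | inj₂ _ | no _ | no _ | yes _ = refl
  recover-sorted (ee a b false true)  _ | inj₂ _ | no _ | no _ | yes _ = refl
  recover-sorted (ee a b true false)  _ | inj₂ _ | no _ | no _ | yes _ = refl
  recover-sorted (ee a b true true)   _ | inj₂ _ | no _ | no _ | yes _ = refl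
  recover-sorted (aa a b s) (a<m , b<m , ne) with <ᵇ-cases ne
  recover-sorted (aa a b s) (a<m , b<m , ne) | inj₁ (lt , e) rewrite e with a ℕ.≟ m | a ℕ.≟ a | b ℕ.≟ m | a ℕ.≟ b
  ... | yes refl | _     | _        | _ = ⊥-elim (ℕ.n≮n _ a<m)
  ... | no _     | no n  | _        | _ = ⊥-elim (n refl)
  ... | no _     | yes _ | yes refl | _ = ⊥-elim (ℕ.n≮n _ b<m)
  recover-sorted (aa a b false) _ | inj₁ _ | no _ | yes _ | no _ | _ = refl
  recover-sorted (aa a b true)  _ | inj₁ _ | no _ | yes _ | no _ | _ = refl
  recover-sorted (aa a b s) (a<m , b<m , ne) | inj₂ (gt , e) rewrite e with a ℕ.≟ m | b ℕ.≟ a | a ℕ.≟ a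
  ... | yes refl | _        | _     = ⊥-elim (ℕ.n≮n _ a<m)
  ... | no _     | yes refl | _     = ⊥-elim (ℕ.n≮n _ gt)
  ... | no _     | no _     | no n  = ⊥-elim (n refl)
  recover-sorted (aa a b false) _ | inj₂ _ | no _ | no _ | yes _ = refl
  recover-sorted (aa a b true)  _ | inj₂ _ | no _ | no _ | yes _ = refl
  recover-sorted (dd a e) h with a ℕ.≟ m | a ℕ.≟ a | m ℕ.≟ m
  ... | yes refl | _     | _    = ⊥-elim (ℕ.n≮n _ h)
  ... | no _     | no n  | _    = ⊥-elim (n refl)
  ... | no _     | yes _ | no n = ⊥-elim (n refl)
  ... | no _     | yes _ | yes _ = refl
  recover-sorted (ff a p) h with m ℕ.≟ m
  ... | yes _ = refl
  ... | no n  = ⊥-elim (n refl)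

  real-injective : ∀ {t u} → ValidTriple m t → ValidTriple m u → real t ≡ real u → t ≡ u
  real-injective {t} {u} vt vu e with real-points t vt | real-points u vu
  ... | e₁ , e₂ , e₃ | f₁ , f₂ , f₃ = trans (sym (recover-sorted t vt)) (trans (cong recover same) (recover-sorted u vu))
    where
    point : ∀ {x y X Y} → toℕ {v} X ≡ num x → toℕ {v} Y ≡ num y → X ≡ Y → x ≡ y
    point {x} {y} p q refl = trans (sym (pt-num x)) (trans (cong pt (trans (sym p) q)) (pt-num y))
    same : sorted t ≡ sorted u
    same = cong₂ _,_ (point e₁ f₁ (cong Block.a e)) (cong₂ _,_ (point e₂ f₂ (cong Block.b e)) (point e₃ f₃ (cong Block.c e)))

  pts-base : ∀ {t x} → ValidTriple m t → x ∈ pts t → num x < v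
  pts-base {t} vt x∈ with (h , h′ , h″) , sub ← sorted-spec t vt with sub x∈
  ... | here refl = ℕ.<-trans h (ℕ.<-trans h′ (num-< _ h″))
  ... | there (here refl) = ℕ.<-trans h′ (num-< _ h″)
  ... | there (there (here refl)) = num-< _ h″

  adjacent : ∀ {s t ℓ} → ValidTriple m s × s ∋ ℓ → ValidTriple m t × t ∋ ℓ → real s ≢ real t → Adjacent2 (real s) (real t)
  adjacent {s} {t} {x , y} (vs , contains xs ys ne) (vt , contains xt yt _) = share-pair {x = X} {y = Y} X≢Y
      (real-∈ vs xs eX) (real-∈ vs ys eY) (real-∈ vt xt eX) (real-∈ vt yt eY)
    where
    X = fromℕ< (pts-base {s} vs xs)
    Y = fromℕ< (pts-base {s} vs ys)
    eX : toℕ X ≡ num x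
    eX = Fin.toℕ-fromℕ< _
    eY : toℕ Y ≡ num y
    eY = Fin.toℕ-fromℕ< _
    X≢Y : X ≢ Y
    X≢Y e = ne (trans (sym (pt-num x)) (trans (cong pt (trans (sym eX) (trans (cong toℕ e) eY))) (pt-num y)))

-- The case λ ≥ 4: two triples of each class on each pair

module Large (m k v : ℕ) {{_ : NonZero m}} (5≤m : 5 ≤ m) (2≤k : 2 ≤ k) (k≤m : k ≤ m) (v≡ : v ≡ 2 * m + 2) (junk : Block v)
             (halve : ∀ {i a} → i < m → a < m → ∃ λ c → c < m × Classes._≈_ m (2 * c + a) i)
             (divide₃ : ∀ {i} → i < m → ∃ λ a → a < m × Classes._≈_ m (3 * a) i) where

  open LargeOrder m k 5≤m 2≤k k≤m
  open Realisation m v v≡ junk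

  Through : Point → Point → ℕ → Triple → Set
  Through x y i t = ValidTriple m t × weight t ≈ i × x ∈ pts t × y ∈ pts t

  Two : Point → Point → ℕ → Set
  Two x y i = ∃₂ λ t u → t ≢ u × Through x y i t × Through x y i u

  twice+ : ∀ {a b i} → a + b + a ≈ i → 2 * a + b ≈ i
  twice+ {a} {b} {i} = subst (_≈ i) (lia 2 (λ a b → a :+ b :+ a :≡ 2 :* a :+ b) a b)

  a-∈ : ∀ {a : ℕ} {p x} → (a , p) ∈ ((a , false) ∷ (a , true) ∷ x ∷ [])
  a-∈ {p = false} = 1st
  a-∈ {p = true}  = 2nd

  ∞-∈ : ∀ {x : Point} {p} → (m , p) ∈ (x ∷ (m , false) ∷ (m , true) ∷ [])
  ∞-∈ {p = false} = 2nd
  ∞-∈ {p = true}  = 3rd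

  xor-xor : ∀ p q → p xor (p xor q) ≡ q
  xor-xor false q = refl
  xor-xor true false = refl
  xor-xor true true = refl

  xor-xorʳ : ∀ q s → (q xor s) xor s ≡ q
  xor-xorʳ false false = refl
  xor-xorʳ false true  = refl
  xor-xorʳ true  false = refl
  xor-xorʳ true  true  = refl

  -- The class determines the third residue `c`. If it is new, its bit is free, which gives two
  -- triples; if it repeats `a` or `b`, one triple of kind `aa` and one of kind `ee` take their
  -- place.
  two-finite : ∀ {a b p q i} → a < b → b < m → i < m → Two (a , p) (b , q) i
  two-finite {a} {b} {p} {q} {i} a<b b<m i<m
    with c<m , e ← complement-spec {a + b} {i} (lia 3 (λ a b m → a :< b :⇒ b :< m :⇒ a :+ b :≤ 2 :* m) a b m a<b b<m) i<m
    = cases (complement (a + b) i) c<m e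
    where
    a<m = ℕ.<-trans a<b b<m
    a≢b = ℕ.<⇒≢ a<b
    cases : ∀ c → c < m → a + b + c ≈ i → Two (a , p) (b , q) i
    cases c c<m e with ℕ.<-cmp c a | ℕ.<-cmp c b
    ... | tri< lt _ _ | _ = cu c a b false p q , cu c a b true p q , (λ ()) ,
          ((lt , a<b , b<m) , e′ , 2nd , 3rd) , ((lt , a<b , b<m) , e′ , 2nd , 3rd)
      where e′ = subst (_≈ i) (lia 3 (λ a b c → a :+ b :+ c :≡ c :+ a :+ b) a b c) e
    ... | tri≈ _ refl _ | _ = aa a b (twist a b q) , ee a b p (twist a b q) , (λ ()) ,
          ((a<m , b<m , a≢b) , twice+ {a} {b} e , a-∈ , there (there (here (cong (b ,_) (sym (twist-twist a b q)))))) ,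
          ((a<m , b<m , a≢b) , twice+ {a} {b} e , 1st , there (here (cong (b ,_) (sym (twist-twist a b q)))))
    ... | tri> _ _ gt | tri< lt _ _ = cu a c b p false q , cu a c b p true q , (λ ()) ,
          ((gt , lt , b<m) , e′ , 1st , 3rd) , ((gt , lt , b<m) , e′ , 1st , 3rd)
      where e′ = subst (_≈ i) (lia 3 (λ a b c → a :+ b :+ c :≡ a :+ c :+ b) a b c) e
    ... | tri> _ _ _ | tri≈ _ refl _ = aa b a (twist b a p) , ee b a q (twist b a p) , (λ ()) ,
          ((b<m , a<m , a≢b ∘ sym) , twice+ {b} {a} e′ , there (there (here (cong (a ,_) (sym (twist-twist b a p))))) , a-∈) ,
          ((b<m , a<m , a≢b ∘ sym) , twice+ {b} {a} e′ , there (here (cong (a ,_) (sym (twist-twist b a p)))) , 1st)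
      where e′ = subst (_≈ i) (lia 2 (λ a b → a :+ b :+ b :≡ b :+ a :+ b) a b) e
    ... | tri> _ _ _ | tri> _ _ gt = cu a b c p q false , cu a b c p q true , (λ ()) ,
          ((a<b , gt , c<m) , e , 1st , 2nd) , ((a<b , gt , c<m) , e , 1st , 2nd)

  thrice : ∀ {a i} → 2 * a + a ≈ i → 3 * a ≈ i
  thrice {a} {i} = subst (_≈ i) (lia 1 (λ a → 2 :* a :+ a :≡ 3 :* a) a)

  two-vertical : ∀ {a i} → a < m → i < m → Two (a , false) (a , true) i
  two-vertical {a} {i} a<m i<m with c<m , e ← third-spec {i} {a} i<m a<m = cases (third i a) c<m e
    where
    cases : ∀ c → c < m → 2 * a + c ≈ i → Two (a , false) (a , true) i
    cases c c<m e with a ℕ.≟ c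
    ... | no ne = aa a c false , aa a c true , (λ ()) , ((a<m , c<m , ne) , e , 1st , 2nd) , ((a<m , c<m , ne) , e , 1st , 2nd)
    ... | yes refl = dd a false , dd a true , (λ ()) , (a<m , thrice {a} e , 1st , 2nd) , (a<m , thrice {a} e , 1st , 2nd)

  ee-source : ∀ {a b p s a′ b′ p′ s′} → ee a b p s ≡ ee a′ b′ p′ s′ → a ≡ a′
  ee-source refl = refl

  -- The residue `a` is the double point of one triple, with `2 a + c = i`, and the third residue of
  -- the other, with `2 d + a = i`. Both equations degenerate together, namely when `3 a = i`, and
  -- then `dd` and `ff` supply the two triples.
  two-mixed : ∀ {a p q i} → a < m → i < m → Two (a , p) (m , q) i
  two-mixed {a} {p} {q} {i} a<m i<m with c<m , e ← third-spec {i} {a} i<m a<m | d , d<m , e′ ← halve {i} {a} i<m a<m = cases (third i a) c<m e d<m e′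
    where
    cases : ∀ c {d} → c < m → 2 * a + c ≈ i → d < m → 2 * d + a ≈ i → Two (a , p) (m , q) i
    cases c {d} c<m e d<m e′ with a ℕ.≟ c
    ... | yes refl = dd a q , ff a p , (λ ()) , (a<m , thrice {a} e , a-∈ , 3rd) , (a<m , thrice {a} e , 1st , ∞-∈)
    -- The parameters are forced: `p xor s` must be `q` in the first triple; in the second, `s` must
    -- twist to the bit `p` at `a`, and the bit at `d` must give `q` after adding `s`.
    ... | no ne = ee a c p (p xor q) , ee d a (q xor s) s , (λ e → ne′ (sym (ee-source e))) ,
        ((a<m , c<m , ne) , e , 1st , there (there (here (cong (m ,_) (sym (xor-xor p q)))))) ,
        ((d<m , a<m , ne′) , e′ , there (here (cong (a ,_) (sym (twist-twist d a p)))) , there (there (here (cong (m ,_) (sym (xor-xorʳ q s))))))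
      where
      s = twist d a p
      ne′ : d ≢ a
      ne′ refl = ne (complement-unique {2 * a} a<m c<m e′ e)

  two-infinite : ∀ {i} → i < m → Two (m , false) (m , true) i
  two-infinite i<m with a , a<m , e ← divide₃ i<m = ff a false , ff a true , (λ ()) , (a<m , e , 2nd , 3rd) , (a<m , e , 2nd , 3rd)

  two : ∀ {x y i} → num x < num y → proj₁ y ≤ m → i < m → Two x y i
  two {a , p} {b , q} h b≤m i<m with num-order {a} {b} {p} {q} h | ℕ.m≤n⇒m<n∨m≡n b≤m
  ... | inj₁ a<b                  | inj₁ b<m  = two-finite a<b b<m i<m
  ... | inj₁ a<m                  | inj₂ refl = two-mixed a<m i<m
  ... | inj₂ (refl , refl , refl) | inj₁ b<m  = two-vertical b<m i<m
  ... | inj₂ (refl , refl , refl) | inj₂ refl = two-infinite i<m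

  Chosen : Point → Point → List ℕ → Triple → Set
  Chosen x y is t = ValidTriple m t × class t ∈ is × x ∈ pts t × y ∈ pts t

  choose : ∀ {x y} → num x < num y → proj₁ y ≤ m → ∀ is → Unique is → All (_< m) is →
           ∃ λ ts → length ts ≡ 2 * length is × Unique ts × All (Chosen x y is) ts
  choose h b≤m [] [] [] = [] , refl , [] , []
  choose {x} {y} h b≤m (i ∷ is) (i∉ ∷ u) (i<m ∷ is<m)
    with t , w , ne , (vt , et , xt , yt) , (vw , ew , xw , yw) ← two h b≤m i<m | ts , len , ut , all ← choose h b≤m is u is<m =
    t ∷ w ∷ ts , trans (cong (2 +_) len) (sym (ℕ.*-suc 2 (length is))) ,
    (ne ∷ All.map (fresh (≈-cls et)) all) ∷ All.map (fresh (≈-cls ew)) all ∷ ut ,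
    (vt , here (≈-cls et) , xt , yt) ∷ (vw , here (≈-cls ew) , xw , yw) ∷ All.map (λ (v , c∈ , ps) → v , there c∈ , ps) all
    where
    fresh : ∀ {t w} → class t ≡ i → Chosen x y is w → t ≢ w
    fresh e (_ , c∈ , _) refl = All.lookup i∉ c∈ (sym e)

  module _ {ℓ w} (w-path : Path ℓ w ℓ) (w-unique : Unique (blocks w))
           (sound : ∀ {t} → t ∈ blocks w → Selected t) (complete : ∀ {t} → Selected t → t ∈ blocks w) where

    Bs : List (Block v)
    Bs = map real (blocks w)

    Bs-unique : Unique Bs
    Bs-unique = unique-map (λ t∈ u∈ → real-injective (proj₁ (sound t∈)) (proj₁ (sound u∈))) w-unique

    low high : List ℕ
    low  = upTo k
    high = map (k +_) (upTo (m ∸ k))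

    length-upTo : ∀ n → length (upTo n) ≡ n
    length-upTo n = List.length-applyUpTo id n

    pair-count : ∀ {X Y : Fin v} → toℕ X < toℕ Y → pairCount Bs X Y ≡ 2 * k
    pair-count {X} {Y} X<Y = count
        (choose {x} {y} h y≤m low (Unique.upTo⁺ k) (All.tabulate λ i∈ → ℕ.<-≤-trans (∈-upTo⁻ i∈) k≤m))
        (choose {x} {y} h y≤m high (Unique.map⁺ (ℕ.+-cancelˡ-≡ k _ _) (Unique.upTo⁺ (m ∸ k)))
          (All.map⁺ (All.tabulate λ i∈ → subst (_ <_) (ℕ.m+[n∸m]≡n k≤m) (ℕ.+-monoʳ-< k (∈-upTo⁻ i∈)))))
      where
      x = pt (toℕ X)
      y = pt (toℕ Y)
      eX : toℕ X ≡ num x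
      eX = sym (num-pt (toℕ X))
      eY : toℕ Y ≡ num y
      eY = sym (num-pt (toℕ Y))
      h : num x < num y
      h = subst₂ _<_ eX eY X<Y
      y≤m : proj₁ y ≤ m
      y≤m = lia 5 (λ Y b p m v → Y :≡ 2 :* b :+ p :⇒ Y :< v :⇒ v :≡ 2 :* m :+ lit 2 :⇒ b :≤ m) (toℕ Y) (proj₁ y) (bit (proj₂ y)) m v eY (Fin.toℕ<n Y) v≡
      disjoint : ∀ us → All (Chosen x y high) us → ∀ {B} → B ∈ Bs → B ∈ map real us → ⊥
      disjoint us cus B∈ B∈′ with t , t∈ , e ← ∈-map⁻ real B∈ | u , u∈ , e′ ← ∈-map⁻ real B∈′
        with vu , c∈ , _ ← All.lookup cus u∈ with refl ← real-injective (proj₁ (sound t∈)) vu (trans (sym e) e′)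
        with j , _ , eq ← ∈-map⁻ (k +_) c∈ = ℕ.m+n≮m k j (subst (_< k) eq (proj₂ (sound t∈)))

      count : (∃ λ ts → length ts ≡ 2 * length low × Unique ts × All (Chosen x y low) ts) →
              (∃ λ us → length us ≡ 2 * length high × Unique us × All (Chosen x y high) us) → pairCount Bs X Y ≡ 2 * k
      count (ts , lt , ut , cts) (us , lu , uu , cus) =
        pairCount-exact {Ws = map real ts} {Rs = map real us} (2 * k) (λ { refl → ℕ.n≮n _ X<Y }) Bs-unique
          (λ B∈ → let t , t∈ , e = ∈-map⁻ real B∈ ; v , c∈ , _ = All.lookup cts t∈ in subst (_∈ Bs) (sym e) (∈-map⁺ real (complete {t} (v , ∈-upTo⁻ c∈))))
          (unique-map (λ a∈ b∈ → real-injective (proj₁ (All.lookup cts a∈)) (proj₁ (All.lookup cts b∈))) ut)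
          (unique-map (λ a∈ b∈ → real-injective (proj₁ (All.lookup cus a∈)) (proj₁ (All.lookup cus b∈))) uu)
          (λ (B∈ , B∈′) → disjoint us cus B∈ B∈′)
          (All.map⁺ (All.map (λ {t} (v , _ , x∈ , y∈) → real-∈ {t} v x∈ eX , real-∈ {t} v y∈ eY) cts))
          (All.map⁺ (All.map (λ {t} (v , _ , x∈ , y∈) → real-∈ {t} v x∈ eX , real-∈ {t} v y∈ eY) cus))
          (trans (List.length-map real ts) (trans lt (cong (2 *_) (length-upTo k))))
          (trans (cong (λ n → 2 * k + n + 2) (trans (List.length-map real us) (trans lu (cong (2 *_) (trans (List.length-map (k +_) (upTo (m ∸ k))) (length-upTo (m ∸ k)))))))
            (lia 4 (λ k n m v → k :+ n :≡ m :⇒ v :≡ 2 :* m :+ lit 2 :⇒ 2 :* k :+ 2 :* n :+ lit 2 :≡ v) k (m ∸ k) m v (ℕ.m+[n∸m]≡n k≤m) v≡))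

    Bs-cyclic : CyclicChain Bs
    Bs-cyclic = closed-cyclic (λ s ℓ → ValidTriple m s × s ∋ ℓ) real adjacent
      (path-map {P = λ s → ValidTriple m s} _,_ (All.tabulate λ t∈ → proj₁ (sound t∈)) w-path) Bs-unique two-blocks
      where
      two-blocks : 2 ≤ length w
      two-blocks = subst (2 ≤_) (List.length-map proj₁ w) (unique-⊆-length {xs = dd 0 false ∷ dd 0 true ∷ []} (((λ ()) ∷ []) ∷ [] ∷ [])
        λ { (here refl) → complete {dd 0 false} (0<m , subst (_< k) (sym (≈-cls (0<m , inj₁ refl))) (ℕ.≤-trans (s≤s z≤n) 2≤k))
          ; (there (here refl)) → complete {dd 0 true} (0<m , subst (_< k) (sym (≈-cls (0<m , inj₁ refl))) (ℕ.≤-trans (s≤s z≤n) 2≤k)) })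

    realised : Σ (List (Block v)) λ Bs → IsTS v (2 * k) Bs × IsSimple Bs × HasCyclicGrayCode Bs
    realised = Bs , (λ X Y X<Y → pair-count X<Y) , Bs-unique , Bs , ↭-refl , Bs-cyclic

  large : Σ (List (Block v)) λ Bs → IsTS v (2 * k) Bs × IsSimple Bs × HasCyclicGrayCode Bs
  large = let _ , _ , p , u , sound , complete = closed-order in realised p u sound complete

-- Trails of blocks, for λ = 2

module _ {v : ℕ} (junk : Block v) where

  -- Junk unless the three points are distinct.
  blockOf : (x y z : Fin v) → Block v
  blockOf x y z with ℕ.<-cmp (toℕ x) (toℕ y) | ℕ.<-cmp (toℕ y) (toℕ z) | ℕ.<-cmp (toℕ x) (toℕ z)
  ... | tri< p _ _ | tri< q _ _ | _          = block x y z p q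
  ... | tri< _ _ _ | tri> _ _ q | tri< r _ _ = block x z y r q
  ... | tri< p _ _ | tri> _ _ _ | tri> _ _ r = block z x y r p
  ... | tri> _ _ p | tri< _ _ _ | tri< r _ _ = block y x z p r
  ... | tri> _ _ _ | tri< q _ _ | tri> _ _ r = block y z x q r
  ... | tri> _ _ p | tri> _ _ q | _          = block z y x q p
  ... | _          | _          | _          = junk

  blockOf-∈ : ∀ {x y z} → x ≢ y → x ≢ z → y ≢ z → let B = blockOf x y z in x ∈B B × y ∈B B × z ∈B B
  blockOf-∈ {x} {y} {z} xy xz yz with ℕ.<-cmp (toℕ x) (toℕ y) | ℕ.<-cmp (toℕ y) (toℕ z) | ℕ.<-cmp (toℕ x) (toℕ z)
  ... | tri< _ _ _ | tri< _ _ _ | _          = inj₁ refl , inj₂ (inj₁ refl) , inj₂ (inj₂ refl)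
  ... | tri< _ _ _ | tri> _ _ _ | tri< _ _ _ = inj₁ refl , inj₂ (inj₂ refl) , inj₂ (inj₁ refl)
  ... | tri< _ _ _ | tri> _ _ _ | tri> _ _ _ = inj₂ (inj₁ refl) , inj₂ (inj₂ refl) , inj₁ refl
  ... | tri> _ _ _ | tri< _ _ _ | tri< _ _ _ = inj₂ (inj₁ refl) , inj₁ refl , inj₂ (inj₂ refl)
  ... | tri> _ _ _ | tri< _ _ _ | tri> _ _ _ = inj₂ (inj₂ refl) , inj₁ refl , inj₂ (inj₁ refl)
  ... | tri> _ _ _ | tri> _ _ _ | _          = inj₂ (inj₂ refl) , inj₂ (inj₁ refl) , inj₁ refl
  ... | tri≈ _ e _ | _          | _          = ⊥-elim (xy (Fin.toℕ-injective e))
  ... | tri< _ _ _ | tri≈ _ e _ | _          = ⊥-elim (yz (Fin.toℕ-injective e))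
  ... | tri> _ _ _ | tri≈ _ e _ | _          = ⊥-elim (yz (Fin.toℕ-injective e))
  ... | tri< _ _ _ | tri> _ _ _ | tri≈ _ e _ = ⊥-elim (xz (Fin.toℕ-injective e))
  ... | tri> _ _ _ | tri< _ _ _ | tri≈ _ e _ = ⊥-elim (xz (Fin.toℕ-injective e))

  blockOf-cong : ∀ {x y z x′ y′ z′} → x ≡ x′ → y ≡ y′ → z ≡ z′ → blockOf x y z ≡ blockOf x′ y′ z′
  blockOf-cong refl refl refl = refl

module Trails {v : ℕ} where

  -- The apex in use after `k` crossings of a ladder.
  side : Bool → ℕ → Bool
  side b zero    = b
  side b (suc k) = side (not b) k

  side-even : ∀ b i → side b (2 * i) ≡ b
  side-even b zero = refl
  side-even b (suc i) rewrite ℕ.+-suc i (i + 0) = trans (cong (λ c → side c (2 * i)) (Bool.not-involutive b)) (side-even b i)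

  record _∋_ (B : Block v) (ℓ : Fin v × Fin v) : Set where
    constructor contains
    field
      first    : proj₁ ℓ ∈B B
      second   : proj₂ ℓ ∈B B
      distinct : proj₁ ℓ ≢ proj₂ ℓ

  open Walks _∋_ public

  -- The predicate bounds the blocks from below only. The exact length is what rules out repetitions
  -- in the end, through the count in `two-covered⇒TS`.
  record Trail (ℓ ℓ′ : Fin v × Fin v) (n : ℕ) (P : Block v → Set) : Set where
    constructor trail
    field
      walk   : Walk
      path   : Path ℓ walk ℓ′
      size   : length walk ≡ n
      covers : ∀ {B} → P B → B ∈ blocks walk
  open Trail public

  one : ∀ {ℓ ℓ′ B} → B ∋ ℓ → B ∋ ℓ′ → Trail ℓ ℓ′ 1 (_≡ B)
  one {B = B} h h′ = trail ((B , _) ∷ []) ((h , h′) ∷ []) refl λ { refl → here refl }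

  infixr 5 _⊕_

  _⊕_ : ∀ {ℓ ℓ′ ℓ″ m n P Q} → Trail ℓ ℓ′ m P → Trail ℓ′ ℓ″ n Q → Trail ℓ ℓ″ (m + n) (λ B → P B ⊎ Q B)
  s ⊕ t = trail (walk s ++ walk t) (path s ++ᵖ path t) (trans (List.length-++ (walk s)) (cong₂ _+_ (size s) (size t)))
    λ { (inj₁ p) → subst (_ ∈_) (sym (List.map-++ proj₁ (walk s) (walk t))) (∈-++⁺ˡ (covers s p))
      ; (inj₂ q) → subst (_ ∈_) (sym (List.map-++ proj₁ (walk s) (walk t))) (∈-++⁺ʳ (blocks (walk s)) (covers t q)) }

  weaken : ∀ {ℓ ℓ′ m n P Q} → m ≡ n → (∀ {B} → Q B → P B) → Trail ℓ ℓ′ m P → Trail ℓ ℓ′ n Q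
  weaken refl f t = trail (walk t) (path t) (size t) (covers t ∘ f)

  relabel : ∀ {ℓ ℓ′ ℓ₁ ℓ₁′ n P} → ℓ ≡ ℓ₁ → ℓ′ ≡ ℓ₁′ → Trail ℓ ℓ′ n P → Trail ℓ₁ ℓ₁′ n P
  relabel refl refl t = t

  backwards : ∀ {ℓ ℓ′ n P} → Trail ℓ ℓ′ n P → Trail ℓ′ ℓ n P
  backwards {ℓ} (trail w p refl c) = trail (backward ℓ w) (backward-path p)
    (trans (sym (List.length-map proj₁ (backward ℓ w))) (trans (sym (↭.↭-length (backward-blocks ℓ w))) (List.length-map proj₁ w)))
    (↭.∈-resp-↭ (backward-blocks ℓ w) ∘ c)

  nil : ∀ {ℓ} → Trail ℓ ℓ 0 (λ _ → ⊥)
  nil = trail [] [] refl λ ()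

  iterate : ∀ (ℓ : ℕ → Fin v × Fin v) {n} {P : ℕ → Block v → Set} m →
            (∀ t → t < m → Trail (ℓ t) (ℓ (suc t)) n (P t)) → Trail (ℓ 0) (ℓ m) (m * n) (λ B → ∃ λ t → t < m × P t B)
  iterate ℓ zero    f = weaken refl (λ ()) nil
  iterate ℓ {n} {P} (suc m) f = weaken (ℕ.+-comm (m * n) n) split-last (iterate ℓ m (λ t t<m → f t (ℕ.m<n⇒m<1+n t<m)) ⊕ f m ℕ.≤-refl)
    where
    split-last : ∀ {B} → (∃ λ t → t < suc m × P t B) → (∃ λ t → t < m × P t B) ⊎ P m B
    split-last (t , t<m , p) with ℕ.m≤n⇒m<n∨m≡n (s≤s⁻¹ t<m)
    ... | inj₁ lt   = inj₁ (t , lt , p)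
    ... | inj₂ refl = inj₂ p

  Covered : List (Block v) → Fin v → Fin v → Set
  Covered L x y = ∃₂ λ B C → B ≢ C × B ∈ L × C ∈ L × (x ∈B B × y ∈B B) × (x ∈B C × y ∈B C)

  Covered-sym : ∀ {L x y} → Covered L x y → Covered L y x
  Covered-sym (B , C , ne , B∈ , C∈ , (xB , yB) , (xC , yC)) = B , C , ne , B∈ , C∈ , (yB , xB) , (yC , xC)

  Has : List (Block v) → Fin v → Fin v → Fin v → Set
  Has L x y z = ∃ λ B → B ∈ L × x ∈B B × y ∈B B × z ∈B B

  has₁₃ : ∀ {L x y z} → Has L x y z → Has L x z y
  has₁₃ (B , B∈ , x , y , z) = B , B∈ , x , z , y

  has₂₃ : ∀ {L x y z} → Has L x y z → Has L y z x
  has₂₃ (B , B∈ , x , y , z) = B , B∈ , y , z , x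

  -- The two blocks differ because a block through `x`, `y`, `z` has no room for `z′`.
  covered : ∀ {L x y z z′} → x ≢ y → x ≢ z → y ≢ z → x ≢ z′ → y ≢ z′ → z ≢ z′ → Has L x y z → Has L x y z′ → Covered L x y
  covered {x = x} {y} {z} {z′} xy xz yz xz′ yz′ zz′ (B , B∈ , xB , yB , zB) (C , C∈ , xC , yC , zC) = B , C , B≢C , B∈ , C∈ , (xB , yB) , (xC , yC)
    where
    B≢C : B ≢ C
    B≢C refl with three-points {B = B} {xs = x ∷ y ∷ z ∷ []} ((xy ∷ xz ∷ []) ∷ (yz ∷ []) ∷ [] ∷ []) refl
        (λ { (here refl) → xB ; (there (here refl)) → yB ; (there (there (here refl))) → zB }) zC
    ... | here e = xz′ (sym e)
    ... | there (here e) = yz′ (sym e)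
    ... | there (there (here e)) = zz′ (sym e)

  finish : ∀ {ℓ n P} (t : Trail ℓ ℓ n P) → TwoCovered (blocks (walk t)) → n * 3 ≡ v * (v ∸ 1) → 2 ≤ n →
           Σ (List (Block v)) λ Bs → IsTS v 2 Bs × IsSimple Bs × HasCyclicGrayCode Bs
  finish (trail w p refl _) cover size two = Bs , proj₁ ts , proj₂ ts , Bs , ↭-refl ,
    subst CyclicChain (List.map-id Bs) (closed-cyclic _∋_ id adjacent p (subst Unique (sym (List.map-id Bs)) (proj₂ ts)) two)
    where
    Bs = blocks w
    ts = two-covered⇒TS Bs cover (trans (cong (_* 3) (List.length-map proj₁ w)) size)
    adjacent : ∀ {s t ℓ} → s ∋ ℓ → t ∋ ℓ → s ≢ t → Adjacent2 s t
    adjacent (contains xs ys ne) (contains xt yt _) = share-pair ne xs ys xt yt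

-- Ladders and their translates

module Ladders (v N : ℕ) (junk : Block v) (pnt : ℕ → Fin v) (period : ∀ a → pnt (a + N) ≡ pnt a)
               (apart : ∀ {a b} → a < b → b < a + N → pnt a ≢ pnt b) where

  open Trails {v} public

  periods : ∀ a i → pnt (a + i * N) ≡ pnt a
  periods a zero    = cong pnt (ℕ.+-identityʳ a)
  periods a (suc i) = trans (cong pnt (trans (cong (a +_) (ℕ.+-comm N (i * N))) (sym (ℕ.+-assoc a (i * N) N)))) (trans (period (a + i * N)) (periods a i))

  pnt-cong : ∀ {a b} i j → a + i * N ≡ b + j * N → pnt a ≡ pnt b
  pnt-cong {a} {b} i j e = trans (sym (periods a i)) (trans (cong pnt e) (periods b j))

  offsets : ∀ Z {a b} → a ≢ b → a < N → b < N → pnt (Z + a) ≢ pnt (Z + b)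
  offsets Z {a} {b} ne a<N b<N with ℕ.<-cmp a b
  ... | tri≈ _ e _ = ⊥-elim (ne e)
  ... | tri< lt _ _ = apart (ℕ.+-monoʳ-< Z lt) (lia 4 (λ Z a b N → b :< N :⇒ Z :+ b :< Z :+ a :+ N) Z a b N b<N)
  ... | tri> _ _ gt = apart (ℕ.+-monoʳ-< Z gt) (lia 4 (λ Z a b N → a :< N :⇒ Z :+ a :< Z :+ b :+ N) Z a b N a<N) ∘ sym

  -- A ladder with apexes 0 and β over the path w₀, …, wₙ.
  module Ladder (n β : ℕ) (w : ℕ → ℕ) (β<N : β < N) (w-positive : ∀ {j} → j ≤ n → 0 < w j) (w<β : ∀ {j} → j ≤ n → w j < β)
                (w-step : ∀ {j} → j < n → w j ≢ w (suc j)) (Z : ℕ) where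

    at : ℕ → Fin v
    at o = pnt (Z + o)

    apex : Bool → ℕ
    apex false = 0
    apex true  = β

    -- Rungs and steps are the labels along a ladder: cells of neighbouring columns at one apex
    -- share a rung, and the two cells of one column share a step.
    rung : Bool → ℕ → Fin v × Fin v
    rung b j = at (apex b) , at (w j)

    step : ℕ → Fin v × Fin v
    step j = at (w j) , at (w (suc j))

    cell : Bool → ℕ → Block v
    cell b j = blockOf junk (at (apex b)) (at (w j)) (at (w (suc j)))

    w<N : ∀ {j} → j ≤ n → w j < N
    w<N j≤n = ℕ.<-trans (w<β j≤n) β<N

    apex≢w : ∀ b {j} → j ≤ n → at (apex b) ≢ at (w j)
    apex≢w false {j} j≤n = offsets Z (ℕ.<⇒≢ (w-positive j≤n)) (ℕ.<-trans (w-positive j≤n) (w<N j≤n)) (w<N j≤n)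
    apex≢w true  {j} j≤n = offsets Z (ℕ.<⇒≢ (w<β j≤n) ∘ sym) β<N (w<N j≤n)

    step≢ : ∀ {j} → j < n → at (w j) ≢ at (w (suc j))
    step≢ j<n = offsets Z (w-step j<n) (w<N (ℕ.<⇒≤ j<n)) (w<N j<n)

    cell-∈ : ∀ b {j} → j < n → at (apex b) ∈B cell b j × at (w j) ∈B cell b j × at (w (suc j)) ∈B cell b j
    cell-∈ b j<n = blockOf-∈ junk (apex≢w b (ℕ.<⇒≤ j<n)) (apex≢w b j<n) (step≢ j<n)

    cell-lower : ∀ b {j} → j < n → cell b j ∋ rung b j
    cell-lower b j<n = let p , q , _ = cell-∈ b j<n in contains p q (apex≢w b (ℕ.<⇒≤ j<n))

    cell-upper : ∀ b {j} → j < n → cell b j ∋ rung b (suc j)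
    cell-upper b j<n = let p , _ , r = cell-∈ b j<n in contains p r (apex≢w b j<n)

    cell-step : ∀ b {j} → j < n → cell b j ∋ step j
    cell-step b j<n = let _ , q , r = cell-∈ b j<n in contains q r (step≢ j<n)

    Cells : ℕ → ℕ → Block v → Set
    Cells i k B = ∃₂ λ b j → i ≤ j × j < i + k × B ≡ cell b j

    first-or-rest : ∀ {i k B} b → Cells i (suc k) B → (B ≡ cell b i ⊎ B ≡ cell (not b) i) ⊎ Cells (suc i) k B
    first-or-rest {i} {k} b (c , j , i≤j , j<k , refl) with ℕ.m≤n⇒m<n∨m≡n i≤j
    ... | inj₁ lt = inj₂ (c , j , lt , subst (j <_) (ℕ.+-suc i k) j<k , refl)
    first-or-rest false (false , j , _) | inj₂ refl = inj₁ (inj₁ refl)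
    first-or-rest false (true , j , _)  | inj₂ refl = inj₁ (inj₂ refl)
    first-or-rest true (false , j , _)  | inj₂ refl = inj₁ (inj₂ refl)
    first-or-rest true (true , j , _)   | inj₂ refl = inj₁ (inj₁ refl)

    -- Out along one apex, across the last column by its step, and back along the other apex.
    loop : ∀ b i k → i + suc k ≤ n → Trail (rung b i) (rung (not b) i) (2 * suc k) (Cells i (suc k))
    loop b i zero h = weaken refl
        (λ {B} c → [ id , (λ { (_ , j , p , q , _) → ⊥-elim (ℕ.<⇒≱ q (subst (_≤ j) (sym (ℕ.+-identityʳ (suc i))) p)) }) ]′ (first-or-rest b c))
        (one (cell-lower b i<n) (cell-step b i<n) ⊕ one (cell-step (not b) i<n) (cell-lower (not b) i<n))
      where
      i<n : i < n
      i<n = subst (_≤ n) (ℕ.+-comm i 1) h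
    loop b i (suc k) h = weaken (lia 1 (λ k → lit 1 :+ (2 :* (lit 1 :+ k) :+ lit 1) :≡ 2 :* (lit 2 :+ k)) k)
        (λ {B} c → [ [ inj₁ , inj₂ ∘ inj₂ ]′ , inj₂ ∘ inj₁ ]′ (first-or-rest b c))
        (one (cell-lower b i<n) (cell-upper b i<n) ⊕ loop b (suc i) k (subst (_≤ n) (ℕ.+-suc i (suc k)) h) ⊕ one (cell-upper (not b) i<n) (cell-lower (not b) i<n))
      where
      i<n : i < n
      i<n = lia 3 (λ i k n → i :+ (lit 2 :+ k) :≤ n :⇒ i :< n) i k n h

    -- Every column is crossed by its step, so the apex changes once per column.
    snake : ∀ b i k → i + k ≤ n → Trail (rung b i) (rung (side b k) (i + k)) (2 * k) (Cells i k)
    snake b i zero h = relabel refl (cong (λ j → at (apex b) , at (w j)) (sym (ℕ.+-identityʳ i)))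
      (weaken refl (λ (_ , j , p , q , _) → ℕ.<⇒≱ q (subst (_≤ j) (sym (ℕ.+-identityʳ i)) p)) nil)
    snake b i (suc k) h = relabel refl (cong (λ j → at (apex (side (not b) k)) , at (w j)) (sym (ℕ.+-suc i k)))
      (weaken (lia 1 (λ k → lit 1 :+ (lit 1 :+ 2 :* k) :≡ 2 :* (lit 1 :+ k)) k) (λ {B} c → [ [ inj₁ , inj₂ ∘ inj₁ ]′ , inj₂ ∘ inj₂ ]′ (first-or-rest b c))
        (one (cell-lower b i<n) (cell-step b i<n) ⊕ one (cell-step (not b) i<n) (cell-upper (not b) i<n) ⊕
          snake (not b) (suc i) k (subst (_≤ n) (ℕ.+-suc i k) h)))
      where
      i<n : i < n
      i<n = lia 3 (λ i k n → i :+ (lit 1 :+ k) :≤ n :⇒ i :< n) i k n h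

    module _ {L : List (Block v)} (cells : ∀ b {j} → j < n → cell b j ∈ L) where

      has-cell : ∀ b {j} → j < n → Has L (at (apex b)) (at (w j)) (at (w (suc j)))
      has-cell b j<n = cell b _ , cells b j<n , cell-∈ b j<n

      step-covered : ∀ {j} → j < n → Covered L (at (w j)) (at (w (suc j)))
      step-covered j<n = covered (step≢ j<n) (apex≢w false (ℕ.<⇒≤ j<n) ∘ sym) (apex≢w false j<n ∘ sym) (apex≢w true (ℕ.<⇒≤ j<n) ∘ sym) (apex≢w true j<n ∘ sym)
        (offsets Z (ℕ.<⇒≢ (ℕ.≤-<-trans z≤n (w<β {0} z≤n))) (ℕ.≤-<-trans z≤n β<N) β<N) (has₂₃ (has-cell false j<n)) (has₂₃ (has-cell true j<n))

      rung-covered : ∀ b {j} → suc j < n → w j ≢ w (suc (suc j)) → Covered L (at (apex b)) (at (w (suc j)))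
      rung-covered b {j} j<n ne = covered (apex≢w b (ℕ.<⇒≤ j<n)) (apex≢w b (ℕ.<⇒≤ j<n′)) (step≢ j<n′ ∘ sym) (apex≢w b j<n) (step≢ j<n)
        (offsets Z ne (w<N (ℕ.<⇒≤ j<n′)) (w<N j<n)) (has₁₃ (has-cell b j<n′)) (has-cell b j<n)
        where
        j<n′ : j < n
        j<n′ = ℕ.<-trans (ℕ.n<1+n j) j<n

      -- An inner rung lies in the cells on both of its sides. An end rung has a cell on one side
      -- only and needs a block from elsewhere.
      rungs-covered : ∀ b → 1 < n → (∀ {j} → suc j < n → w j ≢ w (suc (suc j))) →
                      Covered L (at (apex b)) (at (w 0)) → Covered L (at (apex b)) (at (w n)) →
                      ∀ {j} → j ≤ n → Covered L (at (apex b)) (at (w j))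
      rungs-covered b 1<n step₂ first last {zero}  _   = first
      rungs-covered b 1<n step₂ first last {suc j} j≤n with ℕ.m≤n⇒m<n∨m≡n j≤n
      ... | inj₁ lt   = rung-covered b lt (step₂ lt)
      ... | inj₂ refl = last

  same : ∀ {a b} → a ≡ b + N → pnt a ≡ pnt b
  same {b = b} e = trans (cong pnt e) (period b)

  -- With `c` inverse to `g`, the residue of `Z c` is the `t` sought. So translates that are met in
  -- steps of `g` are all the translates.
  multiples : ∀ .{{_ : NonZero N}} g c K → c * g ≡ 1 + K * N → ∀ Z → ∃ λ t → t < N × (∀ o → pnt (t * g + o) ≡ pnt (Z + o))
  multiples g c K e Z = Z * c % N , ℕ.m%n<n _ N , λ o → pnt-cong (s * g) (Z * K) (begin
    t * g + o + s * g * N     ≡⟨ ring₁ t g o s N ⟩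
    (t + s * N) * g + o       ≡⟨ cong (λ x → x * g + o) (sym (ℕ.m≡m%n+[m/n]*n (Z * c) N)) ⟩
    Z * c * g + o             ≡⟨ cong (_+ o) (ℕ.*-assoc Z c g) ⟩
    Z * (c * g) + o           ≡⟨ cong (λ x → Z * x + o) e ⟩
    Z * (1 + K * N) + o       ≡⟨ ring₂ Z K N o ⟩
    Z + o + Z * K * N         ∎)
    where
    open ≡-Reasoning
    t = Z * c % N
    s = Z * c / N
    ring₁ : ∀ t g o s N → t * g + o + s * g * N ≡ (t + s * N) * g + o
    ring₁ = solve-∀
    ring₂ : ∀ Z K N o → Z * (1 + K * N) + o ≡ Z + o + Z * K * N
    ring₂ = solve-∀

  transport : ∀ {L a b a′ b′} → pnt a ≡ pnt a′ → pnt b ≡ pnt b′ → Covered L (pnt a) (pnt b) → Covered L (pnt a′) (pnt b′)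
  transport {L} = subst₂ (Covered L)

  aligned : ∀ {L} X d {a b} → a ≤ N → b ≡ a + d → (∀ Z → Covered L (pnt (Z + a)) (pnt (Z + b))) → Covered L (pnt X) (pnt (X + d))
  aligned X d {a} {b} a≤N refl cover = transport (same e) (same (lia 5 (λ X Z a d N → Z :+ a :≡ X :+ N :⇒ Z :+ (a :+ d) :≡ X :+ d :+ N) X Z a d N e)) (cover Z)
    where
    Z = X + (N ∸ a)
    e : Z + a ≡ X + N
    e = trans (ℕ.+-assoc X _ a) (cong (X +_) (ℕ.m∸n+n≡m a≤N))

  Scalene : (a b c : ℕ) → Set
  Scalene a b c = a < N × b < N × c < N × a ≢ b × a ≢ c × b ≢ c

  scalene-≢ : ∀ {a b c} → Scalene a b c → ∀ Z → pnt (Z + a) ≢ pnt (Z + b) × pnt (Z + a) ≢ pnt (Z + c) × pnt (Z + b) ≢ pnt (Z + c)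
  scalene-≢ (a<N , b<N , c<N , ab , ac , bc) Z = offsets Z ab a<N b<N , offsets Z ac a<N c<N , offsets Z bc b<N c<N

  has-shift : ∀ {L a b c a′ b′ c′} → pnt a ≡ pnt a′ → pnt b ≡ pnt b′ → pnt c ≡ pnt c′ → Has L (pnt a) (pnt b) (pnt c) → Has L (pnt a′) (pnt b′) (pnt c′)
  has-shift {L} ea eb ec (B , B∈ , x , y , z) = B , B∈ , subst (_∈B B) ea x , subst (_∈B B) eb y , subst (_∈B B) ec z

  covered-at : ∀ {L} Z {a b c d} → a < N → b < N → c < N → d < N → a ≢ b → a ≢ c → b ≢ c → a ≢ d → b ≢ d → c ≢ d →
               Has L (pnt (Z + a)) (pnt (Z + b)) (pnt (Z + c)) → Has L (pnt (Z + a)) (pnt (Z + b)) (pnt (Z + d)) → Covered L (pnt (Z + a)) (pnt (Z + b))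
  covered-at Z a<N b<N c<N d<N ab ac bc ad bd cd = covered (offsets Z ab a<N b<N) (offsets Z ac a<N c<N) (offsets Z bc b<N c<N)
    (offsets Z ad a<N d<N) (offsets Z bd b<N d<N) (offsets Z cd c<N d<N)

  <-or-> : ∀ {a b} → a ≢ b → a < b ⊎ b < a
  <-or-> {a} {b} ne with ℕ.<-cmp a b
  ... | tri< lt _ _ = inj₁ lt
  ... | tri≈ _ e _  = ⊥-elim (ne e)
  ... | tri> _ _ gt = inj₂ gt

  -- Of the two differences of a pair modulo `N`, one is at most `h`; it is read from whichever
  -- point suits.
  circular : ∀ {L} h → N ≤ suc (2 * h) → (∀ X d → 0 < d → d ≤ h → Covered L (pnt X) (pnt (X + d))) →
             ∀ {X Y} → X < N → Y < N → X ≢ Y → Covered L (pnt X) (pnt Y)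
  circular {L} h N≤ cover {X} {Y} X<N Y<N X≢Y = [ (λ lt → ordered lt Y<N) , (λ gt → Covered-sym (ordered gt X<N)) ]′ (<-or-> X≢Y)
    where
    ordered : ∀ {X Y} → X < Y → Y < N → Covered L (pnt X) (pnt Y)
    ordered {X} {Y} lt Y<N with (Y ∸ X) ℕ.≤? h
    ... | yes p = transport refl (cong pnt (ℕ.m+[n∸m]≡n (ℕ.<⇒≤ lt))) (cover X (Y ∸ X) (ℕ.m<n⇒0<n∸m lt) p)
    ... | no ¬p = Covered-sym (transport refl (same wrap) (cover Y (N ∸ (Y ∸ X)) (ℕ.m<n⇒0<n∸m d<N)
        (lia 4 (λ d e N h → d :+ e :≡ N :⇒ N :≤ lit 1 :+ 2 :* h :⇒ h :< d :⇒ e :≤ h) (Y ∸ X) (N ∸ (Y ∸ X)) N h (ℕ.m+[n∸m]≡n (ℕ.<⇒≤ d<N)) N≤ (ℕ.≰⇒> ¬p))))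
      where
      d<N : Y ∸ X < N
      d<N = ℕ.≤-<-trans (ℕ.m∸n≤m Y X) Y<N
      wrap : Y + (N ∸ (Y ∸ X)) ≡ X + N
      wrap = lia 5 (λ X Y d e N → X :+ d :≡ Y :⇒ d :+ e :≡ N :⇒ Y :+ e :≡ X :+ N) X Y (Y ∸ X) (N ∸ (Y ∸ X)) N (ℕ.m+[n∸m]≡n (ℕ.<⇒≤ lt)) (ℕ.m+[n∸m]≡n (ℕ.<⇒≤ d<N))

  Spread : (a b c d : ℕ) → Set
  Spread a b c d = a < N × b < N × c < N × d < N × a ≢ b × a ≢ c × b ≢ c × a ≢ d × b ≢ d × c ≢ d

  covered-spread : ∀ {L} Z a b c d → Spread a b c d →
                   Has L (pnt (Z + a)) (pnt (Z + b)) (pnt (Z + c)) → Has L (pnt (Z + a)) (pnt (Z + b)) (pnt (Z + d)) → Covered L (pnt (Z + a)) (pnt (Z + b))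
  covered-spread Z a b c d (a<N , b<N , c<N , d<N , ab , ac , bc , ad , bd , cd) = covered-at Z a<N b<N c<N d<N ab ac bc ad bd cd

infix 6 _:≢_

_:≢_ : Term → Term → Formula
s :≢ t = s :≡ t :⇒ :⊥

spread : (N a b c d : Term) → Formula
spread N a b c d = a :< N :∧ b :< N :∧ c :< N :∧ d :< N :∧ a :≢ b :∧ a :≢ c :∧ b :≢ c :∧ a :≢ d :∧ b :≢ d :∧ c :≢ d

scalene : (N a b c : Term) → Formula
scalene N a b c = a :< N :∧ b :< N :∧ c :< N :∧ a :≢ b :∧ a :≢ c :∧ b :≢ c

mod-apart : ∀ {N a b} .{{_ : NonZero N}} → a < b → b < a + N → a % N ≢ b % N
mod-apart {N} {a} {b} a<b b<a+N e = cases (ℕ.<-cmp (a / N) (b / N))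
  where
  qa = a / N
  qb = b / N
  ea : a ≡ a % N + qa * N
  ea = ℕ.m≡m%n+[m/n]*n a N
  eb : b ≡ a % N + qb * N
  eb = trans (ℕ.m≡m%n+[m/n]*n b N) (cong (_+ qb * N) (sym e))
  mono : ∀ {p q} → p ≤ q → p * N ≤ q * N
  mono = ℕ.*-monoˡ-≤ N
  cases : _ → ⊥
  cases (tri≈ _ eq _) = ℕ.<⇒≢ a<b (trans ea (trans (cong (λ q → a % N + q * N) eq) (sym eb)))
  cases (tri> _ _ gt) = lia 5 (λ a b r x y → a :≡ r :+ x :⇒ b :≡ r :+ y :⇒ y :≤ x :⇒ a :< b :⇒ :⊥) a b (a % N) (qa * N) (qb * N) ea eb (mono (ℕ.<⇒≤ gt)) a<b
  cases (tri< lt _ _) = lia 6 (λ a b r x y N → a :≡ r :+ x :⇒ b :≡ r :+ y :⇒ N :+ x :≤ y :⇒ b :< a :+ N :⇒ :⊥) a b (a % N) (qa * N) (qb * N) N ea eb (mono lt) b<a+N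

module Residues (N v : ℕ) .{{_ : NonZero N}} (N≤v : N ≤ v) where

  pnt : ℕ → Fin v
  pnt a = fromℕ< (ℕ.<-≤-trans (ℕ.m%n<n a N) N≤v)

  toℕ-pnt : ∀ a → toℕ (pnt a) ≡ a % N
  toℕ-pnt a = Fin.toℕ-fromℕ< _

  period : ∀ a → pnt (a + N) ≡ pnt a
  period a = Fin.toℕ-injective (trans (toℕ-pnt (a + N)) (trans (ℕ.[m+n]%n≡m%n a N) (sym (toℕ-pnt a))))

  apart : ∀ {a b} → a < b → b < a + N → pnt a ≢ pnt b
  apart {a} {b} a<b b<a+N e = mod-apart a<b b<a+N (trans (sym (toℕ-pnt a)) (trans (cong toℕ e) (toℕ-pnt b)))

  pnt-toℕ : ∀ {x} → toℕ x < N → pnt (toℕ x) ≡ x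
  pnt-toℕ {x} h = Fin.toℕ-injective (trans (toℕ-pnt (toℕ x)) (ℕ.m<n⇒m%n≡m h))

-- With one branch rising and the other falling by 1, neighbours have the differences 1, 2, 3, ....
zigzag : (p q : ℕ → ℕ) → ℕ → ℕ
zigzag p q j = if odd j then q ⌊ j /2⌋ else p ⌊ j /2⌋

odd-2* : ∀ i → odd (2 * i) ≡ false
odd-2* zero    = refl
odd-2* (suc i) = trans (cong odd (ℕ.*-suc 2 i)) (odd-2* i)

odd-1+2* : ∀ i → odd (suc (2 * i)) ≡ true
odd-1+2* zero    = refl
odd-1+2* (suc i) = trans (cong (odd ∘ suc) (ℕ.*-suc 2 i)) (odd-1+2* i)

zigzag-even : ∀ p q i → zigzag p q (2 * i) ≡ p i
zigzag-even p q i rewrite odd-2* i | ⌊2*n/2⌋ i = refl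

zigzag-odd : ∀ p q i → zigzag p q (suc (2 * i)) ≡ q i
zigzag-odd p q i rewrite odd-1+2* i | ⌊1+2*n/2⌋ i = refl

-- Order 12 u + 4, over ℤ_v.
module Order₄ (u v : ℕ) .{{_ : NonZero v}} (1≤u : 1 ≤ u) (v≡ : v ≡ 12 * u + 4) (junk : Block v) where

  open Residues v v ℕ.≤-refl
  open Ladders v v junk pnt period apart

  -- The path `3 u + 1, 3 u + 2, 3 u, 3 u + 3, …, 2 u + 1` exhausts the interval from `2 u +
  -- 1` to `4 u + 1` with the differences 1 to `2 u`.
  p q w : ℕ → ℕ
  p i = 3 * u + 1 ∸ i
  q i = 3 * u + 2 + i
  w = zigzag p q

  w-even : ∀ {i} → i ≤ u → w (2 * i) + i ≡ 3 * u + 1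
  w-even {i} h = trans (cong (_+ i) (zigzag-even p q i)) (ℕ.m∸n+n≡m (lia 2 (λ i u → i :≤ u :⇒ i :≤ 3 :* u :+ lit 1) i u h))

  w-odd : ∀ i → w (suc (2 * i)) ≡ 3 * u + 2 + i
  w-odd i = zigzag-odd p q i

  -- The graph of `w`, with subtraction replaced by addition so that linear arithmetic applies.
  W : ℕ → ℕ → Set
  W j x = (∃ λ i → j ≡ 2 * i × x + i ≡ 3 * u + 1) ⊎ (∃ λ i → j ≡ 1 + 2 * i × x ≡ 3 * u + 2 + i)

  w-spec : ∀ {j} → j ≤ 2 * u → W j (w j)
  w-spec {j} h with halves j
  ... | inj₁ e = inj₁ (⌊ j /2⌋ , e , trans (cong (λ j′ → w j′ + ⌊ j /2⌋) e) (w-even (lia 3 (λ j i u → j :≡ 2 :* i :⇒ j :≤ 2 :* u :⇒ i :≤ u) j ⌊ j /2⌋ u e h)))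
  ... | inj₂ e = inj₂ (⌊ j /2⌋ , e , trans (cong w e) (w-odd ⌊ j /2⌋))

  w-bounds : ∀ {j} → j ≤ 2 * u → 2 * u + 1 ≤ w j × w j ≤ 4 * u + 1
  w-bounds {j} h with w-spec h
  ... | inj₁ (i , e , e′) = lia 4 (λ j i u x → j :≤ 2 :* u :⇒ j :≡ 2 :* i :⇒ x :+ i :≡ 3 :* u :+ lit 1 :⇒ (2 :* u :+ lit 1 :≤ x :∧ x :≤ 4 :* u :+ lit 1)) j i u (w j) h e e′
  ... | inj₂ (i , e , e′) = lia 4 (λ i u x j → i :< u :⇒ x :≡ 3 :* u :+ lit 2 :+ i :⇒ (2 :* u :+ lit 1 :≤ x :∧ x :≤ 4 :* u :+ lit 1)) i u (w j) j i<u e′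
    where
    i<u : i < u
    i<u = ℕ.*-cancelˡ-< 2 i u (subst (_≤ 2 * u) e h)

  w-injective : ∀ {i j x} → i < j → W i x → W j x → ⊥
  w-injective {i} {j} {x} lt (inj₁ (a , e , f)) (inj₁ (b , e′ , f′)) = lia 6 (λ i j a b u x → i :< j :⇒ i :≡ 2 :* a :⇒ x :+ a :≡ 3 :* u :+ lit 1 :⇒ j :≡ 2 :* b :⇒ x :+ b :≡ 3 :* u :+ lit 1 :⇒ :⊥) i j a b u x lt e f e′ f′
  w-injective {i} {j} {x} lt (inj₁ (a , e , f)) (inj₂ (b , e′ , f′)) = lia 4 (λ a b u x → x :+ a :≡ 3 :* u :+ lit 1 :⇒ x :≡ 3 :* u :+ lit 2 :+ b :⇒ :⊥) a b u x f f′
  w-injective {i} {j} {x} lt (inj₂ (a , e , f)) (inj₁ (b , e′ , f′)) = lia 4 (λ a b u x → x :+ a :≡ 3 :* u :+ lit 1 :⇒ x :≡ 3 :* u :+ lit 2 :+ b :⇒ :⊥) b a u x f′ f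
  w-injective {i} {j} {x} lt (inj₂ (a , e , f)) (inj₂ (b , e′ , f′)) = lia 6 (λ i j a b u x → i :< j :⇒ i :≡ lit 1 :+ 2 :* a :⇒ x :≡ 3 :* u :+ lit 2 :+ a :⇒ j :≡ lit 1 :+ 2 :* b :⇒ x :≡ 3 :* u :+ lit 2 :+ b :⇒ :⊥) i j a b u x lt e f e′ f′

  w-≢ : ∀ {i j} → i < j → j ≤ 2 * u → w i ≢ w j
  w-≢ {i} {j} lt h e = w-injective lt (w-spec (ℕ.≤-trans (ℕ.<⇒≤ lt) h)) (subst (W j) (sym e) (w-spec h))

  -- The apex 0 has the differences `2 u + 1` to `4 u + 1` to the path, and `β` is placed so as to
  -- have `4 u + 2` to `6 u + 2`; with those of the steps this makes all differences up to `v / 2`.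
  g n β : ℕ
  g = 2 * u + 1
  n = 2 * u
  β = 8 * u + 3

  β<v : β < v
  β<v = lia 2 (λ u v → v :≡ 12 :* u :+ lit 4 :⇒ 8 :* u :+ lit 3 :< v) u v v≡

  open module L (Z : ℕ) = Ladder n β w β<v
    (λ {j} h → lia 2 (λ u x → 2 :* u :+ lit 1 :≤ x :⇒ lit 0 :< x) u (w j) (proj₁ (w-bounds h)))
    (λ {j} h → lia 2 (λ u x → x :≤ 4 :* u :+ lit 1 :⇒ x :< 8 :* u :+ lit 3) u (w j) (proj₂ (w-bounds h)))
    (λ {j} h → w-≢ (ℕ.n<1+n j) h) Z hiding (apex; w<N)
  open L 0 using (apex; w<N)

  wₙ : w n ≡ 2 * u + 1
  wₙ = lia 2 (λ u x → x :+ u :≡ 3 :* u :+ lit 1 :⇒ x :≡ 2 :* u :+ lit 1) u (w n) (w-even ℕ.≤-refl)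

  -- Its differences `2 u + 1`, `3 u + 1`, `5 u + 2` are those of three of the end rungs. The
  -- fourth, from `β` to `2 u + 1`, has difference `v / 2` and needs no further triple.
  E : ℕ → Block v
  E Z = blockOf junk (at Z 0) (at Z (2 * u + 1)) (at Z (5 * u + 2))

  E-≢ : ∀ Z → at Z 0 ≢ at Z (2 * u + 1) × at Z 0 ≢ at Z (5 * u + 2) × at Z (2 * u + 1) ≢ at Z (5 * u + 2)
  E-≢ = scalene-≢ (lia 2 (λ u v → v :≡ 12 :* u :+ lit 4 :⇒ scalene v (lit 0) (2 :* u :+ lit 1) (5 :* u :+ lit 2)) u v v≡)

  E-∈ : ∀ Z → at Z 0 ∈B E Z × at Z (2 * u + 1) ∈B E Z × at Z (5 * u + 2) ∈B E Z
  E-∈ Z = let ne₁ , ne₂ , ne₃ = E-≢ Z in blockOf-∈ junk ne₁ ne₂ ne₃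

  Unit : ℕ → Block v → Set
  Unit Z B = Cells Z 0 n B ⊎ B ≡ E Z

  -- The number of columns is even, so the snake ends at the apex where it began. The triple `E`
  -- then leads from the last rung there to the first rung of the ladder translated by `g`.
  unit : ∀ Z → Trail (rung Z false 0) (rung (Z + g) false 0) (4 * u + 1) (Unit Z)
  unit Z = weaken (lia 1 (λ u → 2 :* (2 :* u) :+ lit 1 :≡ 4 :* u :+ lit 1) u) id
    (relabel refl (cong₂ (λ b o → at Z (apex b) , at Z o) (side-even false u) wₙ) (snake Z false 0 n ℕ.≤-refl) ⊕
     relabel refl (cong₂ _,_ (cong pnt (sym (ℕ.+-identityʳ (Z + g)))) (cong pnt (lia 2 (λ Z u → Z :+ (5 :* u :+ lit 2) :≡ Z :+ (2 :* u :+ lit 1) :+ (3 :* u :+ lit 1)) Z u)))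
       (let h₁ , h₂ , h₃ = E-∈ Z ; ne₁ , _ , ne₃ = E-≢ Z in one (contains h₁ h₂ ne₁) (contains h₂ h₃ ne₃)))

  abstract

    cycle : Trail (rung 0 false 0) (rung 0 false 0) (v * (4 * u + 1)) (λ B → ∃ λ t → t < v × Unit (t * g) B)
    cycle = relabel refl (cong₂ _,_ (around 0) (around (w 0))) (iterate (λ t → rung (t * g) false 0) v λ t _ →
        relabel refl (cong (λ Z → rung Z false 0) (ℕ.+-comm (t * g) g)) (unit (t * g)))
      where
      around : ∀ o → pnt (v * g + o) ≡ pnt o
      around o = pnt-cong 0 g (trans (ℕ.+-identityʳ _) (trans (ℕ.+-comm (v * g) o) (cong (o +_) (ℕ.*-comm v g))))

  L : List (Block v)
  L = blocks (walk cycle)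

  multiple : ∀ Z → ∃ λ t → t < v × (∀ o → at (t * g) o ≡ at Z o)
  multiple = multiples g (6 * u + 5) (u + 1) (trans (expand u) (cong (λ x → 1 + (u + 1) * x) (sym v≡)))
    where
    expand : ∀ u → (6 * u + 5) * (2 * u + 1) ≡ 1 + (u + 1) * (12 * u + 4)
    expand = solve-∀

  cells∈L : ∀ Z b {j} → j < n → cell Z b j ∈ L
  cells∈L Z b {j} j<n = let t , t<v , e = multiple Z in
    subst (_∈ L) (blockOf-cong junk (e (apex b)) (e (w j)) (e (w (suc j)))) (covers cycle {cell (t * g) b j} (t , t<v , inj₁ (b , j , z≤n , j<n , refl)))

  hasE : ∀ Z → Has L (at Z 0) (at Z (2 * u + 1)) (at Z (5 * u + 2))
  hasE Z = let t , t<v , e = multiple Z in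
    E Z , subst (_∈ L) (blockOf-cong junk (e 0) (e (2 * u + 1)) (e (5 * u + 2))) (covers cycle {E (t * g)} (t , t<v , inj₂ refl)) , E-∈ Z

  r : ℕ
  r = u ∸ 1

  1+r : suc r ≡ u
  1+r = ℕ.m+[n∸m]≡n 1≤u

  has-last : ∀ Z b → Has L (at Z (apex b)) (at Z (2 * u + 1)) (at Z (4 * u + 1))
  has-last Z b = has-shift refl
    (cong (λ o → pnt (Z + o)) (trans (cong w (lia 2 (λ r u → lit 1 :+ r :≡ u :⇒ lit 2 :+ 2 :* r :≡ 2 :* u) r u 1+r)) wₙ))
    (cong (λ o → pnt (Z + o)) (trans (w-odd r) (lia 2 (λ r u → lit 1 :+ r :≡ u :⇒ 3 :* u :+ lit 2 :+ r :≡ 4 :* u :+ lit 1) r u 1+r)))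
    (has₁₃ (has-cell Z (cells∈L Z) b (lia 2 (λ r u → lit 1 :+ r :≡ u :⇒ lit 1 :+ 2 :* r :< 2 :* u) r u 1+r)))

  first-covered : ∀ Z b → Covered L (at Z (apex b)) (at Z (w 0))
  first-covered Z false = covered-spread Z 0 (3 * u + 1) (3 * u + 2 + 0) (10 * u + 3)
    (lia 2 (λ u v → v :≡ 12 :* u :+ lit 4 :⇒ lit 1 :≤ u :⇒ spread v (lit 0) (3 :* u :+ lit 1) (3 :* u :+ lit 2 :+ lit 0) (10 :* u :+ lit 3)) u v v≡ 1≤u)
    (has-cell Z (cells∈L Z) false (ℕ.≤-trans 1≤u (ℕ.m≤m+n u _)))
    (has₂₃ (has-shift
      (cong pnt (lia 4 (λ Z Z′ u v → v :≡ 12 :* u :+ lit 4 :⇒ Z′ :+ (2 :* u :+ lit 1) :≡ Z :+ v :⇒ Z′ :+ lit 0 :≡ Z :+ (10 :* u :+ lit 3)) Z Z′ u v v≡ e))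
      (same (lia 4 (λ Z Z′ u v → Z′ :+ (2 :* u :+ lit 1) :≡ Z :+ v :⇒ Z′ :+ (2 :* u :+ lit 1) :≡ Z :+ lit 0 :+ v) Z Z′ u v e))
      (same (lia 4 (λ Z Z′ u v → Z′ :+ (2 :* u :+ lit 1) :≡ Z :+ v :⇒ Z′ :+ (5 :* u :+ lit 2) :≡ Z :+ (3 :* u :+ lit 1) :+ v) Z Z′ u v e))
      (hasE Z′)))
    where
    -- Translation by `-(2 u + 1)` takes the pair `2 u + 1, 5 u + 2` of `E` to `0, 3 u + 1`.
    Z′ = Z + (v ∸ (2 * u + 1))
    e : Z′ + (2 * u + 1) ≡ Z + v
    e = trans (ℕ.+-assoc Z _ _) (cong (Z +_) (ℕ.m∸n+n≡m (lia 2 (λ u v → v :≡ 12 :* u :+ lit 4 :⇒ 2 :* u :+ lit 1 :≤ v) u v v≡)))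
  first-covered Z true = covered-spread Z β (3 * u + 1) (3 * u + 2 + 0) (5 * u + 2)
    (lia 2 (λ u v → v :≡ 12 :* u :+ lit 4 :⇒ lit 1 :≤ u :⇒ spread v (8 :* u :+ lit 3) (3 :* u :+ lit 1) (3 :* u :+ lit 2 :+ lit 0) (5 :* u :+ lit 2)) u v v≡ 1≤u)
    (has-cell Z (cells∈L Z) true (ℕ.≤-trans 1≤u (ℕ.m≤m+n u _)))
    (has₂₃ (has₂₃ (has-shift
      (cong pnt (lia 2 (λ Z u → Z :+ (3 :* u :+ lit 1) :+ lit 0 :≡ Z :+ (3 :* u :+ lit 1)) Z u))
      (cong pnt (lia 2 (λ Z u → Z :+ (3 :* u :+ lit 1) :+ (2 :* u :+ lit 1) :≡ Z :+ (5 :* u :+ lit 2)) Z u))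
      (cong pnt (lia 2 (λ Z u → Z :+ (3 :* u :+ lit 1) :+ (5 :* u :+ lit 2) :≡ Z :+ (8 :* u :+ lit 3)) Z u))
      (hasE (Z + (3 * u + 1))))))

  last-covered′ : ∀ Z b → Covered L (at Z (apex b)) (at Z (2 * u + 1))
  last-covered′ Z false = covered-spread Z 0 (2 * u + 1) (4 * u + 1) (5 * u + 2)
    (lia 2 (λ u v → v :≡ 12 :* u :+ lit 4 :⇒ lit 1 :≤ u :⇒ spread v (lit 0) (2 :* u :+ lit 1) (4 :* u :+ lit 1) (5 :* u :+ lit 2)) u v v≡ 1≤u)
    (has-last Z false) (hasE Z)
  last-covered′ Z true = covered-spread Z β (2 * u + 1) (4 * u + 1) (10 * u + 3)
    (lia 2 (λ u v → v :≡ 12 :* u :+ lit 4 :⇒ lit 1 :≤ u :⇒ spread v (8 :* u :+ lit 3) (2 :* u :+ lit 1) (4 :* u :+ lit 1) (10 :* u :+ lit 3)) u v v≡ 1≤u)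
    (has-last Z true)
    -- Translation by `v / 2 = 6 u + 2` exchanges the two points of this pair, so it takes the last
    -- cell at `β` to a second block through them.
    (has-swap (has-shift
      (same (lia 3 (λ Z u v → v :≡ 12 :* u :+ lit 4 :⇒ Z :+ (6 :* u :+ lit 2) :+ (8 :* u :+ lit 3) :≡ Z :+ (2 :* u :+ lit 1) :+ v) Z u v v≡))
      (cong pnt (lia 2 (λ Z u → Z :+ (6 :* u :+ lit 2) :+ (2 :* u :+ lit 1) :≡ Z :+ (8 :* u :+ lit 3)) Z u))
      (cong pnt (lia 2 (λ Z u → Z :+ (6 :* u :+ lit 2) :+ (4 :* u :+ lit 1) :≡ Z :+ (10 :* u :+ lit 3)) Z u))
      (has-last (Z + (6 * u + 2)) true)))
    where
    has-swap : ∀ {x y z} → Has L x y z → Has L y x z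
    has-swap h = has₁₃ (has₂₃ h)

  rung-pair : ∀ Z b {j} → j ≤ n → Covered L (at Z (apex b)) (at Z (w j))
  rung-pair Z b = rungs-covered Z (cells∈L Z) b (lia 1 (λ u → lit 1 :≤ u :⇒ lit 1 :< 2 :* u) u 1≤u)
    (λ {j} h → w-≢ (ℕ.m<n⇒m<1+n (ℕ.n<1+n j)) h)
    (first-covered Z b) (subst (λ o → Covered L (at Z (apex b)) (at Z o)) (sym wₙ) (last-covered′ Z b))

  w-onto : ∀ x → 2 * u + 1 ≤ x → x ≤ 4 * u + 1 → ∃ λ j → j ≤ n × w j ≡ x
  w-onto x lo hi with x ℕ.≤? 3 * u + 1
  ... | yes h = 2 * i , ℕ.*-monoʳ-≤ 2 i≤u , trans (zigzag-even p q i) (ℕ.m∸[m∸n]≡n h)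
    where
    i = 3 * u + 1 ∸ x
    i≤u : i ≤ u
    i≤u = lia 3 (λ x i u → x :+ i :≡ 3 :* u :+ lit 1 :⇒ 2 :* u :+ lit 1 :≤ x :⇒ i :≤ u) x i u (ℕ.m+[n∸m]≡n h) lo
  ... | no h = suc (2 * i) , lia 3 (λ x i u → 3 :* u :+ lit 2 :+ i :≡ x :⇒ x :≤ 4 :* u :+ lit 1 :⇒ lit 1 :+ 2 :* i :≤ 2 :* u) x i u e hi , trans (w-odd i) e
    where
    i = x ∸ (3 * u + 2)
    e : 3 * u + 2 + i ≡ x
    e = ℕ.m+[n∸m]≡n (lia 2 (λ x u → 3 :* u :+ lit 1 :< x :⇒ 3 :* u :+ lit 2 :≤ x) x u (ℕ.≰⇒> h))

  pairs : ∀ X d → 0 < d → d ≤ 6 * u + 2 → Covered L (pnt X) (pnt (X + d))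
  pairs X (suc j) _ d≤ with suc j ℕ.≤? 2 * u | suc j ℕ.≤? 4 * u + 1 | halves j
  ... | yes h | _ | inj₁ e = aligned X (suc j) {w j} {w (suc j)} (ℕ.<⇒≤ (w<N (ℕ.<⇒≤ h)))
        (lia 5 (λ j i u x y → j :≡ 2 :* i :⇒ x :+ i :≡ 3 :* u :+ lit 1 :⇒ y :≡ 3 :* u :+ lit 2 :+ i :⇒ y :≡ x :+ (lit 1 :+ j)) j ⌊ j /2⌋ u (w j) (w (suc j)) e
          (trans (cong (λ j′ → w j′ + ⌊ j /2⌋) e) (w-even (lia 3 (λ j i u → j :≡ 2 :* i :⇒ lit 1 :+ j :≤ 2 :* u :⇒ i :≤ u) j ⌊ j /2⌋ u e h)))
          (trans (cong (w ∘ suc) e) (w-odd ⌊ j /2⌋)))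
        λ Z → step-covered Z (cells∈L Z) h
  ... | yes h | _ | inj₂ e = aligned X (suc j) {w (suc j)} {w j} (ℕ.<⇒≤ (w<N h))
        (lia 5 (λ j i u x y → j :≡ lit 1 :+ 2 :* i :⇒ y :+ (lit 1 :+ i) :≡ 3 :* u :+ lit 1 :⇒ x :≡ 3 :* u :+ lit 2 :+ i :⇒ x :≡ y :+ (lit 1 :+ j)) j ⌊ j /2⌋ u (w j) (w (suc j)) e
          (trans (cong (λ j′ → w j′ + suc ⌊ j /2⌋) (trans (cong suc e) (sym (ℕ.*-suc 2 ⌊ j /2⌋))))
            (w-even (lia 3 (λ j i u → j :≡ lit 1 :+ 2 :* i :⇒ lit 1 :+ j :≤ 2 :* u :⇒ lit 1 :+ i :≤ u) j ⌊ j /2⌋ u e h)))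
          (trans (cong w e) (w-odd ⌊ j /2⌋)))
        λ Z → Covered-sym (step-covered Z (cells∈L Z) h)
  ... | no h | yes h′ | _ = let i , i≤n , e = w-onto (suc j) (subst (_≤ suc j) (ℕ.+-comm 1 (2 * u)) (ℕ.≰⇒> h)) h′ in
        aligned X (suc j) {0} {w i} z≤n e λ Z → rung-pair Z false i≤n
  ... | no _ | no h′ | _ = let i , i≤n , e = w-onto (8 * u + 3 ∸ suc j) lo hi in
        aligned X (suc j) {w i} {β} (ℕ.<⇒≤ (w<N i≤n)) (sym (trans (cong (_+ suc j) e) (ℕ.m∸n+n≡m d≤β))) λ Z → Covered-sym (rung-pair Z true i≤n)
    where
    d≤β : suc j ≤ 8 * u + 3
    d≤β = ℕ.≤-trans d≤ (lia 1 (λ u → 6 :* u :+ lit 2 :≤ 8 :* u :+ lit 3) u)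
    lo : 2 * u + 1 ≤ 8 * u + 3 ∸ suc j
    lo = lia 3 (λ d c u → d :+ c :≡ 8 :* u :+ lit 3 :⇒ d :≤ 6 :* u :+ lit 2 :⇒ 2 :* u :+ lit 1 :≤ c) (suc j) _ u (ℕ.m+[n∸m]≡n d≤β) d≤
    hi : 8 * u + 3 ∸ suc j ≤ 4 * u + 1
    hi = lia 3 (λ d c u → d :+ c :≡ 8 :* u :+ lit 3 :⇒ 4 :* u :+ lit 1 :< d :⇒ c :≤ 4 :* u :+ lit 1) (suc j) _ u (ℕ.m+[n∸m]≡n d≤β) (ℕ.≰⇒> h′)

  solution : Σ (List (Block v)) λ Bs → IsTS v 2 Bs × IsSimple Bs × HasCyclicGrayCode Bs
  solution = finish cycle (λ {x} {y} x≢y → subst₂ (Covered L) (pnt-toℕ (Fin.toℕ<n x)) (pnt-toℕ (Fin.toℕ<n y))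
      (circular (6 * u + 2) (lia 2 (λ u v → v :≡ 12 :* u :+ lit 4 :⇒ v :≤ lit 1 :+ 2 :* (6 :* u :+ lit 2)) u v v≡) pairs (Fin.toℕ<n x) (Fin.toℕ<n y) (x≢y ∘ Fin.toℕ-injective)))
    (trans (ℕ.*-assoc v (4 * u + 1) 3) (cong (λ x → v * (x ∸ 1)) {suc ((4 * u + 1) * 3)} {v}
      (trans (cong suc (ℕ.*-comm (4 * u + 1) 3)) (lia 2 (λ u v → v :≡ 12 :* u :+ lit 4 :⇒ lit 1 :+ 3 :* (4 :* u :+ lit 1) :≡ v) u v v≡))))
    (ℕ.*-mono-≤ {2} {v} {1} {4 * u + 1} (lia 2 (λ u v → v :≡ 12 :* u :+ lit 4 :⇒ lit 2 :≤ v) u v v≡) (lia 1 (λ u → lit 1 :≤ 4 :* u :+ lit 1) u))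

-- Order 12 u with u = r + 2, over ℤ_N ∪ {∞} with N = 12 u - 1 = 12 r + 23.
module Order₀ (r : ℕ) (junk : Block (suc (12 * r + 23))) where

  N v u : ℕ
  N = 12 * r + 23
  v = suc N
  u = 2 + r

  instance
    N-nonZero : NonZero N
    N-nonZero = >-nonZero (lia 1 (λ r → lit 0 :< 12 :* r :+ lit 23) r)

  open Residues N v (ℕ.n≤1+n N) public
  open Ladders v N junk pnt period apart public

  -- The path `3 u, 3 u - 1, 3 u + 1, …, 2 u` exhausts the interval from `2 u` to `4 u - 1` with the
  -- differences 1 to `2 u - 1`.
  p q w : ℕ → ℕ
  p i = 3 * r + 6 + i
  q i = 3 * r + 5 ∸ i
  w = zigzag p q

  -- Modulo `N` the apex `β` is `-2 u`. The apexes 0 and `-2 u` have the differences `2 u` to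
  -- `4 u - 1` and `4 u` to `6 u - 1 = (N - 1) / 2` to the path.
  n′ n β : ℕ
  n′ = 2 * r + 2
  n = suc n′
  β = 10 * r + 19

  w-even : ∀ i → w (2 * i) ≡ 3 * r + 6 + i
  w-even i = zigzag-even p q i

  w-odd : ∀ {i} → i ≤ r + 1 → w (suc (2 * i)) + i ≡ 3 * r + 5
  w-odd {i} h = trans (cong (_+ i) (zigzag-odd p q i)) (ℕ.m∸n+n≡m (lia 2 (λ i r → i :≤ r :+ lit 1 :⇒ i :≤ 3 :* r :+ lit 5) i r h))

  W : ℕ → ℕ → Set
  W j x = (∃ λ i → i ≤ r + 1 × j ≡ 2 * i × x ≡ 3 * r + 6 + i) ⊎ (∃ λ i → i ≤ r + 1 × j ≡ 1 + 2 * i × x + i ≡ 3 * r + 5)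

  w-spec : ∀ {j} → j ≤ n → W j (w j)
  w-spec {j} h with halves j
  ... | inj₁ e = inj₁ (⌊ j /2⌋ , ℕ.≮⇒≥ (λ lt → lia 3 (λ j i r → j :≡ 2 :* i :⇒ j :≤ lit 3 :+ 2 :* r :⇒ r :+ lit 1 :< i :⇒ :⊥) j ⌊ j /2⌋ r e
      (subst (j ≤_) (cong suc (ℕ.+-comm (2 * r) 2)) h) lt) , e , trans (cong w e) (w-even ⌊ j /2⌋))
  ... | inj₂ e = inj₂ (⌊ j /2⌋ , i≤ , e , trans (cong (λ j′ → w j′ + ⌊ j /2⌋) e) (w-odd i≤))
    where
    i≤ : ⌊ j /2⌋ ≤ r + 1
    i≤ = lia 3 (λ j i r → j :≡ lit 1 :+ 2 :* i :⇒ j :≤ lit 1 :+ (2 :* r :+ lit 2) :⇒ i :≤ r :+ lit 1) j ⌊ j /2⌋ r e h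

  w-bounds : ∀ {j} → j ≤ n → 2 * r + 4 ≤ w j × w j ≤ 4 * r + 7
  w-bounds {j} h with w-spec h
  ... | inj₁ (i , i≤ , e , e′) = lia 3 (λ i r x → i :≤ r :+ lit 1 :⇒ x :≡ 3 :* r :+ lit 6 :+ i :⇒ (2 :* r :+ lit 4 :≤ x :∧ x :≤ 4 :* r :+ lit 7)) i r (w j) i≤ e′
  ... | inj₂ (i , i≤ , e , e′) = lia 3 (λ i r x → i :≤ r :+ lit 1 :⇒ x :+ i :≡ 3 :* r :+ lit 5 :⇒ (2 :* r :+ lit 4 :≤ x :∧ x :≤ 4 :* r :+ lit 7)) i r (w j) i≤ e′

  w-injective : ∀ {i j x} → i < j → W i x → W j x → ⊥
  w-injective {i} {j} {x} lt (inj₁ (a , _ , e , f)) (inj₁ (b , _ , e′ , f′)) = lia 6 (λ i j a b r x → i :< j :⇒ i :≡ 2 :* a :⇒ x :≡ 3 :* r :+ lit 6 :+ a :⇒ j :≡ 2 :* b :⇒ x :≡ 3 :* r :+ lit 6 :+ b :⇒ :⊥) i j a b r x lt e f e′ f′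
  w-injective {i} {j} {x} lt (inj₁ (a , _ , e , f)) (inj₂ (b , _ , e′ , f′)) = lia 4 (λ a b r x → x :≡ 3 :* r :+ lit 6 :+ a :⇒ x :+ b :≡ 3 :* r :+ lit 5 :⇒ :⊥) a b r x f f′
  w-injective {i} {j} {x} lt (inj₂ (a , _ , e , f)) (inj₁ (b , _ , e′ , f′)) = lia 4 (λ a b r x → x :≡ 3 :* r :+ lit 6 :+ a :⇒ x :+ b :≡ 3 :* r :+ lit 5 :⇒ :⊥) b a r x f′ f
  w-injective {i} {j} {x} lt (inj₂ (a , _ , e , f)) (inj₂ (b , _ , e′ , f′)) = lia 6 (λ i j a b r x → i :< j :⇒ i :≡ lit 1 :+ 2 :* a :⇒ x :+ a :≡ 3 :* r :+ lit 5 :⇒ j :≡ lit 1 :+ 2 :* b :⇒ x :+ b :≡ 3 :* r :+ lit 5 :⇒ :⊥) i j a b r x lt e f e′ f′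

  w-≢ : ∀ {i j} → i < j → j ≤ n → w i ≢ w j
  w-≢ {i} {j} lt h e = w-injective lt (w-spec (ℕ.≤-trans (ℕ.<⇒≤ lt) h)) (subst (W j) (sym e) (w-spec h))

  open module L (Z : ℕ) = Ladder n β w (lia 1 (λ r → 10 :* r :+ lit 19 :< 12 :* r :+ lit 23) r)
    (λ {j} h → lia 2 (λ r x → 2 :* r :+ lit 4 :≤ x :⇒ lit 0 :< x) r (w j) (proj₁ (w-bounds h)))
    (λ {j} h → lia 2 (λ r x → x :≤ 4 :* r :+ lit 7 :⇒ x :< 10 :* r :+ lit 19) r (w j) (proj₂ (w-bounds h)))
    (λ {j} h → w-≢ (ℕ.n<1+n j) h) Z public hiding (apex; w<N)
  open L 0 using (apex; w<N) public

  wₙ : w n ≡ 2 * r + 4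
  wₙ = lia 2 (λ r x → x :+ (r :+ lit 1) :≡ 3 :* r :+ lit 5 :⇒ x :≡ 2 :* r :+ lit 4) r (w n)
    (trans (cong (λ j → w j + (r + 1)) (lia 1 (λ r → lit 1 :+ (2 :* r :+ lit 2) :≡ lit 1 :+ 2 :* (r :+ lit 1)) r)) (w-odd ℕ.≤-refl))

  wₙ′ : w n′ ≡ 4 * r + 7
  wₙ′ = trans (cong w (lia 1 (λ r → 2 :* r :+ lit 2 :≡ 2 :* (r :+ lit 1)) r)) (trans (w-even (r + 1)) (lia 1 (λ r → 3 :* r :+ lit 6 :+ (r :+ lit 1) :≡ 4 :* r :+ lit 7) r))

  ∞ : Fin v
  ∞ = fromℕ< (ℕ.n<1+n N)

  ∞≢pnt : ∀ a → ∞ ≢ pnt a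
  ∞≢pnt a e = ℕ.<⇒≢ (ℕ.m%n<n a N) (trans (sym (toℕ-pnt a)) (trans (cong toℕ (sym e)) (Fin.toℕ-fromℕ< _)))

  -- The end rungs have the differences `3 u` and `2 u` at the apex 0, `5 u` and `4 u` at the apex
  -- `β`. The triple `E` over 0, `3 u`, `5 u` supplies the first three, `I` the last one and the
  -- pairs at ∞.
  E I : ℕ → Block v
  E Z = blockOf junk (at Z 0) (at Z (3 * r + 6)) (at Z (5 * r + 10))
  I Z = blockOf junk ∞ (at Z β) (at Z (2 * r + 4))

  -- Base points of the ladders, in the order in which the triples E link them.
  X : ℕ → ℕ
  X s = u * s

  E-≢ : ∀ Z → at Z 0 ≢ at Z (3 * r + 6) × at Z 0 ≢ at Z (5 * r + 10) × at Z (3 * r + 6) ≢ at Z (5 * r + 10)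
  E-≢ = scalene-≢ (lia 1 (λ r → scalene (12 :* r :+ lit 23) (lit 0) (3 :* r :+ lit 6) (5 :* r :+ lit 10)) r)

  I-≢ : ∀ Z → at Z β ≢ at Z (2 * r + 4)
  I-≢ Z = proj₁ (proj₂ (scalene-≢ (lia 1 (λ r → scalene (12 :* r :+ lit 23) (10 :* r :+ lit 19) (lit 0) (2 :* r :+ lit 4)) r) Z))

  E-∈ : ∀ Z → at Z 0 ∈B E Z × at Z (3 * r + 6) ∈B E Z × at Z (5 * r + 10) ∈B E Z
  E-∈ Z = let ne₁ , ne₂ , ne₃ = E-≢ Z in blockOf-∈ junk ne₁ ne₂ ne₃

  I-∈ : ∀ Z → ∞ ∈B I Z × at Z β ∈B I Z × at Z (2 * r + 4) ∈B I Z
  I-∈ Z = blockOf-∈ junk (∞≢pnt (Z + β)) (∞≢pnt (Z + (2 * r + 4))) (I-≢ Z)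

  R : Bool → ℕ → ℕ → Fin v × Fin v
  R b j s = rung (X s) b j

  X-+ : ∀ k s → X (k + s) ≡ k * u + X s
  X-+ k s = trans (ℕ.*-distribˡ-+ u k s) (cong (_+ u * s) (ℕ.*-comm u k))

  at-period : ∀ k s o → at (X (k * N + s)) o ≡ at (X s) o
  at-period k s o = pnt-cong 0 (k * u) (trans (ℕ.+-identityʳ _) (expand k u N s o))
    where
    expand : ∀ k u N s o → u * (k * N + s) + o ≡ u * s + o + k * u * N
    expand = solve-∀

  R-period : ∀ b j k s → R b j (k * N + s) ≡ R b j s
  R-period b j k s = cong₂ _,_ (at-period k s (apex b)) (at-period k s (w j))

  E-11 : ∀ s → E (X s) ∋ R false 0 s
  E-11 s = let a , b , _ = E-∈ (X s) in subst (E (X s) ∋_) (cong (λ o → at (X s) 0 , at (X s) o) (lia 1 (λ r → 3 :* r :+ lit 6 :≡ 3 :* r :+ lit 6 :+ lit 0) r)) (contains a b (proj₁ (E-≢ (X s))))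

  E-21 : ∀ s → E (X s) ∋ R true 0 (2 + s)
  E-21 s = let a , _ , c = E-∈ (X s) in subst (E (X s) ∋_) (sym (cong₂ _,_
      (same (trans (cong (_+ β) (X-+ 2 s)) (lia 2 (λ x r → 2 :* (lit 2 :+ r) :+ x :+ (10 :* r :+ lit 19) :≡ x :+ lit 0 :+ (12 :* r :+ lit 23)) (X s) r)))
      (cong pnt (trans (cong (_+ w 0) (X-+ 2 s)) (lia 2 (λ x r → 2 :* (lit 2 :+ r) :+ x :+ (3 :* r :+ lit 6 :+ lit 0) :≡ x :+ (5 :* r :+ lit 10)) (X s) r)))))
    (contains a c (proj₁ (proj₂ (E-≢ (X s)))))

  E-1e : ∀ s → E (X s) ∋ R false n (3 + s)
  E-1e s = let _ , b , c = E-∈ (X s) in subst (E (X s) ∋_) (sym (cong₂ _,_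
      (cong pnt (trans (cong (_+ 0) (X-+ 3 s)) (lia 2 (λ x r → 3 :* (lit 2 :+ r) :+ x :+ lit 0 :≡ x :+ (3 :* r :+ lit 6)) (X s) r)))
      (cong pnt (trans (cong₂ _+_ (X-+ 3 s) wₙ) (lia 2 (λ x r → 3 :* (lit 2 :+ r) :+ x :+ (2 :* r :+ lit 4) :≡ x :+ (5 :* r :+ lit 10)) (X s) r)))))
    (contains b c (proj₂ (proj₂ (E-≢ (X s)))))

  I-2e : ∀ s → I (X s) ∋ R true n s
  I-2e s = let _ , b , c = I-∈ (X s) in subst (λ o → I (X s) ∋ (at (X s) β , at (X s) o)) (sym wₙ) (contains b c (I-≢ (X s)))

  ∞-label : ℕ → Fin v × Fin v
  ∞-label s = ∞ , at (X s) (2 * r + 4)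

  I-∞ : ∀ s → I (X s) ∋ ∞-label s
  I-∞ s = let a , _ , c = I-∈ (X s) in contains a c (∞≢pnt (X s + (2 * r + 4)))

  I-∞′ : ∀ s → I (X (4 + s)) ∋ ∞-label s
  I-∞′ s = let a , b , _ = I-∈ (X (4 + s)) in subst (λ y → I (X (4 + s)) ∋ (∞ , y))
      (same (trans (cong (_+ β) (X-+ 4 s)) (lia 2 (λ x r → 4 :* (lit 2 :+ r) :+ x :+ (10 :* r :+ lit 19) :≡ x :+ (2 :* r :+ lit 4) :+ (12 :* r :+ lit 23)) (X s) r)))
    (contains a b (∞≢pnt (X (4 + s) + β)))

  Unit : ℕ → Block v → Set
  Unit s B = Cells (X s) 0 n B ⊎ B ≡ E (X s)

  unit : ∀ s → Trail (R true 0 s) (R true 0 (2 + s)) (2 * n + 1) (Unit s)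
  unit s = loop (X s) true 0 n′ ℕ.≤-refl ⊕ one (E-11 s) (E-21 s)

  run : ∀ s m → Trail (R true 0 s) (R true 0 (2 * m + s)) (m * (2 * n + 1)) (λ B → ∃ λ t → t < m × Unit (2 * t + s) B)
  run s m = iterate (λ t → R true 0 (2 * t + s)) m λ t _ → relabel refl (cong (λ x → R true 0 (x + s)) (sym (ℕ.*-suc 2 t))) (unit (2 * t + s))

  -- As `4 u - 2 u = 2 u`, the triples `I` at the ladders `s` and `s + 4` share a pair through ∞.
  -- Since 4 is prime to `N`, steps of 4 reach all of them, and the trail begins and ends at an end
  -- rung of a ladder.
  ∞-run : Trail (R true n 0) (R true n (4 * (12 * r + 22))) N (λ B → ∃ λ t → t < N × B ≡ I (X (4 * t)))
  ∞-run = weaken (trans (cong suc (trans (cong (_+ 1) (ℕ.*-identityʳ (12 * r + 21))) refl)) (lia 1 (λ r → lit 1 :+ (12 :* r :+ lit 21 :+ lit 1) :≡ 12 :* r :+ lit 23) r)) sorts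
      (one (I-2e 0) (I-∞ 0) ⊕
       (iterate (λ t → ∞-label (4 * t)) (12 * r + 21) λ t _ →
         relabel refl (cong ∞-label (sym (ℕ.*-suc 4 t))) (one (I-∞′ (4 * t)) (I-∞ (4 + 4 * t)))) ⊕
       one (subst (λ x → I (X x) ∋ ∞-label (4 * (12 * r + 21))) last (I-∞′ (4 * (12 * r + 21)))) (I-2e (4 * (12 * r + 22))))
    where
    last : 4 + 4 * (12 * r + 21) ≡ 4 * (12 * r + 22)
    last = lia 1 (λ r → lit 4 :+ 4 :* (12 :* r :+ lit 21) :≡ 4 :* (12 :* r :+ lit 22)) r
    sorts : ∀ {B} → (∃ λ t → t < N × B ≡ I (X (4 * t))) →
            B ≡ I (X 0) ⊎ (∃ λ t → t < 12 * r + 21 × B ≡ I (X (4 + 4 * t))) ⊎ B ≡ I (X (4 * (12 * r + 22)))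
    sorts (zero , _ , e) = inj₁ e
    sorts (suc t , t<N , e) with t ℕ.<? 12 * r + 21
    ... | yes h = inj₂ (inj₁ (t , h , trans e (cong (I ∘ X) (ℕ.*-suc 4 t))))
    ... | no ¬h = inj₂ (inj₂ (trans e (cong (λ t → I (X (4 * t))) (lia 2 (λ t r → lit 1 :+ t :< 12 :* r :+ lit 23 :⇒ 12 :* r :+ lit 21 :≤ t :⇒ lit 1 :+ t :≡ 12 :* r :+ lit 22) t r t<N (ℕ.≮⇒≥ ¬h)))))

module Cycle₀ (r : ℕ) (junk : Block (suc (12 * r + 23))) where

  open Order₀ r junk public

  side-n : ∀ b → side b n ≡ not b
  side-n b = trans (cong (side b) (lia 1 (λ r → lit 1 :+ (2 :* r :+ lit 2) :≡ lit 1 :+ 2 :* (r :+ lit 1)) r)) (side-even (not b) (r + 1))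

  -- The number of columns is odd, so the snake ends at the other apex.
  full-snake : ∀ b s → Trail (R b 0 s) (R (not b) n s) (2 * n) (Cells (X s) 0 n)
  full-snake b s = relabel refl (cong (λ c → R c n s) (side-n b)) (snake (X s) b 0 n ℕ.≤-refl)

  -- Chosen with `2 m = N - 5`: a run of `m` units leads from ladder `-1` to ladder `N - 6`, and
  -- from ladder 2 to ladder `N - 3`.
  m : ℕ
  m = 6 * r + 9

  -- Ladder 0 is visited twice: its last column `P₂` leads from the triples through ∞ to the linking
  -- triples, and its other columns `P₁₀` are traversed on the way back.
  P₂ P₅ P₁₀ : Block v → Set
  P₂ B = B ≡ cell (X 0) true n′ ⊎ B ≡ cell (X 0) false n′
  P₅ B = Cells (X (12 * r + 17)) 0 n B
  P₁₀ B = Cells (X 0) 0 n′ B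

  All-parts : Block v → Set
  All-parts B = (∃ λ t → t < N × B ≡ I (X (4 * t))) ⊎ P₂ B ⊎ B ≡ E (X (12 * r + 20)) ⊎
    (∃ λ t → t < m × Unit (2 * t + (12 * r + 22)) B) ⊎ P₅ B ⊎ B ≡ E (X (12 * r + 17)) ⊎ Cells (X (12 * r + 20)) 0 n B ⊎
    (∃ λ t → t < m × Unit (2 * t + 2) B) ⊎ B ≡ E (X 0) ⊎ P₁₀ B ⊎ Unit (12 * r + 21) B ⊎ B ≡ E (X (12 * r + 19)) ⊎
    Cells (X (12 * r + 19)) 0 n B

  R≡ : ∀ b j k {s t} → s ≡ k * N + t → R b j s ≡ R b j t
  R≡ b j k {t = t} refl = R-period b j k t

  size-sum : N + (2 + (1 + (m * (2 * n + 1) + (2 * n + (1 + (2 * n + (m * (2 * n + 1) + (1 + (2 * n′ + ((2 * n + 1) + (1 + 2 * n))))))))))) ≡ N * (4 * r + 8)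
  size-sum = expand r
    where
    expand : ∀ r → (12 * r + 23) + (2 + (1 + ((6 * r + 9) * (2 * (1 + (2 * r + 2)) + 1) + (2 * (1 + (2 * r + 2)) + (1 + (2 * (1 + (2 * r + 2)) +
      ((6 * r + 9) * (2 * (1 + (2 * r + 2)) + 1) + (1 + (2 * (2 * r + 2) + ((2 * (1 + (2 * r + 2)) + 1) + (1 + 2 * (1 + (2 * r + 2))))))))))))) ≡ (12 * r + 23) * (4 * r + 8)
    expand = solve-∀

  -- E (X s) meets the lower rungs of the ladders s and s + 2 and the upper rung
  -- of the ladder s + 3. Modulo N, the ladders -1, 1, …, N - 6, then N - 3, and
  -- then N - 5, …, 4, 2 are linked in this way; the ladders 0, -2 and -4 lead
  -- back to the triples through ∞.
  abstract

    cycle : Trail (R true n (12 * r + 19)) (R true n (12 * r + 19)) (N * (4 * r + 8)) All-parts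
    cycle = weaken size-sum id
      -- The run through ∞ ends at ladder `4 (N - 1)`, which is `-4` modulo `N`; it is walked from
      -- there back to ladder 0.
      (relabel (R≡ true n 3 (lia 1 (λ r → 4 :* (12 :* r :+ lit 22) :≡ 3 :* (12 :* r :+ lit 23) :+ (12 :* r :+ lit 19)) r)) refl (backwards ∞-run) ⊕
       (one (cell-upper (X 0) true ℕ.≤-refl) (cell-step (X 0) true ℕ.≤-refl) ⊕ one (cell-step (X 0) false ℕ.≤-refl) (cell-upper (X 0) false ℕ.≤-refl)) ⊕
       one (subst (E (X (12 * r + 20)) ∋_) (R≡ false n 1 (lia 1 (λ r → lit 3 :+ (12 :* r :+ lit 20) :≡ 1 :* (12 :* r :+ lit 23) :+ lit 0) r)) (E-1e (12 * r + 20)))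
           (subst (E (X (12 * r + 20)) ∋_) (cong (R true 0) (lia 1 (λ r → lit 2 :+ (12 :* r :+ lit 20) :≡ 12 :* r :+ lit 22) r)) (E-21 (12 * r + 20))) ⊕
       relabel refl (R≡ true 0 1 (lia 1 (λ r → 2 :* (6 :* r :+ lit 9) :+ (12 :* r :+ lit 22) :≡ 1 :* (12 :* r :+ lit 23) :+ (12 :* r :+ lit 17)) r)) (run (12 * r + 22) m) ⊕
       loop (X (12 * r + 17)) true 0 n′ ℕ.≤-refl ⊕
       one (E-11 (12 * r + 17)) (subst (E (X (12 * r + 17)) ∋_) (cong (R false n) (lia 1 (λ r → lit 3 :+ (12 :* r :+ lit 17) :≡ 12 :* r :+ lit 20) r)) (E-1e (12 * r + 17))) ⊕
       backwards (full-snake true (12 * r + 20)) ⊕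
       backwards (relabel refl (cong (R true 0) (lia 1 (λ r → 2 :* (6 :* r :+ lit 9) :+ lit 2 :≡ 12 :* r :+ lit 20) r)) (run 2 m)) ⊕
       one (E-21 0) (E-11 0) ⊕
       weaken (cong (2 *_) (sym (ℕ.+-suc (2 * r) 1))) (λ (b , j , p , q , e) → b , j , p , subst (j <_) (ℕ.+-suc (2 * r) 1) q , e)
         (loop (X 0) false 0 (2 * r + 1) (lia 1 (λ r → lit 1 :+ (2 :* r :+ lit 1) :≤ lit 1 :+ (2 :* r :+ lit 2)) r)) ⊕
       backwards (relabel refl (R≡ true 0 1 (lia 1 (λ r → lit 2 :+ (12 :* r :+ lit 21) :≡ 1 :* (12 :* r :+ lit 23) :+ lit 0) r)) (unit (12 * r + 21))) ⊕
       one (subst (E (X (12 * r + 19)) ∋_) (cong (R true 0) (lia 1 (λ r → lit 2 :+ (12 :* r :+ lit 19) :≡ 12 :* r :+ lit 21) r)) (E-21 (12 * r + 19))) (E-11 (12 * r + 19)) ⊕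
       full-snake false (12 * r + 19))

module Cover₀ (r : ℕ) (junk : Block (suc (12 * r + 23))) where

  open Cycle₀ r junk public

  L : List (Block v)
  L = blocks (walk cycle)

  Placed : ℕ → Set
  Placed s = (∀ b {j} → j < n → All-parts (cell (X s) b j)) × All-parts (E (X s))

  place₀ : Placed 0
  place₀ = cells , (inj₂ (inj₂ (inj₂ (inj₂ (inj₂ (inj₂ (inj₂ (inj₂ (inj₁ refl)))))))))
    where
    by-column : ∀ b {j} → j < n′ ⊎ j ≡ n′ → All-parts (cell (X 0) b j)
    by-column b     {j} (inj₁ lt)   = inj₂ (inj₂ (inj₂ (inj₂ (inj₂ (inj₂ (inj₂ (inj₂ (inj₂ (inj₁ (b , j , z≤n , lt , refl))))))))))
    by-column true      (inj₂ refl) = inj₂ (inj₁ (inj₁ refl))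
    by-column false     (inj₂ refl) = inj₂ (inj₁ (inj₂ refl))
    cells : ∀ b {j} → j < n → All-parts (cell (X 0) b j)
    cells b j<n = by-column b (ℕ.m≤n⇒m<n∨m≡n (s≤s⁻¹ j<n))

  place-run₁ : ∀ {t} → t < m → Placed (2 * t + (12 * r + 22))
  place-run₁ {t} t<m = (λ b {j} j<n → inj₂ (inj₂ (inj₂ (inj₁ (t , t<m , inj₁ (b , j , z≤n , j<n , refl)))))) ,
    (inj₂ (inj₂ (inj₂ (inj₁ (t , t<m , inj₂ refl)))))

  place-run₂ : ∀ {t} → t < m → Placed (2 * t + 2)
  place-run₂ {t} t<m = (λ b {j} j<n → inj₂ (inj₂ (inj₂ (inj₂ (inj₂ (inj₂ (inj₂ (inj₁ (t , t<m , inj₁ (b , j , z≤n , j<n , refl)))))))))) ,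
    (inj₂ (inj₂ (inj₂ (inj₂ (inj₂ (inj₂ (inj₂ (inj₁ (t , t<m , inj₂ refl)))))))))

  place₁₇ : Placed (12 * r + 17)
  place₁₇ = (λ b {j} j<n → inj₂ (inj₂ (inj₂ (inj₂ (inj₁ (b , j , z≤n , j<n , refl)))))) ,
    (inj₂ (inj₂ (inj₂ (inj₂ (inj₂ (inj₁ refl))))))

  place₂₀ : Placed (12 * r + 20)
  place₂₀ = (λ b {j} j<n → inj₂ (inj₂ (inj₂ (inj₂ (inj₂ (inj₂ (inj₁ (b , j , z≤n , j<n , refl)))))))) ,
    (inj₂ (inj₂ (inj₁ refl)))

  place₂₁ : Placed (12 * r + 21)
  place₂₁ = (λ b {j} j<n → inj₂ (inj₂ (inj₂ (inj₂ (inj₂ (inj₂ (inj₂ (inj₂ (inj₂ (inj₂ (inj₁ (inj₁ (b , j , z≤n , j<n , refl))))))))))))) ,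
    (inj₂ (inj₂ (inj₂ (inj₂ (inj₂ (inj₂ (inj₂ (inj₂ (inj₂ (inj₂ (inj₁ (inj₂ refl))))))))))))

  place₁₉ : Placed (12 * r + 19)
  place₁₉ = (λ b {j} j<n → inj₂ (inj₂ (inj₂ (inj₂ (inj₂ (inj₂ (inj₂ (inj₂ (inj₂ (inj₂ (inj₂ (inj₂ (b , j , z≤n , j<n , refl))))))))))))) ,
    (inj₂ (inj₂ (inj₂ (inj₂ (inj₂ (inj₂ (inj₂ (inj₂ (inj₂ (inj₂ (inj₂ (inj₁ refl))))))))))))

  -- The cycle numbers its ladders without reduction modulo `N`, so a ladder may occur under a
  -- number above `N`.
  Located : ℕ → Set
  Located s = ∃₂ λ k s′ → s′ ≡ k * N + s × Placed s′

  place-even : ∀ {s} i → s ≡ 2 * i → s < N → Located s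
  place-even {s} zero    e s<N = 0 , 0 , sym e , place₀
  place-even {s} (suc i) e s<N = cases (ℕ.<-cmp i m)
    where
    cases : _ → Located s
    cases (tri< h _ _) = 0 , 2 * i + 2 , lia 2 (λ s i → s :≡ 2 :* (lit 1 :+ i) :⇒ 2 :* i :+ lit 2 :≡ s) s i e , place-run₂ h
    cases (tri≈ _ h _) = 0 , 12 * r + 20 , lia 3 (λ s i r → s :≡ 2 :* (lit 1 :+ i) :⇒ i :≡ 6 :* r :+ lit 9 :⇒ 12 :* r :+ lit 20 :≡ s) s i r e h , place₂₀
    cases (tri> _ _ h) = 0 , 2 * 0 + (12 * r + 22) , lia 3 (λ s i r → s :≡ 2 :* (lit 1 :+ i) :⇒ s :< 12 :* r :+ lit 23 :⇒ 6 :* r :+ lit 9 :< i :⇒ 12 :* r :+ lit 22 :≡ s) s i r e s<N h ,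
      place-run₁ (lia 1 (λ r → lit 0 :< 6 :* r :+ lit 9) r)

  place-odd : ∀ {s} i → s ≡ suc (2 * i) → s < N → Located s
  place-odd {s} i e s<N = cases (suc i ℕ.<? m) (i ℕ.≟ 6 * r + 8) (i ℕ.≟ 6 * r + 9) (i ℕ.≟ 6 * r + 10)
    where
    cases : Dec (suc i < m) → Dec (i ≡ 6 * r + 8) → Dec (i ≡ 6 * r + 9) → Dec (i ≡ 6 * r + 10) → Located s
    -- The run begins at ladder `-1`, so ladder `2 i + 1` belongs to its unit `i + 1`.
    cases (yes h) _ _ _ = 1 , 2 * suc i + (12 * r + 22) ,
      lia 3 (λ s i r → s :≡ lit 1 :+ 2 :* i :⇒ 2 :* (lit 1 :+ i) :+ (12 :* r :+ lit 22) :≡ 1 :* (12 :* r :+ lit 23) :+ s) s i r e , place-run₁ h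
    cases _ (yes h) _ _ = 0 , 12 * r + 17 , lia 3 (λ s i r → s :≡ lit 1 :+ 2 :* i :⇒ i :≡ 6 :* r :+ lit 8 :⇒ 12 :* r :+ lit 17 :≡ s) s i r e h , place₁₇
    cases _ _ (yes h) _ = 0 , 12 * r + 19 , lia 3 (λ s i r → s :≡ lit 1 :+ 2 :* i :⇒ i :≡ 6 :* r :+ lit 9 :⇒ 12 :* r :+ lit 19 :≡ s) s i r e h , place₁₉
    cases _ _ _ (yes h) = 0 , 12 * r + 21 , lia 3 (λ s i r → s :≡ lit 1 :+ 2 :* i :⇒ i :≡ 6 :* r :+ lit 10 :⇒ 12 :* r :+ lit 21 :≡ s) s i r e h , place₂₁
    cases (no a) (no b) (no c) (no d) = ⊥-elim (lia 3 (λ s i r → s :≡ lit 1 :+ 2 :* i :⇒ s :< 12 :* r :+ lit 23 :⇒ 6 :* r :+ lit 9 :≤ lit 1 :+ i :⇒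
      (i :≡ 6 :* r :+ lit 8 :⇒ :⊥) :⇒ (i :≡ 6 :* r :+ lit 9 :⇒ :⊥) :⇒ (i :≡ 6 :* r :+ lit 10 :⇒ :⊥) :⇒ :⊥) s i r e s<N (ℕ.≮⇒≥ a) b c d)

  place : ∀ s → s < N → Located s
  place s s<N = [ (λ e → place-even ⌊ s /2⌋ e s<N) , (λ e → place-odd ⌊ s /2⌋ e s<N) ]′ (halves s)

  inverse : 12 * u ≡ 1 + 1 * N
  inverse = lia 1 (λ r → 12 :* (lit 2 :+ r) :≡ lit 1 :+ 1 :* (12 :* r :+ lit 23)) r

  -- Since `12 u = N + 1`, the multiples `X s` of `u` run through all residues.
  locate : ∀ Z → ∃ λ s → Placed s × (∀ o → at (X s) o ≡ at Z o)
  locate Z = let t , t<N , e = multiples u 12 1 inverse Z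
                 k , s , s≡ , pl = place t t<N in
    s , pl , λ o → trans (trans (cong (λ s → at (X s) o) s≡) (at-period k t o)) (trans (cong (λ x → pnt (x + o)) (ℕ.*-comm u t)) (e o))

  cells∈L : ∀ Z b {j} → j < n → cell Z b j ∈ L
  cells∈L Z b {j} j<n = let s , pl , e = locate Z in subst (_∈ L) (blockOf-cong junk (e (apex b)) (e (w j)) (e (w (suc j)))) (covers cycle (proj₁ pl b j<n))

  hasE : ∀ Z → Has L (at Z 0) (at Z (3 * r + 6)) (at Z (5 * r + 10))
  hasE Z = let s , pl , e = locate Z in E Z , subst (_∈ L) (blockOf-cong junk (e 0) (e (3 * r + 6)) (e (5 * r + 10))) (covers cycle (proj₂ pl)) , E-∈ Z

  hasI : ∀ Z → Has L ∞ (at Z β) (at Z (2 * r + 4))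
  -- The inverse of `4 u` is `36 u`, because `(12 u)² = (N + 1)²` leaves the remainder 1.
  hasI Z = let t , t<N , e = multiples (4 * u) (12 * (3 * r + 6)) (N + 2) (expand r) Z in
    I Z , subst (_∈ L) (cong₂ (blockOf junk ∞) (trans (move t β) (e β)) (trans (move t (2 * r + 4)) (e (2 * r + 4)))) (covers cycle (inj₁ (t , t<N , refl))) , I-∈ Z
    where
    expand : ∀ r → 12 * (3 * r + 6) * (4 * (2 + r)) ≡ 1 + (12 * r + 23 + 2) * (12 * r + 23)
    expand = solve-∀
    move : ∀ t o → at (X (4 * t)) o ≡ at (t * (4 * u)) o
    move t o = cong (λ x → pnt (x + o)) (rearrange u t)
      where
      rearrange : ∀ u t → u * (4 * t) ≡ t * (4 * u)
      rearrange = solve-∀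

module Solution₀ (r : ℕ) (junk : Block (suc (12 * r + 23))) where

  open Cover₀ r junk

  n>0 : 0 < n
  n>0 = s≤s z≤n

  first-covered : ∀ Z b → Covered L (at Z (apex b)) (at Z (w 0))
  first-covered Z false = covered-spread Z 0 (3 * r + 6 + 0) (3 * r + 5) (5 * r + 10)
    (lia 1 (λ r → spread (12 :* r :+ lit 23) (lit 0) (3 :* r :+ lit 6 :+ lit 0) (3 :* r :+ lit 5) (5 :* r :+ lit 10)) r)
    (has-cell Z (cells∈L Z) false n>0)
    (has-shift refl (cong pnt (lia 2 (λ Z r → Z :+ (3 :* r :+ lit 6) :≡ Z :+ (3 :* r :+ lit 6 :+ lit 0)) Z r)) refl (hasE Z))
  first-covered Z true = covered-spread Z β (3 * r + 6 + 0) (3 * r + 5) (r + 2)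
    (lia 1 (λ r → spread (12 :* r :+ lit 23) (10 :* r :+ lit 19) (3 :* r :+ lit 6 :+ lit 0) (3 :* r :+ lit 5) (r :+ lit 2)) r)
    (has-cell Z (cells∈L Z) true n>0)
    -- Translation by `β = -2 u` takes the pair `0, 5 u` of `E` to `β, 3 u`.
    (has₁₃ (has-shift
      (cong pnt (ℕ.+-identityʳ (Z + β)))
      (same (lia 2 (λ Z r → Z :+ (10 :* r :+ lit 19) :+ (3 :* r :+ lit 6) :≡ Z :+ (r :+ lit 2) :+ (12 :* r :+ lit 23)) Z r))
      (same (lia 2 (λ Z r → Z :+ (10 :* r :+ lit 19) :+ (5 :* r :+ lit 10) :≡ Z :+ (3 :* r :+ lit 6 :+ lit 0) :+ (12 :* r :+ lit 23)) Z r))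
      (hasE (Z + β))))

  has-last : ∀ Z b → Has L (at Z (apex b)) (at Z (2 * r + 4)) (at Z (4 * r + 7))
  has-last Z b = has₁₃ (has-shift refl (cong (at Z) wₙ′) (cong (at Z) wₙ) (has-cell Z (cells∈L Z) b ℕ.≤-refl))

  -- At the apex 0 the second block is `E` translated by `-3 u`, that is by `9 r + 17`, whose pair
  -- `3 u, 5 u` becomes `0, 2 u`; at the apex `β` it is `I`.
  last-covered : ∀ Z b → Covered L (at Z (apex b)) (at Z (2 * r + 4))
  last-covered Z false = covered-spread Z 0 (2 * r + 4) (4 * r + 7) (9 * r + 17)
    (lia 1 (λ r → spread (12 :* r :+ lit 23) (lit 0) (2 :* r :+ lit 4) (4 :* r :+ lit 7) (9 :* r :+ lit 17)) r)
    (has-last Z false)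
    (has₂₃ (has-shift
      (cong pnt (lia 2 (λ Z r → Z :+ (9 :* r :+ lit 17) :+ lit 0 :≡ Z :+ (9 :* r :+ lit 17)) Z r))
      (same (lia 2 (λ Z r → Z :+ (9 :* r :+ lit 17) :+ (3 :* r :+ lit 6) :≡ Z :+ lit 0 :+ (12 :* r :+ lit 23)) Z r))
      (same (lia 2 (λ Z r → Z :+ (9 :* r :+ lit 17) :+ (5 :* r :+ lit 10) :≡ Z :+ (2 :* r :+ lit 4) :+ (12 :* r :+ lit 23)) Z r))
      (hasE (Z + (9 * r + 17)))))
  last-covered Z true = covered (offsets Z (λ e → β≢ e) β<N 2<N) (offsets Z (λ e → β≢′ e) β<N 4<N) (offsets Z (λ e → 2≢4 e) 2<N 4<N)
      (∞≢pnt (Z + β) ∘ sym) (∞≢pnt (Z + (2 * r + 4)) ∘ sym) (∞≢pnt (Z + (4 * r + 7)) ∘ sym) (has-last Z true) (has₂₃ (hasI Z))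
    where
    β<N = lia 1 (λ r → 10 :* r :+ lit 19 :< 12 :* r :+ lit 23) r
    2<N = lia 1 (λ r → 2 :* r :+ lit 4 :< 12 :* r :+ lit 23) r
    4<N = lia 1 (λ r → 4 :* r :+ lit 7 :< 12 :* r :+ lit 23) r
    β≢ = lia 1 (λ r → 10 :* r :+ lit 19 :≡ 2 :* r :+ lit 4 :⇒ :⊥) r
    β≢′ = lia 1 (λ r → 10 :* r :+ lit 19 :≡ 4 :* r :+ lit 7 :⇒ :⊥) r
    2≢4 = lia 1 (λ r → 2 :* r :+ lit 4 :≡ 4 :* r :+ lit 7 :⇒ :⊥) r

  rung-pair : ∀ Z b {j} → j ≤ n → Covered L (at Z (apex b)) (at Z (w j))
  rung-pair Z b = rungs-covered Z (cells∈L Z) b (s≤s (lia 1 (λ r → lit 1 :≤ 2 :* r :+ lit 2) r))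
    (λ {j} h → w-≢ (ℕ.m<n⇒m<1+n (ℕ.n<1+n j)) h)
    (first-covered Z b) (subst (λ o → Covered L (at Z (apex b)) (at Z o)) (sym wₙ) (last-covered Z b))

  w-onto : ∀ x → 2 * r + 4 ≤ x → x ≤ 4 * r + 7 → ∃ λ j → j ≤ n × w j ≡ x
  w-onto x lo hi with x ℕ.≤? 3 * r + 5
  ... | yes h = suc (2 * i) , s≤s (lia 3 (λ x i r → x :+ i :≡ 3 :* r :+ lit 5 :⇒ 2 :* r :+ lit 4 :≤ x :⇒ 2 :* i :≤ 2 :* r :+ lit 2) x i r (ℕ.m+[n∸m]≡n h) lo) ,
        trans (zigzag-odd p q i) (ℕ.m∸[m∸n]≡n h)
    where
    i = 3 * r + 5 ∸ x
  ... | no h = 2 * i , lia 3 (λ x i r → 3 :* r :+ lit 6 :+ i :≡ x :⇒ x :≤ 4 :* r :+ lit 7 :⇒ 2 :* i :≤ lit 1 :+ (2 :* r :+ lit 2)) x i r e hi , trans (w-even i) e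
    where
    i = x ∸ (3 * r + 6)
    e : 3 * r + 6 + i ≡ x
    e = ℕ.m+[n∸m]≡n (lia 2 (λ x r → 3 :* r :+ lit 5 :< x :⇒ 3 :* r :+ lit 6 :≤ x) x r (ℕ.≰⇒> h))

  pairs : ∀ Y d → 0 < d → d ≤ 6 * r + 11 → Covered L (pnt Y) (pnt (Y + d))
  pairs Y (suc j) _ d≤ = cases (suc j ℕ.≤? n) (suc j ℕ.≤? 4 * r + 7) (halves j)
    where
    cases : Dec (suc j ≤ n) → Dec (suc j ≤ 4 * r + 7) → j ≡ 2 * ⌊ j /2⌋ ⊎ j ≡ suc (2 * ⌊ j /2⌋) → Covered L (pnt Y) (pnt (Y + suc j))
    cases (yes h) _ (inj₁ e) = aligned Y (suc j) {w (suc j)} {w j} (ℕ.<⇒≤ (w<N h))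
        (lia 5 (λ j i r x y → j :≡ 2 :* i :⇒ x :≡ 3 :* r :+ lit 6 :+ i :⇒ y :+ i :≡ 3 :* r :+ lit 5 :⇒ x :≡ y :+ (lit 1 :+ j)) j ⌊ j /2⌋ r (w j) (w (suc j)) e
          (trans (cong w e) (w-even ⌊ j /2⌋))
          (trans (cong (λ j′ → w (suc j′) + ⌊ j /2⌋) e)
            (w-odd (lia 3 (λ j i r → j :≡ 2 :* i :⇒ lit 1 :+ j :≤ lit 1 :+ (2 :* r :+ lit 2) :⇒ i :≤ r :+ lit 1) j ⌊ j /2⌋ r e h))))
        λ Z → Covered-sym (step-covered Z (cells∈L Z) h)
    cases (yes h) _ (inj₂ e) = aligned Y (suc j) {w j} {w (suc j)} (ℕ.<⇒≤ (w<N (ℕ.<⇒≤ h)))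
        (lia 5 (λ j i r x y → j :≡ lit 1 :+ 2 :* i :⇒ y :≡ 3 :* r :+ lit 6 :+ (lit 1 :+ i) :⇒ x :+ i :≡ 3 :* r :+ lit 5 :⇒ y :≡ x :+ (lit 1 :+ j)) j ⌊ j /2⌋ r (w j) (w (suc j)) e
          (trans (cong w (trans (cong suc e) (sym (ℕ.*-suc 2 ⌊ j /2⌋)))) (w-even (suc ⌊ j /2⌋)))
          (trans (cong (λ j′ → w j′ + ⌊ j /2⌋) e)
            (w-odd (lia 3 (λ j i r → j :≡ lit 1 :+ 2 :* i :⇒ lit 1 :+ j :≤ lit 1 :+ (2 :* r :+ lit 2) :⇒ i :≤ r :+ lit 1) j ⌊ j /2⌋ r e h))))
        λ Z → step-covered Z (cells∈L Z) h
    cases (no h) (yes h′) _ = let i , i≤n , e = w-onto (suc j) (lia 2 (λ j r → lit 1 :+ (2 :* r :+ lit 2) :< lit 1 :+ j :⇒ 2 :* r :+ lit 4 :≤ lit 1 :+ j) j r (ℕ.≰⇒> h)) h′ in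
        aligned Y (suc j) {0} {w i} z≤n e λ Z → rung-pair Z false i≤n
    -- The apex `β` is `-2 u`, so its rung to the path vertex `x` has the difference `x + 2 u`.
    cases (no _) (no h′) _ = let i , i≤n , e = w-onto x lo hi in
        transport (same (lia 2 (λ Y r → Y :+ (2 :* r :+ lit 4) :+ (10 :* r :+ lit 19) :≡ Y :+ (12 :* r :+ lit 23)) Y r))
          (cong pnt (trans (cong (Y + (2 * r + 4) +_) e) (trans (ℕ.+-assoc Y (2 * r + 4) x) (cong (Y +_) (ℕ.m+[n∸m]≡n 2r+4≤d)))))
          (rung-pair (Y + (2 * r + 4)) true i≤n)
      where
      x = suc j ∸ (2 * r + 4)
      2r+4≤d : 2 * r + 4 ≤ suc j
      2r+4≤d = lia 2 (λ j r → 4 :* r :+ lit 7 :< lit 1 :+ j :⇒ 2 :* r :+ lit 4 :≤ lit 1 :+ j) j r (ℕ.≰⇒> h′)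
      lo : 2 * r + 4 ≤ x
      lo = lia 3 (λ j r x → 2 :* r :+ lit 4 :+ x :≡ lit 1 :+ j :⇒ 4 :* r :+ lit 7 :< lit 1 :+ j :⇒ 2 :* r :+ lit 4 :≤ x) j r x (ℕ.m+[n∸m]≡n 2r+4≤d) (ℕ.≰⇒> h′)
      hi : x ≤ 4 * r + 7
      hi = lia 3 (λ j r x → 2 :* r :+ lit 4 :+ x :≡ lit 1 :+ j :⇒ lit 1 :+ j :≤ 6 :* r :+ lit 11 :⇒ x :≤ 4 :* r :+ lit 7) j r x (ℕ.m+[n∸m]≡n 2r+4≤d) d≤

  -- The point `Y` is the second point of one translate of `I` and the third point of another; the
  -- remaining points of these blocks are `Y - 4 u` and `Y + 4 u`.
  infinite : ∀ Y → Covered L ∞ (pnt Y)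
  infinite Y = covered (∞≢pnt Y) (∞≢pnt (Y + (8 * r + 15))) (Y≢ (λ e → ne₁ e) 8<N) (∞≢pnt (Y + (4 * r + 8))) (Y≢ (λ e → ne₂ e) 4<N)
      (offsets Y (λ e → ne₃ e) 8<N 4<N)
      (has₁₃ (shift₁ (hasI (Y + (10 * r + 19))))) (shift₂ (hasI (Y + (2 * r + 4))))
    where
    8<N = lia 1 (λ r → 8 :* r :+ lit 15 :< 12 :* r :+ lit 23) r
    4<N = lia 1 (λ r → 4 :* r :+ lit 8 :< 12 :* r :+ lit 23) r
    ne₁ = lia 1 (λ r → lit 0 :≡ 8 :* r :+ lit 15 :⇒ :⊥) r
    ne₂ = lia 1 (λ r → lit 0 :≡ 4 :* r :+ lit 8 :⇒ :⊥) r
    ne₃ = lia 1 (λ r → 8 :* r :+ lit 15 :≡ 4 :* r :+ lit 8 :⇒ :⊥) r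
    Y≢ : ∀ {a} → 0 ≢ a → a < N → pnt Y ≢ pnt (Y + a)
    Y≢ {a} ne a<N e = offsets Y ne (ℕ.≤-<-trans z≤n a<N) a<N (trans (cong pnt (ℕ.+-identityʳ Y)) e)
    at-∞ : ∀ {y z y′ z′} → y ≡ y′ → z ≡ z′ → Has L ∞ y z → Has L ∞ y′ z′
    at-∞ = subst₂ (Has L ∞)
    shift₁ : Has L ∞ (at (Y + (10 * r + 19)) β) (at (Y + (10 * r + 19)) (2 * r + 4)) → Has L ∞ (pnt (Y + (8 * r + 15))) (pnt Y)
    shift₁ = at-∞ (same (lia 2 (λ Y r → Y :+ (10 :* r :+ lit 19) :+ (10 :* r :+ lit 19) :≡ Y :+ (8 :* r :+ lit 15) :+ (12 :* r :+ lit 23)) Y r))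
                  (same (lia 2 (λ Y r → Y :+ (10 :* r :+ lit 19) :+ (2 :* r :+ lit 4) :≡ Y :+ (12 :* r :+ lit 23)) Y r))
    shift₂ : Has L ∞ (at (Y + (2 * r + 4)) β) (at (Y + (2 * r + 4)) (2 * r + 4)) → Has L ∞ (pnt Y) (pnt (Y + (4 * r + 8)))
    shift₂ = at-∞ (same (lia 2 (λ Y r → Y :+ (2 :* r :+ lit 4) :+ (10 :* r :+ lit 19) :≡ Y :+ (12 :* r :+ lit 23)) Y r))
                  (cong pnt (lia 2 (λ Y r → Y :+ (2 :* r :+ lit 4) :+ (2 :* r :+ lit 4) :≡ Y :+ (4 :* r :+ lit 8)) Y r))

  classify : ∀ x → x ≡ ∞ ⊎ (toℕ x < N)
  classify x with ℕ.m≤n⇒m<n∨m≡n (s≤s⁻¹ (Fin.toℕ<n x))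
  ... | inj₁ lt = inj₂ lt
  ... | inj₂ e  = inj₁ (Fin.toℕ-injective (trans e (sym (Fin.toℕ-fromℕ< _))))

  two-covered : TwoCovered L
  two-covered {x} {y} x≢y = cases (classify x) (classify y)
    where
    cases : x ≡ ∞ ⊎ toℕ x < N → y ≡ ∞ ⊎ toℕ y < N → Covered L x y
    cases (inj₁ p)  (inj₁ q)  = ⊥-elim (x≢y (trans p (sym q)))
    cases (inj₁ p)  (inj₂ hy) = subst₂ (Covered L) (sym p) (pnt-toℕ hy) (infinite (toℕ y))
    cases (inj₂ hx) (inj₁ q)  = Covered-sym (subst₂ (Covered L) (sym q) (pnt-toℕ hx) (infinite (toℕ x)))
    cases (inj₂ hx) (inj₂ hy) = subst₂ (Covered L) (pnt-toℕ hx) (pnt-toℕ hy)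
      (circular (6 * r + 11) (lia 1 (λ r → 12 :* r :+ lit 23 :≤ lit 1 :+ 2 :* (6 :* r :+ lit 11)) r) pairs hx hy (x≢y ∘ Fin.toℕ-injective))

  solution : Σ (List (Block v)) λ Bs → IsTS v 2 Bs × IsSimple Bs × HasCyclicGrayCode Bs
  solution = finish cycle two-covered (expand r)
      (ℕ.*-mono-≤ {2} {N} {1} {4 * r + 8} (lia 1 (λ r → lit 2 :≤ 12 :* r :+ lit 23) r) (lia 1 (λ r → lit 1 :≤ 4 :* r :+ lit 8) r))
    where
    expand : ∀ r → (12 * r + 23) * (4 * r + 8) * 3 ≡ (1 + (12 * r + 23)) * (12 * r + 23)
    expand = solve-∀

-- The orders 4 and 12, by evaluation

module Explicit (v : ℕ) (junk : Block v) (triples : List (ℕ × ℕ × ℕ)) where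

  Bs : List (Block v)
  Bs = map (λ (a , b , c) → build junk a b c) triples

  open import Data.List.Relation.Unary.Unique.DecPropositional (_≟ᴮ_ {v}) using (unique?)

  adjacent? : ∀ B C → Dec (Adjacent2 {v} B C)
  adjacent? B C = intersectionSize B C ℕ.≟ 2

  chain? : ∀ Cs → Dec (Chain {v} Cs)
  chain? []           = yes chain-[]
  chain? (B ∷ [])     = yes (chain-[-] B)
  chain? (B ∷ C ∷ Cs) = map′ (λ (a , c) → chain-∷ B C Cs a c) (λ { (chain-∷ _ _ _ a c) → a , c }) (adjacent? B C ×-dec chain? (C ∷ Cs))

  lastAdj? : ∀ B Cs → Dec (LastAdj {v} B Cs)
  lastAdj? B []           = yes _
  lastAdj? B (C ∷ [])     = adjacent? C B
  lastAdj? B (C ∷ D ∷ Cs) = lastAdj? B (D ∷ Cs)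

  cyclic? : ∀ Cs → Dec (CyclicChain {v} Cs)
  cyclic? []       = yes _
  cyclic? (B ∷ Cs) = chain? (B ∷ Cs) ×-dec lastAdj? B (B ∷ Cs)

  system? : Dec (IsTS v 2 Bs)
  system? = Fin.all? λ x → Fin.all? λ y → (toℕ x ℕ.<? toℕ y) →-dec (pairCount Bs x y ℕ.≟ 2)

  explicit : {_ : True system?} {_ : True (unique? Bs)} {_ : True (cyclic? Bs)} →
             Σ (List (Block v)) λ Bs → IsTS v 2 Bs × IsSimple Bs × HasCyclicGrayCode Bs
  explicit {s} {u} {c} = Bs , toWitness s , toWitness u , Bs , ↭-refl , toWitness c

triple : ∀ v (a b c : ℕ) {_ : True (a ℕ.<? b)} {_ : True (b ℕ.<? c)} {_ : True (c ℕ.<? v)} → Block v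
triple v a b c {p} {q} {r} = block (fromℕ< (ℕ.<-trans a<b (ℕ.<-trans b<c c<v))) (fromℕ< (ℕ.<-trans b<c c<v)) (fromℕ< c<v)
    (subst₂ _<_ (sym (Fin.toℕ-fromℕ< _)) (sym (Fin.toℕ-fromℕ< _)) a<b) (subst₂ _<_ (sym (Fin.toℕ-fromℕ< _)) (sym (Fin.toℕ-fromℕ< _)) b<c)
  where
  a<b = toWitness p
  b<c = toWitness q
  c<v = toWitness r

GrayTS : ℕ → ℕ → Set
GrayTS v λ′ = Σ (List (Block v)) λ Bs → IsTS v λ′ Bs × IsSimple Bs × HasCyclicGrayCode Bs

order-4 : GrayTS 4 2
order-4 = Explicit.explicit 4 (triple 4 0 1 2) ((0 , 1 , 2) ∷ (0 , 1 , 3) ∷ (0 , 2 , 3) ∷ (1 , 2 , 3) ∷ [])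

-- With `u = 1` a ladder would have a single column, and ladder 0 could not be divided between its
-- two visits in the general cycle.
order-12 : GrayTS 12 2
order-12 = Explicit.explicit 12 (triple 12 0 1 2)
  ((0 , 2 , 3) ∷ (2 , 3 , 9) ∷ (2 , 9 , 11) ∷ (2 , 6 , 11) ∷ (2 , 6 , 7) ∷ (2 , 5 , 7) ∷ (2 , 4 , 5) ∷ (0 , 4 , 5) ∷ (0 , 3 , 5) ∷
   (3 , 5 , 6) ∷ (3 , 6 , 8) ∷ (6 , 8 , 9) ∷ (4 , 8 , 9) ∷ (4 , 7 , 9) ∷ (4 , 6 , 7) ∷ (1 , 4 , 6) ∷ (1 , 5 , 6) ∷ (1 , 5 , 11) ∷
   (5 , 9 , 11) ∷ (5 , 9 , 10) ∷ (7 , 9 , 10) ∷ (1 , 7 , 10) ∷ (0 , 1 , 7) ∷ (0 , 7 , 11) ∷ (0 , 4 , 11) ∷ (4 , 8 , 11) ∷ (1 , 8 , 11) ∷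
   (1 , 2 , 8) ∷ (1 , 2 , 10) ∷ (2 , 4 , 10) ∷ (3 , 4 , 10) ∷ (1 , 3 , 4) ∷ (1 , 3 , 9) ∷ (0 , 1 , 9) ∷ (0 , 6 , 9) ∷ (0 , 6 , 10) ∷
   (6 , 10 , 11) ∷ (3 , 10 , 11) ∷ (3 , 7 , 11) ∷ (3 , 7 , 8) ∷ (5 , 7 , 8) ∷ (5 , 8 , 10) ∷ (0 , 8 , 10) ∷ (0 , 2 , 8) ∷ [])

-- Division by 2 and by 3 modulo m

thirds : ∀ i → ∃ λ j → i ≡ 3 * j ⊎ i ≡ 1 + 3 * j ⊎ i ≡ 2 + 3 * j
thirds zero                = 0 , inj₁ refl
thirds (suc zero)          = 0 , inj₂ (inj₁ refl)
thirds (suc (suc zero))    = 0 , inj₂ (inj₂ refl)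
thirds (suc (suc (suc i))) with thirds i
... | j , inj₁ e        = suc j , inj₁ (lia 2 (λ i j → i :≡ 3 :* j :⇒ lit 3 :+ i :≡ 3 :* (lit 1 :+ j)) i j e)
... | j , inj₂ (inj₁ e) = suc j , inj₂ (inj₁ (lia 2 (λ i j → i :≡ lit 1 :+ 3 :* j :⇒ lit 3 :+ i :≡ lit 1 :+ 3 :* (lit 1 :+ j)) i j e))
... | j , inj₂ (inj₂ e) = suc j , inj₂ (inj₂ (lia 2 (λ i j → i :≡ lit 2 :+ 3 :* j :⇒ lit 3 :+ i :≡ lit 2 :+ 3 :* (lit 1 :+ j)) i j e))

module Division (m : ℕ) {{_ : NonZero m}} where

  open Classes m

  congruent : (m a x i : Term) → Formula
  congruent m a x i = a :< m :∧ near m x i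

  -- If the residue `y` with `a + y = i` is even, its half will do. Otherwise `y + m` is even, and
  -- its half is `⌊ y /2⌋ + h + 1`.
  halve : ∀ h → m ≡ 1 + 2 * h → ∀ {i a} → i < m → a < m → ∃ λ c → c < m × 2 * c + a ≈ i
  halve h m≡ {i} {a} i<m a<m with complement a i | complement-spec {a} {i} (ℕ.≤-trans (ℕ.<⇒≤ a<m) (ℕ.m≤m+n m _)) i<m
  ... | y | y<m , (_ , e) with halves y
  ...   | inj₁ e′ = ⌊ y /2⌋ , lia 5 (λ y c m i a → y :≡ 2 :* c :⇒ y :< m :⇒ i :< m :⇒ residue m (a :+ y) i :⇒
            congruent m c (2 :* c :+ a) i) y ⌊ y /2⌋ m i a e′ y<m i<m e
  ...   | inj₂ e′ = suc (⌊ y /2⌋ + h) , lia 6 (λ y c m i a h → y :≡ lit 1 :+ 2 :* c :⇒ m :≡ lit 1 :+ 2 :* h :⇒ y :< m :⇒ i :< m :⇒ a :< m :⇒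
            residue m (a :+ y) i :⇒ congruent m (lit 1 :+ (c :+ h)) (2 :* (lit 1 :+ (c :+ h)) :+ a) i) y ⌊ y /2⌋ m i a h e′ m≡ y<m i<m a<m e

  -- One of `i`, `i + m`, `i + 2 m` is divisible by 3, because `m` is not; the witnesses, here and
  -- in `divide₃-5`, are the quotients.
  divide₃-1 : ∀ q → m ≡ 1 + 6 * q → ∀ {i} → i < m → ∃ λ a → a < m × 3 * a ≈ i
  divide₃-1 q m≡ {i} i<m with thirds i
  ... | j , inj₁ e        = j , lia 4 (λ i j m q → i :≡ 3 :* j :⇒ i :< m :⇒ congruent m j (3 :* j) i) i j m q e i<m
  ... | j , inj₂ (inj₁ e) = j + 4 * q + 1 , lia 4 (λ i j m q → m :≡ lit 1 :+ 6 :* q :⇒ i :≡ lit 1 :+ 3 :* j :⇒ i :< m :⇒ congruent m (j :+ 4 :* q :+ lit 1) (3 :* (j :+ 4 :* q :+ lit 1)) i) i j m q m≡ e i<m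
  ... | j , inj₂ (inj₂ e) = j + 2 * q + 1 , lia 4 (λ i j m q → m :≡ lit 1 :+ 6 :* q :⇒ i :≡ lit 2 :+ 3 :* j :⇒ i :< m :⇒ congruent m (j :+ 2 :* q :+ lit 1) (3 :* (j :+ 2 :* q :+ lit 1)) i) i j m q m≡ e i<m

  divide₃-5 : ∀ q → m ≡ 5 + 6 * q → ∀ {i} → i < m → ∃ λ a → a < m × 3 * a ≈ i
  divide₃-5 q m≡ {i} i<m with thirds i
  ... | j , inj₁ e        = j , lia 4 (λ i j m q → i :≡ 3 :* j :⇒ i :< m :⇒ congruent m j (3 :* j) i) i j m q e i<m
  ... | j , inj₂ (inj₁ e) = j + 2 * q + 2 , lia 4 (λ i j m q → m :≡ lit 5 :+ 6 :* q :⇒ i :≡ lit 1 :+ 3 :* j :⇒ i :< m :⇒ congruent m (j :+ 2 :* q :+ lit 2) (3 :* (j :+ 2 :* q :+ lit 2)) i) i j m q m≡ e i<m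
  ... | j , inj₂ (inj₂ e) = j + 4 * q + 4 , lia 4 (λ i j m q → m :≡ lit 5 :+ 6 :* q :⇒ i :≡ lit 2 :+ 3 :* j :⇒ i :< m :⇒ congruent m (j :+ 4 :* q :+ lit 4) (3 :* (j :+ 4 :* q :+ lit 4)) i) i j m q m≡ e i<m

-- The two residues of v modulo 12

first-block : ∀ v → 3 ≤ v → Block v
first-block v (s≤s (s≤s (s≤s z≤n))) = triple v 0 1 2

residue-0 : ∀ q k → 1 ≤ k → 2 * k ≤ 12 * q ∸ 2 → GrayTS (12 * q) (2 * k)
residue-0 zero k 1≤k h = ⊥-elim (lia 1 (λ k → lit 1 :≤ k :⇒ 2 :* k :≤ lit 0 :⇒ :⊥) k 1≤k h)
residue-0 (suc zero) (suc zero) _ _ = order-12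
residue-0 (suc (suc r)) (suc zero) _ _ = subst (λ v → GrayTS v 2) v≡ (Solution₀.solution r (first-block _ (lia 1 (λ r → lit 3 :≤ lit 1 :+ (12 :* r :+ lit 23)) r)))
  where
  v≡ : suc (12 * r + 23) ≡ 12 * suc (suc r)
  v≡ = lia 1 (λ r → lit 1 :+ (12 :* r :+ lit 23) :≡ 12 :* (lit 2 :+ r)) r
residue-0 (suc q) (suc (suc k)) _ h = Large.large (5 + 6 * q) (2 + k) (12 * suc q) (s≤s (s≤s (s≤s (s≤s (s≤s z≤n))))) (s≤s (s≤s z≤n))
    (lia 3 (λ k q c → 2 :* (lit 2 :+ k) :≤ c :⇒ lit 2 :+ c :≡ 12 :* (lit 1 :+ q) :⇒ lit 2 :+ k :≤ lit 5 :+ 6 :* q) k q (12 * suc q ∸ 2) h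
      (ℕ.m+[n∸m]≡n (lia 1 (λ q → lit 2 :≤ 12 :* (lit 1 :+ q)) q)))
    (lia 1 (λ q → 12 :* (lit 1 :+ q) :≡ 2 :* (lit 5 :+ 6 :* q) :+ lit 2) q)
    (first-block _ (lia 1 (λ q → lit 3 :≤ 12 :* (lit 1 :+ q)) q))
    (Division.halve (5 + 6 * q) (2 + 3 * q) (lia 1 (λ q → lit 5 :+ 6 :* q :≡ lit 1 :+ 2 :* (lit 2 :+ 3 :* q)) q))
    (Division.divide₃-5 (5 + 6 * q) q refl)

residue-4 : ∀ q k → 1 ≤ k → 2 * k ≤ 12 * q + 4 ∸ 2 → GrayTS (12 * q + 4) (2 * k)
residue-4 zero (suc zero) _ _ = order-4
residue-4 zero (suc (suc k)) _ h = ⊥-elim (lia 1 (λ k → 2 :* (lit 2 :+ k) :≤ lit 2 :⇒ :⊥) k h)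
residue-4 (suc q) (suc zero) _ _ = Order₄.solution (suc q) (12 * suc q + 4) (s≤s z≤n) refl (first-block _ (lia 1 (λ q → lit 3 :≤ 12 :* (lit 1 :+ q) :+ lit 4) q))
residue-4 (suc q) (suc (suc k)) _ h = Large.large (7 + 6 * q) (2 + k) (12 * suc q + 4) (s≤s (s≤s (s≤s (s≤s (s≤s z≤n))))) (s≤s (s≤s z≤n))
    (lia 3 (λ k q c → 2 :* (lit 2 :+ k) :≤ c :⇒ lit 2 :+ c :≡ 12 :* (lit 1 :+ q) :+ lit 4 :⇒ lit 2 :+ k :≤ lit 7 :+ 6 :* q) k q (12 * suc q + 4 ∸ 2) h
      (ℕ.m+[n∸m]≡n (lia 1 (λ q → lit 2 :≤ 12 :* (lit 1 :+ q) :+ lit 4) q)))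
    (lia 1 (λ q → 12 :* (lit 1 :+ q) :+ lit 4 :≡ 2 :* (lit 7 :+ 6 :* q) :+ lit 2) q)
    (first-block _ (lia 1 (λ q → lit 3 :≤ 12 :* (lit 1 :+ q) :+ lit 4) q))
    (Division.halve (7 + 6 * q) (3 + 3 * q) (lia 1 (λ q → lit 7 :+ 6 :* q :≡ lit 1 :+ 2 :* (lit 3 :+ 3 :* q)) q))
    (Division.divide₃-1 (7 + 6 * q) (suc q) (lia 1 (λ q → lit 7 :+ 6 :* q :≡ lit 1 :+ 6 :* (lit 1 :+ q)) q))

theorem1 : (v λ' : ℕ) →
    ((v % 12 ≡ 0) ⊎ (v % 12 ≡ 4)) →
    (Σ ℕ λ k → λ' ≡ 2 * k) →
    2 ≤ λ' → λ' ≤ v ∸ 2 →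
    Σ (List (Block v)) λ Bs → IsTS v λ' Bs × IsSimple Bs × HasCyclicGrayCode Bs
theorem1 v _ (inj₁ e) (k , refl) 2≤λ λ≤ = subst (λ v → GrayTS v (2 * k)) (sym v≡)
    (residue-0 (v / 12) k (ℕ.*-cancelˡ-≤ 2 2≤λ) (subst (λ v → 2 * k ≤ v ∸ 2) v≡ λ≤))
  where
  v≡ : v ≡ 12 * (v / 12)
  v≡ = trans (ℕ.m≡m%n+[m/n]*n v 12) (trans (cong (_+ v / 12 * 12) e) (ℕ.*-comm (v / 12) 12))
theorem1 v _ (inj₂ e) (k , refl) 2≤λ λ≤ = subst (λ v → GrayTS v (2 * k)) (sym v≡)
    (residue-4 (v / 12) k (ℕ.*-cancelˡ-≤ 2 2≤λ) (subst (λ v → 2 * k ≤ v ∸ 2) v≡ λ≤))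
  where
  v≡ : v ≡ 12 * (v / 12) + 4
  v≡ = trans (ℕ.m≡m%n+[m/n]*n v 12) (trans (cong₂ _+_ e (ℕ.*-comm (v / 12) 12)) (ℕ.+-comm 4 (12 * (v / 12))))
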